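{- Let $P\subseteq\mathbb{R}^2$ be a half-integral pseudo-integral polygon with $i(P)>0$ and $b(P)\ge 2i(P)+7$. Then $b(P)=2i(P)+7$.
   Context: A rational polygon is half-integral if the smallest positive integer $d$ such that $dP$ has all vertices in $\mathbb{Z}^2$ is $2$. It is pseudo-integral if its Ehrhart quasi-polynomial ($L_P(k)=|kP\cap\mathbb{Z}^2|$ for positive integers $k$) is a polynomial. $i(P)$, $b(P)$ are the numbers of interior and boundary lattice points of $P$. -}

module Defs where

open import Data.Nat using (ℕ; suc; _≤_)
open import Data.Integer using (ℤ; +_)
open import Data.Rational as Q using (ℚ; _/_; 0ℚ)
open import Data.Product using (_×_; _,_; Σ; ∃)
open import Data.List using (List; []; _∷_; _++_; [_]; zip; length)
open import Data.List.Relation.Unary.All using (All)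
open import Data.List.Relation.Unary.Any using (Any)
open import Data.List.Membership.Propositional using (_∈_)
import Data.List.Relation.Unary.Unique.Propositional as U
open import Relation.Binary.PropositionalEquality using (_≡_; _≢_)
open import Relation.Nullary using (¬_)
open import Function.Bundles using (_⇔_)

Point : Set
Point = ℚ × ℚ

LatticePoint : Set
LatticePoint = ℤ × ℤ

ι : LatticePoint → Point
ι (x , y) = (x / 1 , y / 1)

_-ᵖ_ : Point → Point → Point
(a , b) -ᵖ (c , d) = (a Q.- c , b Q.- d)

scaleᵖ : ℕ → Point → Point
scaleᵖ k (a , b) = ((+ k / 1) Q.* a , (+ k / 1) Q.* b)

cross : Point → Point → ℚ
cross (a , b) (c , d) = a Q.* d Q.- b Q.* c

edges : List Point → List (Point × Point)
edges [] = []
edges (v ∷ vs) = zip (v ∷ vs) (vs ++ [ v ])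

-- A (convex) rational polygon, given by its list of vertices in
-- counterclockwise order: at least 3 distinct vertices and, for every edge
-- (a , b), every other vertex lies strictly to the left of the line ab.
record Polygon : Set where
  field
    vertices : List Point
    atLeast3 : 3 ≤ length vertices
    distinct : U.Unique vertices
    strictlyConvex :
      All (λ e → let (a , b) = e in
             All (λ c → c ≢ a → c ≢ b → 0ℚ Q.< cross (b -ᵖ a) (c -ᵖ a)) vertices)
          (edges vertices)
open Polygon public

InDilate : ℕ → Polygon → Point → Set
InDilate k P x =
  All (λ e → let (a , b) = e in
         0ℚ Q.≤ cross (scaleᵖ k b -ᵖ scaleᵖ k a) (x -ᵖ scaleᵖ k a))
      (edges (vertices P))

InInterior : Polygon → Point → Set
InInterior P x =
  All (λ e → let (a , b) = e in 0ℚ Q.< cross (b -ᵖ a) (x -ᵖ a)) (edges (vertices P))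

OnBoundary : Polygon → Point → Set
OnBoundary P x =
  InDilate 1 P x ×
  Any (λ e → let (a , b) = e in cross (b -ᵖ a) (x -ᵖ a) ≡ 0ℚ) (edges (vertices P))

HasCount : (LatticePoint → Set) → ℕ → Set
HasCount S n =
  Σ (List LatticePoint) λ xs → U.Unique xs × length xs ≡ n × (∀ x → (x ∈ xs) ⇔ S x)

Ehrhart : Polygon → ℕ → ℕ → Set
Ehrhart P k n = HasCount (λ x → InDilate k P (ι x)) n

InteriorCount : Polygon → ℕ → Set
InteriorCount P n = HasCount (λ x → InInterior P (ι x)) n

BoundaryCount : Polygon → ℕ → Set
BoundaryCount P n = HasCount (λ x → OnBoundary P (ι x)) n

IsIntegral : ℚ → Set
IsIntegral q = Q.ℚ.denominatorℕ q ≡ 1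

DilateIntegral : ℕ → Polygon → Set
DilateIntegral d P =
  All (λ v → IsIntegral (Data.Product.proj₁ (scaleᵖ d v)) ×
             IsIntegral (Data.Product.proj₂ (scaleᵖ d v))) (vertices P)

-- smallest positive d with dP integral is 2  (i.e. 2P integral, P not integral)
HalfIntegral : Polygon → Set
HalfIntegral P = DilateIntegral 2 P × ¬ DilateIntegral 1 P

evalPoly : List ℚ → ℚ → ℚ
evalPoly [] t = 0ℚ
evalPoly (c ∷ cs) t = c Q.+ t Q.* evalPoly cs t

PseudoIntegral : Polygon → Set
PseudoIntegral P =
  Σ (List ℚ) λ cs → ∀ k n → 1 ≤ k → Ehrhart P k n → (+ n / 1) ≡ evalPoly cs (+ k / 1)

{-# OPTIONS --safe #-}
-- If b ≥ 10, two boundary lattice points are congruent modulo 3, so after a unimodular transformation some row of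
-- lattice points of P contains a segment of length at least 3; let [0 , N] × {0} be the longest one. Strictly
-- between this row and the topmost (or bottommost) row of lattice points the number of interior points is bounded
-- below by convexity, while each row has at most two boundary points. Counting by rows gives b ≤ 2i + 6 if the
-- segment passes through the interior of P, and b ≤ 2i + 7 if it lies on the boundary and P has lattice points at
-- distance at least 2 from it.
--
-- In the remaining case all lattice points lie in the rows y = 0 (an edge of P) and y = 1, and if b > 2i + 7 then P
-- lies in the strip 0 ≤ y ≤ 3/2. Pseudo-integrality enters through one linear relation between the numbers of
-- lattice points of P, 2P, …, 5P, valid because the Ehrhart polynomial has degree at most 2. These numbers split
-- into contributions of the left and of the right boundary of P, which are concave and piecewise linear with
-- half-integral vertices, and the required inequality holds for each side separately.
module Submission where

-- Counting rows of P alone cannot settle the remaining case: a triangle with base [0 , N] × {0} and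
-- apex at height 3/2 has at least N + 1 boundary lattice points but only about N/3 interior ones.
-- Such polygons are excluded by their dilates, through the rounding at the ends of the rows. Each
-- row end is the floor of a rational linear expression in a few integers describing one side of P.
-- Once these integers are fixed modulo 2 or 3, every floor is a linear form, and the inequality for
-- one side reduces to an equality of coefficient vectors that can be evaluated. All geometry is
-- done over the integers. The polygon enters as a cone in ℤ³ whose slice at height k is kP, given
-- both by its edges and by the vertices of 2P; convexity arguments become positivity of integer
-- forms, and changes of lattice coordinates act linearly on the slices.

open import Defs
open import Data.Bool using (true; false; T; if_then_else_)
open import Data.Empty using (⊥; ⊥-elim)
open import Data.Nat as ℕ using (ℕ; zero; suc)
import Data.Nat.Properties as ℕ
open import Data.Integer as ℤ using (ℤ; +_; -[1+_]; 0ℤ; 1ℤ; _+_; _*_; _-_; -_; _≤_; _<_; +≤+; +<+; -≤+)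
import Data.Integer.Properties as ℤ
import Data.Integer.DivMod as ℤ
open import Data.Integer.Tactic.RingSolver using (solve; solve-∀)
open import Data.List using (List; []; _∷_; _++_; [_]; length; map; filter; upTo; cartesianProduct; zip; drop; initLast; InitLast; _∷ʳ′_)
open import Data.List.Properties using (length-map; length-++; ++-assoc; length-filter; filter-accept; filter-reject)
open import Data.List.Relation.Unary.All as All using (All) renaming ([] to []ᴬ; _∷_ to _∷ᴬ_)
import Data.List.Relation.Unary.All.Properties as All
open import Data.List.Relation.Unary.Any as Any using (Any; here; there)
import Data.List.Relation.Unary.Any.Properties as Any
open import Data.List.Relation.Unary.AllPairs using () renaming ([] to []ᴾ; _∷_ to _∷ᴾ_)
open import Data.List.Membership.Propositional using (_∈_; find; lose)
open import Data.List.Membership.Propositional.Properties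
open import Data.List.Relation.Unary.Unique.Propositional using (Unique)
import Data.List.Relation.Unary.Unique.Propositional.Properties as Unique
open import Data.Product using (_×_; _,_; proj₁; proj₂; ∃; ∃₂)
open import Data.Product.Properties using (,-injectiveˡ; ,-injectiveʳ; ≡-dec)
open import Data.Sum using (_⊎_; inj₁; inj₂; [_,_]′)
open import Function using (id; case_of_)
open import Function.Bundles using (_⇔_; mk⇔; Equivalence)
open import Relation.Binary.Definitions using (tri<; tri≈; tri>)
open import Relation.Binary.PropositionalEquality hiding ([_])
open import Relation.Nullary using (¬_; Dec; yes; no; contradiction)
open import Data.List.Extrema ℤ.≤-totalOrder using (argmax; argmax-all; f[xs]≤f[argmax])
open import Data.Vec as Vec using (Vec) renaming ([] to []ⱽ; _∷_ to _∷ⱽ_)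
import Data.Vec.Relation.Unary.All as AllV
import Data.Vec.Properties as Vec
open import Data.Unit using (tt)
open import Relation.Nullary.Decidable using (toWitness; True; _×-dec_)
import Data.Nat.DivMod as ℕ
import Data.Rational as ℚ
open import Data.Rational using (ℚ; 0ℚ; _/_)
import Data.Rational.Properties as ℚ
open import Data.Rational.Unnormalised as ℚᵘ using (mkℚᵘ; *≡*; *≤*; *<*)
import Data.Rational.Unnormalised.Properties as ℚᵘ
import Tactic.RingSolver as RingSolver
open import Tactic.RingSolver.Core.AlmostCommutativeRing using (AlmostCommutativeRing; fromCommutativeRing)
open import Data.Maybe using (nothing)
open import Level using (0ℓ)

-- Linear arithmetic over ℤ

infixl 6 _⊕_ _⊕₊_
infixl 7 _⊗_

_⊕_ : ∀ {a b} → 0ℤ ≤ a → 0ℤ ≤ b → 0ℤ ≤ a + b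
_⊕_ = ℤ.+-mono-≤

_⊗_ : ∀ {a b} → 0ℤ ≤ a → 0ℤ ≤ b → 0ℤ ≤ a * b
_⊗_ (+≤+ {n = m} _) (+≤+ {n = n} _) = subst (0ℤ ≤_) (ℤ.pos-* m n) (+≤+ ℕ.z≤n)

_⊕₊_ : ∀ {a b} → 0ℤ < a → 0ℤ ≤ b → 0ℤ < a + b
_⊕₊_ = ℤ.+-mono-<-≤

infixr 2 _by_ _by₊_
-- Inequalities are proved by certificates: a sum of products of known non-negative terms, built
-- with `_⊕_` and `_⊗_`, is identified with the target by a ring identity. Strict inequalities enter
-- as differences reduced by 1.
_by_ : ∀ {a b} → 0ℤ ≤ a → a ≡ b → 0ℤ ≤ b
p by refl = p

_by₊_ : ∀ {a b} → 0ℤ < a → a ≡ b → 0ℤ < b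
p by₊ refl = p

≤⇒0≤ : ∀ {a b} → a ≤ b → 0ℤ ≤ b - a
≤⇒0≤ = ℤ.i≤j⇒0≤j-i

0≤⇒≤ : ∀ {a b} → 0ℤ ≤ b - a → a ≤ b
0≤⇒≤ = ℤ.0≤i-j⇒j≤i

<⇒0≤ : ∀ {a b} → a < b → 0ℤ ≤ b - a - 1ℤ
<⇒0≤ {a} {b} p = ≤⇒0≤ {1ℤ + a} {b} (ℤ.i<j⇒suc[i]≤j p) by solve (a ∷ b ∷ [])

0≤⇒< : ∀ {a b} → 0ℤ ≤ b - a - 1ℤ → a < b
0≤⇒< {a} {b} p = ℤ.suc[i]≤j⇒i<j (0≤⇒≤ {1ℤ + a} {b} (p by solve (a ∷ b ∷ [])))

pos⇒0≤ : ∀ {a} → 0ℤ < a → 0ℤ ≤ a - 1ℤ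
pos⇒0≤ p = ≤⇒0≤ (ℤ.i<j⇒suc[i]≤j p)

0≤⇒pos : ∀ {a} → 0ℤ ≤ a - 1ℤ → 0ℤ < a
0≤⇒pos p = ℤ.suc[i]≤j⇒i<j (0≤⇒≤ p)

<⇒0< : ∀ {a b} → a < b → 0ℤ < b - a
<⇒0< p = 0≤⇒pos (<⇒0≤ p)

_⊗₊_ : ∀ {a b} → 0ℤ < a → 0ℤ < b → 0ℤ < a * b
_⊗₊_ {a} {b} p q =
  0≤⇒pos ((pos⇒0≤ p ⊗ pos⇒0≤ q) ⊕ pos⇒0≤ p ⊕ pos⇒0≤ q by solve (a ∷ b ∷ []))
infixl 7 _⊗₊_

0≰-1 : ¬ (0ℤ ≤ -[1+ 0 ])
0≰-1 ()

≰⇒> : ∀ {a b} → ¬ (a ≤ b) → b < a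
≰⇒> = ℤ.≰⇒>

-- The certificate of an infeasible system: the hypotheses and the negated goal combine to 0 ≤ -1.
-- The negation contributes a - b - 1, so integrality is exploited.
by-contra-≤ : ∀ {a b} → (b < a → 0ℤ ≤ -[1+ 0 ]) → a ≤ b
by-contra-≤ {a} {b} f with a ℤ.≤? b
... | yes p = p
... | no ¬p = ⊥-elim (0≰-1 (f (≰⇒> ¬p)))

cancel-≤ : ∀ {c a} → 0ℤ < c → 0ℤ ≤ c * a → 0ℤ ≤ a
cancel-≤ {c} {a} p q = by-contra-≤ λ r →
  q ⊕ pos⇒0≤ p ⊗ <⇒0≤ r ⊕ <⇒0≤ r ⊕ pos⇒0≤ p by solve (a ∷ c ∷ [])

cancel-< : ∀ {c a} → 0ℤ < c → 0ℤ < c * a → 0ℤ < a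
cancel-< {c} {a} p q = 0≤⇒pos (≤⇒0≤ (by-contra-≤ {1ℤ} {a} λ r →
  pos⇒0≤ q ⊕ pos⇒0≤ p ⊗ <⇒0≤ r ⊕ <⇒0≤ r by solve (a ∷ c ∷ [])))

cancel-0 : ∀ {c a} → 0ℤ < c → c * a ≡ 0ℤ → a ≡ 0ℤ
cancel-0 {c} {a} p q = ℤ.≤-antisym
  (0≤⇒≤ (cancel-≤ p (ℤ.≤-reflexive (sym (cong -_ q)) by neg c a)))
  (cancel-≤ p (ℤ.≤-reflexive (sym q)))
  where
  neg : ∀ c a → - (c * a) ≡ c * (0ℤ - a)
  neg = solve-∀

<⇒≤ : ∀ {a b : ℤ} → a < b → a ≤ b
<⇒≤ = ℤ.<⇒≤

0≤+ : ∀ {n} → 0ℤ ≤ + n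
0≤+ = +≤+ ℕ.z≤n

floor-unique : ∀ d .{{_ : ℕ.NonZero d}} n q → 0ℤ ≤ n - + d * q → n - + d * q < + d → n ℤ./ℕ d ≡ q
floor-unique d n q lo hi = ℤ.≤-antisym (half q q′ lo′ hi) (half q′ q lo hi′)
  where
  q′ = n ℤ./ℕ d
  dpos : 0ℤ < + d
  dpos = +<+ (ℕ.>-nonZero⁻¹ d)
  lo′ : 0ℤ ≤ n - + d * q′
  lo′ = ≤⇒0≤ (ℤ.[n/ℕd]*d≤n n d) by cong (λ x → n - x) (ℤ.*-comm q′ (+ d))
  hi′ : n - + d * q′ < + d
  hi′ = 0≤⇒< (<⇒0≤ {n} {(1ℤ + q′) * + d} (ℤ.n<s[n/ℕd]*d n d) by generic n (+ d) q′)
    where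
    generic : ∀ n d q → (1ℤ + q) * d - n - 1ℤ ≡ d - (n - d * q) - 1ℤ
    generic = solve-∀
  half : ∀ q q′ → 0ℤ ≤ n - + d * q′ → n - + d * q < + d → q′ ≤ q
  half q q′ a b = by-contra-≤ λ r → a ⊕ <⇒0≤ b ⊕ <⇒≤ dpos ⊗ <⇒0≤ r by generic n (+ d) q q′
    where
    generic : ∀ n d q q′ → (n - d * q′) + (d - (n - d * q) - 1ℤ) + d * (q′ - q - 1ℤ) ≡ - 1ℤ
    generic = solve-∀

≤-floor : ∀ d .{{_ : ℕ.NonZero d}} n x → + d * x ≤ n → x ≤ n ℤ./ℕ d
≤-floor d n x p = by-contra-≤ λ r →
  ≤⇒0≤ p ⊕ <⇒0≤ {n} {(1ℤ + n ℤ./ℕ d) * + d} (ℤ.n<s[n/ℕd]*d n d) ⊕ 0≤+ {d} ⊗ <⇒0≤ r by generic n (+ d) (n ℤ./ℕ d) x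
  where
  generic : ∀ n d q x → (n - d * x) + ((1ℤ + q) * d - n - 1ℤ) + d * (x - q - 1ℤ) ≡ - 1ℤ
  generic = solve-∀

floor-≤ : ∀ d .{{_ : ℕ.NonZero d}} n x → x ≤ n ℤ./ℕ d → + d * x ≤ n
floor-≤ d n x p = 0≤⇒≤ (≤⇒0≤ (ℤ.[n/ℕd]*d≤n n d) ⊕ 0≤+ {d} ⊗ ≤⇒0≤ p by generic n (+ d) (n ℤ./ℕ d) x)
  where
  generic : ∀ n d q x → (n - q * d) + d * (q - x) ≡ n - d * x
  generic = solve-∀

-- Lists of lattice points

unique⇒length≤ : ∀ {A : Set} {xs ys : List A} → Unique xs → (∀ {z} → z ∈ xs → z ∈ ys) →
  length xs ℕ.≤ length ys
unique⇒length≤ {xs = []} _ _ = ℕ.z≤n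
unique⇒length≤ {xs = x ∷ xs} (x∉ ∷ᴾ u) sub with ∈-∃++ (sub (here refl))
... | as , bs , refl = subst (suc (length xs) ℕ.≤_) (sym len) (ℕ.s≤s (unique⇒length≤ u sub′))
  where
  len : length (as ++ x ∷ bs) ≡ suc (length (as ++ bs))
  len = trans (length-++ as) (trans (ℕ.+-suc (length as) (length bs)) (cong suc (sym (length-++ as))))
  sub′ : ∀ {z} → z ∈ xs → z ∈ as ++ bs
  sub′ z∈ with ∈-++⁻ as (sub (there z∈))
  ... | inj₁ p = ∈-++⁺ˡ p
  ... | inj₂ (here refl) = contradiction refl (All.lookup x∉ z∈)
  ... | inj₂ (there p) = ∈-++⁺ʳ as p

interval : ℤ → ℕ → List ℤ
interval p zero = []
interval p (suc n) = p ∷ interval (1ℤ + p) n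

∈-interval⁻ : ∀ {x} p n → x ∈ interval p n → p ≤ x × x < p + + n
∈-interval⁻ {x} p (suc n) (here refl) = ℤ.≤-refl , 0≤⇒< (0≤+ {n} by generic x (+ n))
  where
  generic : ∀ x n → n ≡ x + (1ℤ + n) - x - 1ℤ
  generic = solve-∀
∈-interval⁻ {x} p (suc n) (there q) with ∈-interval⁻ (1ℤ + p) n q
... | a , b = 0≤⇒≤ (≤⇒0≤ a ⊕ 0≤+ {1} by lower p x) , subst (x <_) (upper p (+ n)) b
  where
  lower : ∀ p x → x - (1ℤ + p) + + 1 ≡ x - p
  lower = solve-∀
  upper : ∀ p n → 1ℤ + p + n ≡ p + (1ℤ + n)
  upper = solve-∀

∈-interval⁺ : ∀ {x} p n → p ≤ x → x < p + + n → x ∈ interval p n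
∈-interval⁺ {x} p zero a b =
  ⊥-elim (ℤ.<-irrefl refl (ℤ.<-≤-trans (subst (x <_) (ℤ.+-identityʳ p) b) a))
∈-interval⁺ {x} p (suc n) a b with p ℤ.≟ x
... | yes refl = here refl
... | no p≢x = there (∈-interval⁺ (1ℤ + p) n (ℤ.i<j⇒suc[i]≤j (ℤ.≤∧≢⇒< a p≢x)) (subst (x <_) (upper p (+ n)) b))
  where
  upper : ∀ p n → p + (1ℤ + n) ≡ 1ℤ + p + n
  upper = solve-∀

interval-unique : ∀ p n → Unique (interval p n)
interval-unique p zero = []ᴾ
interval-unique p (suc n) =
  All.tabulate (λ z∈ → ℤ.<⇒≢ (ℤ.suc[i]≤j⇒i<j (proj₁ (∈-interval⁻ (1ℤ + p) n z∈)))) ∷ᴾ interval-unique (1ℤ + p) n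

length-interval : ∀ p n → length (interval p n) ≡ n
length-interval p zero = refl
length-interval p (suc n) = cong suc (length-interval (1ℤ + p) n)

onRow up down : ℤ → List LatticePoint → List LatticePoint
onRow y = filter (λ z → proj₂ z ℤ.≟ y)
up y = filter (λ z → y ℤ.<? proj₂ z)
down y = filter (λ z → proj₂ z ℤ.<? y)

segment : ℤ → ℤ → ℕ → List LatticePoint
segment y p n = map (_, y) (interval p n)

length-segment : ∀ y p n → length (segment y p n) ≡ n
length-segment y p n = trans (length-map (_, y) (interval p n)) (length-interval p n)

segment-unique : ∀ y p n → Unique (segment y p n)
segment-unique y p n = Unique.map⁺ (λ eq → ,-injectiveˡ eq) (interval-unique p n)

row-≤ : ∀ {xs} y p n → Unique xs → (∀ {x} → (x , y) ∈ xs → p ≤ x × x < p + + n) →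
  length (onRow y xs) ℕ.≤ n
row-≤ {xs} y p n u h = subst (length (onRow y xs) ℕ.≤_) (length-segment y p n)
  (unique⇒length≤ (Unique.filter⁺ _ u) sub)
  where
  sub : ∀ {z} → z ∈ onRow y xs → z ∈ segment y p n
  sub {x , y′} z∈ with ∈-filter⁻ (λ z → proj₂ z ℤ.≟ y) {xs = xs} z∈
  ... | z∈xs , refl = ∈-map⁺ (_, y) (∈-interval⁺ p n (proj₁ (h z∈xs)) (proj₂ (h z∈xs)))

row-≥ : ∀ {xs} y p n → (∀ x → p ≤ x → x < p + + n → (x , y) ∈ xs) → n ℕ.≤ length (onRow y xs)
row-≥ {xs} y p n h = subst (ℕ._≤ length (onRow y xs)) (length-segment y p n)
  (unique⇒length≤ (segment-unique y p n) sub)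
  where
  sub : ∀ {z} → z ∈ segment y p n → z ∈ onRow y xs
  sub z∈ with ∈-map⁻ (_, y) z∈
  ... | x , x∈ , refl = let a , b = ∈-interval⁻ p n x∈ in
    ∈-filter⁺ (λ z → proj₂ z ℤ.≟ y) (h x a b) refl

row-≤2 : ∀ {xs} y → Unique xs →
  (∀ {a b c} → a < b → b < c → (a , y) ∈ xs → (b , y) ∈ xs → (c , y) ∈ xs → ⊥) →
  length (onRow y xs) ℕ.≤ 2
row-≤2 {xs} y u h with onRow y xs in eq | Unique.filter⁺ (λ z → proj₂ z ℤ.≟ y) u
... | [] | _ = ℕ.z≤n
... | _ ∷ [] | _ = ℕ.s≤s ℕ.z≤n
... | _ ∷ _ ∷ [] | _ = ℕ.s≤s (ℕ.s≤s ℕ.z≤n)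
... | (a , a′) ∷ (b , b′) ∷ (c , c′) ∷ _ | (a≢b ∷ᴬ a≢c ∷ᴬ _) ∷ᴾ (b≢c ∷ᴬ _) ∷ᴾ _
  with mem (here refl) | mem (there (here refl)) | mem (there (there (here refl)))
  where
  mem : ∀ {z} → z ∈ _ → z ∈ xs × proj₂ z ≡ y
  mem z∈ = ∈-filter⁻ (λ z → proj₂ z ℤ.≟ y) {xs = xs} (subst (_ ∈_) (sym eq) z∈)
... | pa , refl | pb , refl | pc , refl with ℤ.<-cmp a b | ℤ.<-cmp b c | ℤ.<-cmp a c
... | tri≈ _ refl _ | _ | _ = contradiction refl a≢b
... | _ | tri≈ _ refl _ | _ = contradiction refl b≢c
... | _ | _ | tri≈ _ refl _ = contradiction refl a≢c
... | tri< ab _ _ | tri< bc _ _ | _ = ⊥-elim (h ab bc pa pb pc)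
... | tri< ab _ _ | tri> _ _ cb | tri< ac _ _ = ⊥-elim (h ac cb pa pc pb)
... | tri< ab _ _ | tri> _ _ cb | tri> _ _ ca = ⊥-elim (h ca ab pc pa pb)
... | tri> _ _ ba | tri< bc _ _ | tri< ac _ _ = ⊥-elim (h ba ac pb pa pc)
... | tri> _ _ ba | tri< bc _ _ | tri> _ _ ca = ⊥-elim (h bc ca pb pc pa)
... | tri> _ _ ba | tri> _ _ cb | _ = ⊥-elim (h cb ba pc pb pa)

length-split : ∀ y xs → length xs ≡ length (up y xs) ℕ.+ length (onRow y xs) ℕ.+ length (down y xs)
length-split y [] = refl
length-split y ((x , y′) ∷ xs) with y ℤ.<? y′ | y′ ℤ.≟ y | y′ ℤ.<? y
... | yes p | yes refl | _ = ⊥-elim (ℤ.<-irrefl refl p)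
... | yes p | no _ | yes q = ⊥-elim (ℤ.<-asym p q)
... | yes p | no _ | no _ = cong suc (length-split y xs)
... | no _ | yes refl | yes q = ⊥-elim (ℤ.<-irrefl refl q)
... | no _ | yes refl | no _ =
  trans (cong suc (length-split y xs)) (cong (ℕ._+ length (down y xs)) (sym (ℕ.+-suc (length (up y xs)) _)))
... | no _ | no _ | yes q = trans (cong suc (length-split y xs)) (sym (ℕ.+-suc (length (up y xs) ℕ.+ length (onRow y xs)) _))
... | no p | no q | no r with ℤ.<-cmp y y′
... | tri< a _ _ = contradiction a p
... | tri≈ _ a _ = contradiction (sym a) q
... | tri> _ _ a = contradiction a r

Σ₁ : (ℕ → ℕ) → ℕ → ℕ
Σ₁ f zero = 0
Σ₁ f (suc n) = Σ₁ f n ℕ.+ f (suc n)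

length-rows : ∀ n xs → All (λ z → 0ℤ < proj₂ z × proj₂ z ≤ + n) xs →
  length xs ≡ Σ₁ (λ i → length (onRow (+ i) xs)) n
length-rows n [] []ᴬ = sym (zeros n)
  where
  zeros : ∀ n → Σ₁ (λ _ → 0) n ≡ 0
  zeros zero = refl
  zeros (suc n) = trans (ℕ.+-identityʳ _) (zeros n)
length-rows n (z@(x , + k) ∷ xs) ((+<+ 0<k , +≤+ k≤n) ∷ᴬ bs) =
  trans (cong suc (length-rows n xs bs)) (sym (insert n k≤n))
  where
  f g : ℕ → ℕ
  f i = length (onRow (+ i) xs)
  g i = length (onRow (+ i) (z ∷ xs))
  hit : g k ≡ suc (f k)
  hit = cong length (filter-accept (λ z → proj₂ z ℤ.≟ + k) {xs = xs} refl)
  miss : ∀ {i} → k ≢ i → g i ≡ f i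
  miss {i} k≢i = cong length (filter-reject (λ z → proj₂ z ℤ.≟ + i) {xs = xs} (λ eq → k≢i (ℤ.+-injective eq)))
  below : ∀ n → n ℕ.< k → Σ₁ g n ≡ Σ₁ f n
  below zero _ = refl
  below (suc n) n<k = cong₂ ℕ._+_ (below n (ℕ.<-trans (ℕ.n<1+n n) n<k)) (miss (ℕ.>⇒≢ n<k))
  insert : ∀ n → k ℕ.≤ n → Σ₁ g n ≡ suc (Σ₁ f n)
  insert zero k≤0 = ⊥-elim (ℕ.<⇒≱ 0<k k≤0)
  insert (suc n) k≤1+n with k ℕ.≟ suc n
  ... | yes refl = trans (cong₂ ℕ._+_ (below n ℕ.≤-refl) hit) (ℕ.+-suc (Σ₁ f n) (f (suc n)))
  ... | no k≢ = cong₂ ℕ._+_ (insert n (ℕ.≤-pred (ℕ.≤∧≢⇒< k≤1+n k≢))) (miss k≢)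

∃-max : ∀ {A : Set} (f : A → ℤ) {z xs} → z ∈ xs → ∃ λ m → m ∈ xs × (∀ {w} → w ∈ xs → f w ≤ f m)
∃-max f {z} {xs} z∈ = argmax f z xs , argmax-all f z∈ (All.tabulate id) , All.lookup (f[xs]≤f[argmax] z xs)

-- Polygons as slices of cones

∈-⇔ : ∀ {S n} (c : HasCount S n) {z} → z ∈ proj₁ c ⇔ S z
∈-⇔ (_ , _ , _ , spec) {z} = spec z

hasCount-map : ∀ {S S′ : LatticePoint → Set} {n} (f g : LatticePoint → LatticePoint) →
  (∀ z → g (f z) ≡ z) → (∀ z → f (g z) ≡ z) → (∀ {z} → S z → S′ (f z)) → (∀ {z} → S′ z → S (g z)) →
  HasCount S n → HasCount S′ n
hasCount-map {S′ = S′} f g gf fg to from (xs , u , len , spec) =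
  map f xs ,
  Unique.map⁺ (λ {x} {y} eq → trans (sym (gf x)) (trans (cong g eq) (gf y))) u ,
  trans (length-map f xs) len ,
  λ z → mk⇔
    (λ z∈ → case ∈-map⁻ f z∈ of λ { (w , w∈ , refl) → to (Equivalence.to (spec w) w∈) })
    (λ s → subst (_∈ map f xs) (fg z) (∈-map⁺ f (Equivalence.from (spec (g z)) (from s))))

hasCount-unique : ∀ {S m n} → HasCount S m → HasCount S n → m ≡ n
hasCount-unique (xs , u , refl , p) (ys , v , refl , q) = ℕ.≤-antisym
  (unique⇒length≤ u (λ {z} z∈ → Equivalence.from (q z) (Equivalence.to (p z) z∈)))
  (unique⇒length≤ v (λ {z} z∈ → Equivalence.from (p z) (Equivalence.to (q z) z∈)))

-- The form (α , β , γ) represents the half-plane αx + βy + γ ≥ 0; the third variable k homogenises it,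
-- so that the lattice points of kP form the slice at height k of a cone in ℤ³.
Form : Set
Form = ℤ × ℤ × ℤ

ev : Form → ℤ → ℤ → ℤ → ℤ
ev (α , β , γ) x y k = α * x + β * y + γ * k

-- The generators are the vertices of 2P.
record Body (i b : ℕ) : Set where
  field
    forms : List Form
    gens  : List LatticePoint

  In : ℤ → ℤ → ℤ → Set
  In x y k = All (λ g → 0ℤ ≤ ev g x y k) forms

  Int : ℤ → ℤ → ℤ → Set
  Int x y k = All (λ g → 0ℤ < ev g x y k) forms

  Points : ℕ → ℕ → Set
  Points k = HasCount (λ z → In (proj₁ z) (proj₂ z) (+ k))

  field
    interior : HasCount (λ z → Int (proj₁ z) (proj₂ z) 1ℤ) i
    boundary : HasCount (λ z → In (proj₁ z) (proj₂ z) 1ℤ ×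
                               Any (λ g → ev g (proj₁ z) (proj₂ z) 1ℤ ≡ 0ℤ) forms) b
    gens-In  : ∀ {X Y} → (X , Y) ∈ gens → In X Y (+ 2)
    -- The half of Farkas' lemma that turns any inequality checked at the vertices of 2P into an
    -- inequality on all dilates.
    dual     : ∀ φ → (∀ {X Y} → (X , Y) ∈ gens → 0ℤ ≤ ev φ X Y (+ 2)) →
               ∀ {x y k} → 0ℤ ≤ k → In x y k → 0ℤ ≤ ev φ x y k
    -- Satisfied by n₁, …, n₅ whenever they are the values at 1, …, 5 of a quadratic polynomial.
    relation : ∀ {n₁ n₂ n₃ n₄ n₅} → Points 1 n₁ → Points 2 n₂ → Points 3 n₃ → Points 4 n₄ → Points 5 n₅ →
               + 9 * + n₂ + + 3 * + n₅ ≡ + 4 * + n₁ + + 3 * + n₃ + + 5 * + n₄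

  I B : List LatticePoint
  I = proj₁ interior
  B = proj₁ boundary

-- A unimodular affine map in homogeneous coordinates: the translation part is multiplied by k, so
-- that kP is sent to the k-th dilate of the image. The inverse is stored as data in place of a
-- condition on the determinant.
record Affine : Set where
  field a b c d e f a′ b′ c′ d′ e′ f′ : ℤ

  X : ℤ → ℤ → ℤ → ℤ
  X x y k = a * x + b * y + e * k

  Y : ℤ → ℤ → ℤ → ℤ
  Y x y k = c * x + d * y + f * k

  X′ : ℤ → ℤ → ℤ → ℤ
  X′ x y k = a′ * x + b′ * y + e′ * k

  Y′ : ℤ → ℤ → ℤ → ℤ
  Y′ x y k = c′ * x + d′ * y + f′ * k

  field
    X′-inverse : ∀ x y k → X′ (X x y k) (Y x y k) k ≡ x
    Y′-inverse : ∀ x y k → Y′ (X x y k) (Y x y k) k ≡ y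
    X-inverse  : ∀ x y k → X (X′ x y k) (Y′ x y k) k ≡ x
    Y-inverse  : ∀ x y k → Y (X′ x y k) (Y′ x y k) k ≡ y

module Transform (A : Affine) where
  open Affine A

  -- Forms are contravariant: those of the image polygon are composed with the inverse map. The
  -- opposite direction, `push`, serves to transport `dual`.
  pull : Form → Form
  pull (α , β , γ) = α * a′ + β * c′ , α * b′ + β * d′ , α * e′ + β * f′ + γ

  push : Form → Form
  push (α , β , γ) = α * a + β * c , α * b + β * d , α * e + β * f + γ

  ev-∘ : ∀ a b c d e f α β γ x y k →
    (α * a + β * c) * x + (α * b + β * d) * y + (α * e + β * f + γ) * k ≡
    α * (a * x + b * y + e * k) + β * (c * x + d * y + f * k) + γ * k
  ev-∘ = solve-∀

  ev-pull : ∀ g x y k → ev (pull g) x y k ≡ ev g (X′ x y k) (Y′ x y k) k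
  ev-pull (α , β , γ) x y k = ev-∘ a′ b′ c′ d′ e′ f′ α β γ x y k

  ev-push : ∀ g x y k → ev (push g) x y k ≡ ev g (X x y k) (Y x y k) k
  ev-push (α , β , γ) x y k = ev-∘ a b c d e f α β γ x y k

  ev-pull-image : ∀ g x y k → ev (pull g) (X x y k) (Y x y k) k ≡ ev g x y k
  ev-pull-image g x y k = trans (ev-pull g _ _ k) (cong₂ (λ u v → ev g u v k) (X′-inverse x y k) (Y′-inverse x y k))

  at at′ : ℕ → LatticePoint → LatticePoint
  at  k (x , y) = X  x y (+ k) , Y  x y (+ k)
  at′ k (x , y) = X′ x y (+ k) , Y′ x y (+ k)

  at′-at : ∀ k z → at′ k (at k z) ≡ z
  at′-at k (x , y) = cong₂ _,_ (X′-inverse x y (+ k)) (Y′-inverse x y (+ k))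

  at-at′ : ∀ k z → at k (at′ k z) ≡ z
  at-at′ k (x , y) = cong₂ _,_ (X-inverse x y (+ k)) (Y-inverse x y (+ k))

  module _ {i b} (P : Body i b) where
    open Body P

    In⁺ : ∀ {x y k} → In x y k → All (λ g → 0ℤ ≤ ev g (X x y k) (Y x y k) k) (map pull forms)
    In⁺ p = All.map⁺ (All.map (λ {g} → subst (0ℤ ≤_) (sym (ev-pull-image g _ _ _))) p)

    In⁻ : ∀ {x y k} → All (λ g → 0ℤ ≤ ev g x y k) (map pull forms) → In (X′ x y k) (Y′ x y k) k
    In⁻ p = All.map (λ {g} → subst (0ℤ ≤_) (ev-pull g _ _ _)) (All.map⁻ p)

    Int⁺ : ∀ {x y k} → Int x y k → All (λ g → 0ℤ < ev g (X x y k) (Y x y k) k) (map pull forms)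
    Int⁺ p = All.map⁺ (All.map (λ {g} → subst (0ℤ <_) (sym (ev-pull-image g _ _ _))) p)

    Int⁻ : ∀ {x y k} → All (λ g → 0ℤ < ev g x y k) (map pull forms) → Int (X′ x y k) (Y′ x y k) k
    Int⁻ p = All.map (λ {g} → subst (0ℤ <_) (ev-pull g _ _ _)) (All.map⁻ p)

    transform : Body i b
    transform .Body.forms = map pull forms
    transform .Body.gens = map (at 2) gens
    transform .Body.interior = hasCount-map (at 1) (at′ 1) (at′-at 1) (at-at′ 1) Int⁺ Int⁻ interior
    transform .Body.boundary = hasCount-map (at 1) (at′ 1) (at′-at 1) (at-at′ 1)
      (λ (p , q) → In⁺ p , Any.map⁺ (Any.map (λ {g} eq → trans (ev-pull-image g _ _ _) eq) q))
      (λ (p , q) → In⁻ p , Any.map (λ {g} eq → trans (sym (ev-pull g _ _ _)) eq) (Any.map⁻ q))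
      boundary
    transform .Body.gens-In z∈ = case ∈-map⁻ (at 2) z∈ of λ { (_ , w∈ , refl) → In⁺ (gens-In w∈) }
    transform .Body.dual φ h {x} {y} {k} k≥0 p =
      dual (push φ) (λ z∈ → h (∈-map⁺ (at 2) z∈) by sym (ev-push φ _ _ (+ 2))) k≥0 (In⁻ p)
      by trans (ev-push φ _ _ k) (cong₂ (λ u v → ev φ u v k) (X-inverse x y k) (Y-inverse x y k))
    transform .Body.relation c₁ c₂ c₃ c₄ c₅ = relation (back 1 c₁) (back 2 c₂) (back 3 c₃) (back 4 c₄) (back 5 c₅)
      where
      back : ∀ k {n} → HasCount _ n → Points k n
      back k = hasCount-map (at′ k) (at k) (at-at′ k) (at′-at k) In⁻ In⁺

-- The contribution of one side to the Ehrhart function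

Σ< : ℕ → (ℕ → ℤ) → ℤ
Σ< zero f = 0ℤ
Σ< (suc n) f = Σ< n f + f n

Σ<-cong : ∀ n {f g} → (∀ j → f j ≡ g j) → Σ< n f ≡ Σ< n g
Σ<-cong zero h = refl
Σ<-cong (suc n) h = cong₂ _+_ (Σ<-cong n h) (h n)

-- A polygon in the strip 0 ≤ y ≤ 3/2 is bounded on the right by the concave piecewise linear function with
-- value ρ h / 12 at height h / 2, for h = 0, 1, 2, 3.
value : (ℕ → ℤ) → ℕ → ℕ → ℕ → ℤ
value ρ h k j = + k * ρ h + (+ 2 * + j - + h * + k) * (ρ (suc h) - ρ h)

-- Row j of kP lies at height j/k of P; the result is the h for which this height is between h/2 and
-- (h + 1)/2. At a common endpoint both pieces give the same value.
piece : ℕ → ℕ → ℕ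
piece k j = if 2 ℕ.* j ℕ.≤ᵇ k then 0 else if j ℕ.≤ᵇ k then 1 else 2

-- The denominator 12 serves every profile: half-integral vertices need 2, and chords spanning two
-- or three half-steps introduce a further factor 2 or 3.
rowEnd : (ℕ → ℤ) → ℕ → ℕ → ℤ
rowEnd ρ k j = value ρ (piece k j) k j ℤ./ℕ 12

rows : ℕ → ℕ
rows k = suc (3 ℕ.* k ℕ./ 2)

rowEnds : (ℕ → ℤ) → ℕ → ℤ
rowEnds ρ k = Σ< (rows k) (rowEnd ρ k)

-- `ρ 2` belongs to height 1. Subtracting 1 before the floor yields the last lattice point of the
-- row y = 1 strictly inside the boundary.
innerEnd : (ℕ → ℤ) → ℤ
innerEnd ρ = (ρ 2 - 1ℤ) ℤ./ℕ 12

-- The weights of the dilates come from a linear program: they annihilate the quadratic polynomials (up to a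
-- multiple of s₁) and make the defect of every profile non-negative.
combination : (s₁ s₂ s₃ s₄ s₅ inner top : ℤ) → ℤ
combination s₁ s₂ s₃ s₄ s₅ inner top =
  + 18 - + 6 * (+ 9 * s₂ + + 3 * s₅ - + 3 * s₁ - + 3 * s₃ - + 5 * s₄ - + 3 * inner) - top

-- The share of one side in 6(2i + 7 - b). The two shares, 12 times the width of P at height 3/2,
-- and 18 times the surplus of i over the interior points found in row 1 add up to this number, by
-- the Ehrhart relation.
defect : (ℕ → ℤ) → ℤ
defect ρ = combination (rowEnds ρ 1) (rowEnds ρ 2) (rowEnds ρ 3) (rowEnds ρ 4) (rowEnds ρ 5) (innerEnd ρ) (ρ 3)

-- Integer linear forms, as coefficient vectors. The first parameter is always 1.
infixl 6 _+ᵛ_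
infixl 7 _*ᵛ_

_+ᵛ_ : ∀ {n} → Vec ℤ n → Vec ℤ n → Vec ℤ n
_+ᵛ_ = Vec.zipWith _+_

_*ᵛ_ : ∀ {n} → ℤ → Vec ℤ n → Vec ℤ n
c *ᵛ v = Vec.map (c *_) v

dot : ∀ {n} → Vec ℤ n → Vec ℤ n → ℤ
dot []ⱽ []ⱽ = 0ℤ
dot (c ∷ⱽ v) (p ∷ⱽ ps) = c * p + dot v ps

dot-+ : ∀ {n} (u v ps : Vec ℤ n) → dot (u +ᵛ v) ps ≡ dot u ps + dot v ps
dot-+ []ⱽ []ⱽ []ⱽ = refl
dot-+ (a ∷ⱽ u) (b ∷ⱽ v) (p ∷ⱽ ps) = trans (cong (λ x → (a + b) * p + x) (dot-+ u v ps)) (generic a b p (dot u ps) (dot v ps))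
  where
  generic : ∀ a b p x y → (a + b) * p + (x + y) ≡ a * p + x + (b * p + y)
  generic = solve-∀

dot-* : ∀ {n} c (v ps : Vec ℤ n) → dot (c *ᵛ v) ps ≡ c * dot v ps
dot-* c []ⱽ []ⱽ = sym (ℤ.*-zeroʳ c)
dot-* c (a ∷ⱽ v) (p ∷ⱽ ps) = trans (cong (λ x → c * a * p + x) (dot-* c v ps)) (generic c a p (dot v ps))
  where
  generic : ∀ c a p x → c * a * p + c * x ≡ c * (a * p + x)
  generic = solve-∀

dot-0 : ∀ {n} (ps : Vec ℤ n) → dot (Vec.replicate n 0ℤ) ps ≡ 0ℤ
dot-0 []ⱽ = refl
dot-0 (p ∷ⱽ ps) = trans (ℤ.+-identityˡ _) (dot-0 ps)

constant : ∀ {n} → ℤ → Vec ℤ (suc n)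
constant c = c ∷ⱽ Vec.replicate _ 0ℤ

dot-constant : ∀ {n} c (ps : Vec ℤ n) → dot (constant c) (1ℤ ∷ⱽ ps) ≡ c
dot-constant c ps = trans (cong (λ x → c * 1ℤ + x) (dot-0 ps)) (trans (ℤ.+-identityʳ _) (ℤ.*-identityʳ c))

floorᵛ : ∀ {n} → Vec ℤ n → Vec ℤ n
floorᵛ = Vec.map (ℤ._/ℕ 12)

Exact : ∀ {n} → Vec ℤ n → Set
Exact = AllV.All (λ c → + 12 * (c ℤ./ℕ 12) ≡ c)

exact? : ∀ {n} (v : Vec ℤ n) → Dec (Exact v)
exact? = AllV.all? (λ c → _ ℤ.≟ c)

dot-exact : ∀ {n} (v ps : Vec ℤ n) → Exact v → dot v ps ≡ + 12 * dot (floorᵛ v) ps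
dot-exact v ps e = trans (cong (λ v → dot v ps) (sym (eq v e))) (dot-* (+ 12) (floorᵛ v) ps)
  where
  eq : ∀ {n} (v : Vec ℤ n) → Exact v → + 12 *ᵛ floorᵛ v ≡ v
  eq []ⱽ AllV.[] = refl
  eq (c ∷ⱽ v) (e AllV.∷ es) = cong₂ _∷ⱽ_ e (eq v es)

-- When 12 divides all coefficients but the constant one, the floor rounds the constant only and can
-- be taken coefficientwise.
dot-floor : ∀ {n} (v : Vec ℤ (suc n)) ps → Exact (Vec.tail v) →
  dot v (1ℤ ∷ⱽ ps) ℤ./ℕ 12 ≡ dot (floorᵛ v) (1ℤ ∷ⱽ ps)
dot-floor (c ∷ⱽ v) ps e = floor-unique 12 (dot (c ∷ⱽ v) (1ℤ ∷ⱽ ps)) (dot (floorᵛ (c ∷ⱽ v)) (1ℤ ∷ⱽ ps))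
  (0≤+ {c ℤ.%ℕ 12} by sym remainder)
  (subst (_< + 12) (sym remainder) (+<+ (ℤ.n%ℕd<d c 12)))
  where
  generic : ∀ r q x → (r + q * + 12) * 1ℤ + + 12 * x - + 12 * (q * 1ℤ + x) ≡ r
  generic = solve-∀
  remainder : dot (c ∷ⱽ v) (1ℤ ∷ⱽ ps) - + 12 * dot (floorᵛ (c ∷ⱽ v)) (1ℤ ∷ⱽ ps) ≡ + (c ℤ.%ℕ 12)
  remainder = trans
    (cong (λ x → x - + 12 * dot (floorᵛ (c ∷ⱽ v)) (1ℤ ∷ⱽ ps))
      (cong₂ (λ x y → x * 1ℤ + y) (ℤ.a≡a%ℕn+[a/ℕn]*n c 12) (dot-exact v ps e)))
    (generic (+ (c ℤ.%ℕ 12)) (c ℤ./ℕ 12) (dot (floorᵛ v) ps))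

-- Repeats the definition of the defect on coefficient vectors. As long as 12 divides every
-- non-constant coefficient under a floor, each floor is again a linear form and the symbolic result
-- evaluates to the true defect.
module Symbolic {n} (σ : ℕ → Vec ℤ (suc n)) where

  valueᵛ : ℕ → ℕ → ℕ → Vec ℤ (suc n)
  valueᵛ h k j = + k *ᵛ σ h +ᵛ (+ 2 * + j - + h * + k) *ᵛ (σ (suc h) +ᵛ - 1ℤ *ᵛ σ h)

  rowEndᵛ : ℕ → ℕ → Vec ℤ (suc n)
  rowEndᵛ k j = floorᵛ (valueᵛ (piece k j) k j)

  Σᵛ : ℕ → (ℕ → Vec ℤ (suc n)) → Vec ℤ (suc n)
  Σᵛ zero f = constant 0ℤ
  Σᵛ (suc m) f = Σᵛ m f +ᵛ f m

  rowEndsᵛ : ℕ → Vec ℤ (suc n)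
  rowEndsᵛ k = Σᵛ (rows k) (rowEndᵛ k)

  innerᵛ : Vec ℤ (suc n)
  innerᵛ = σ 2 +ᵛ constant (- 1ℤ)

  combinationᵛ : (s₁ s₂ s₃ s₄ s₅ inner top : Vec ℤ (suc n)) → Vec ℤ (suc n)
  combinationᵛ s₁ s₂ s₃ s₄ s₅ inner top =
    constant (+ 18)
    +ᵛ - (+ 6) *ᵛ (+ 9 *ᵛ s₂ +ᵛ + 3 *ᵛ s₅ +ᵛ - (+ 3) *ᵛ s₁ +ᵛ - (+ 3) *ᵛ s₃ +ᵛ - (+ 5) *ᵛ s₄ +ᵛ - (+ 3) *ᵛ inner)
    +ᵛ - 1ℤ *ᵛ top

  defectᵛ : Vec ℤ (suc n)
  defectᵛ = combinationᵛ (rowEndsᵛ 1) (rowEndsᵛ 2) (rowEndsᵛ 3) (rowEndsᵛ 4) (rowEndsᵛ 5) (floorᵛ innerᵛ) (σ 3)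

  ExactRows : ℕ → ℕ → Set
  -- The divisibility needed for `innerEnd` is recorded at the bottom of the recursion over the
  -- rows.
  ExactRows k zero = Exact (Vec.tail innerᵛ)
  ExactRows k (suc m) = ExactRows k m × Exact (Vec.tail (valueᵛ (piece k m) k m))

  exactRows? : ∀ k m → Dec (ExactRows k m)
  exactRows? k zero = exact? _
  exactRows? k (suc m) = exactRows? k m ×-dec exact? _

  -- The certificate for one residue class: the defect equals c + 6κ with a natural number c and a
  -- form κ that will be known to be non-negative.
  Check : Vec ℤ (suc n) → ℕ → Set
  Check κ c =
    (ExactRows 1 (rows 1) × ExactRows 2 (rows 2) × ExactRows 3 (rows 3) × ExactRows 4 (rows 4) × ExactRows 5 (rows 5)) ×
    defectᵛ ≡ constant (+ c) +ᵛ + 6 *ᵛ κ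

  check? : ∀ κ c → Dec (Check κ c)
  check? κ c =
    (exactRows? 1 _ ×-dec exactRows? 2 _ ×-dec exactRows? 3 _ ×-dec exactRows? 4 _ ×-dec exactRows? 5 _)
    ×-dec Vec.≡-dec ℤ._≟_ _ _

  module _ (ρ : ℕ → ℤ) (ps : Vec ℤ n) (σ≡ρ : ∀ h → dot (σ h) (1ℤ ∷ⱽ ps) ≡ ρ h) where

    ⟦_⟧ : Vec ℤ (suc n) → ℤ
    ⟦ v ⟧ = dot v (1ℤ ∷ⱽ ps)

    ⟦⟧-+* : ∀ u c v → ⟦ u +ᵛ c *ᵛ v ⟧ ≡ ⟦ u ⟧ + c * ⟦ v ⟧
    ⟦⟧-+* u c v = trans (dot-+ u (c *ᵛ v) _) (cong (λ x → ⟦ u ⟧ + x) (dot-* c v _))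

    ⟦value⟧ : ∀ h k j → ⟦ valueᵛ h k j ⟧ ≡ value ρ h k j
    ⟦value⟧ h k j = trans (⟦⟧-+* (+ k *ᵛ σ h) slope Δ) (cong₂ _+_ (trans (dot-* (+ k) (σ h) _) (cong (+ k *_) (σ≡ρ h)))
        (cong (slope *_) (trans (⟦⟧-+* (σ (suc h)) (- 1ℤ) (σ h))
          (trans (cong₂ (λ x y → x + - 1ℤ * y) (σ≡ρ (suc h)) (σ≡ρ h)) (cong (λ x → ρ (suc h) + x) (ℤ.-1*i≡-i (ρ h)))))))
      where
      slope = + 2 * + j - + h * + k
      Δ = σ (suc h) +ᵛ - 1ℤ *ᵛ σ h

    ⟦rows⟧ : ∀ k m → ExactRows k m → ⟦ Σᵛ m (rowEndᵛ k) ⟧ ≡ Σ< m (rowEnd ρ k)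
    ⟦rows⟧ k zero _ = dot-constant 0ℤ ps
    ⟦rows⟧ k (suc m) (es , e) = trans (dot-+ (Σᵛ m (rowEndᵛ k)) _ _)
      (cong₂ _+_ (⟦rows⟧ k m es)
        (trans (sym (dot-floor (valueᵛ (piece k m) k m) ps e)) (cong (ℤ._/ℕ 12) (⟦value⟧ (piece k m) k m))))

    exact-inner : ∀ k m → ExactRows k m → Exact (Vec.tail innerᵛ)
    exact-inner k zero e = e
    exact-inner k (suc m) (es , _) = exact-inner k m es

    ⟦inner⟧ : Exact (Vec.tail innerᵛ) → ⟦ floorᵛ innerᵛ ⟧ ≡ innerEnd ρ
    ⟦inner⟧ e = trans (sym (dot-floor innerᵛ ps e))
      (cong (ℤ._/ℕ 12) (trans (dot-+ (σ 2) (constant (- 1ℤ)) _) (cong₂ _+_ (σ≡ρ 2) (dot-constant (- 1ℤ) ps))))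

    ⟦combination⟧ : ∀ s₁ s₂ s₃ s₄ s₅ i t → ⟦ combinationᵛ s₁ s₂ s₃ s₄ s₅ i t ⟧ ≡
      combination ⟦ s₁ ⟧ ⟦ s₂ ⟧ ⟦ s₃ ⟧ ⟦ s₄ ⟧ ⟦ s₅ ⟧ ⟦ i ⟧ ⟦ t ⟧
    ⟦combination⟧ s₁ s₂ s₃ s₄ s₅ i t = trans
      (step (constant (+ 18) +ᵛ - (+ 6) *ᵛ u₆) (- 1ℤ) t (trans (⟦⟧-+* (constant (+ 18)) (- (+ 6)) u₆)
        (cong₂ (λ x y → x + - (+ 6) * y) (dot-constant (+ 18) ps)
          (step u₅ (- (+ 3)) i (step u₄ (- (+ 5)) s₄ (step u₃ (- (+ 3)) s₃ (step u₂ (- (+ 3)) s₁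
            (step u₁ (+ 3) s₅ (dot-* (+ 9) s₂ _)))))))))
      (generic ⟦ s₁ ⟧ ⟦ s₂ ⟧ ⟦ s₃ ⟧ ⟦ s₄ ⟧ ⟦ s₅ ⟧ ⟦ i ⟧ ⟦ t ⟧)
      where
      u₁ = + 9 *ᵛ s₂
      u₂ = u₁ +ᵛ + 3 *ᵛ s₅
      u₃ = u₂ +ᵛ - (+ 3) *ᵛ s₁
      u₄ = u₃ +ᵛ - (+ 3) *ᵛ s₃
      u₅ = u₄ +ᵛ - (+ 5) *ᵛ s₄
      u₆ = u₅ +ᵛ - (+ 3) *ᵛ i
      step : ∀ u c v {x} → ⟦ u ⟧ ≡ x → ⟦ u +ᵛ c *ᵛ v ⟧ ≡ x + c * ⟦ v ⟧
      step u c v refl = ⟦⟧-+* u c v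
      generic : ∀ s₁ s₂ s₃ s₄ s₅ i t →
        + 18 + - (+ 6) * (+ 9 * s₂ + + 3 * s₅ + - (+ 3) * s₁ + - (+ 3) * s₃ + - (+ 5) * s₄ + - (+ 3) * i) + - 1ℤ * t ≡
        + 18 - + 6 * (+ 9 * s₂ + + 3 * s₅ - + 3 * s₁ - + 3 * s₃ - + 5 * s₄ - + 3 * i) - t
      generic = solve-∀

    defect-≥0 : ∀ κ c → True (check? κ c) → 0ℤ ≤ ⟦ κ ⟧ → 0ℤ ≤ defect ρ
    defect-≥0 κ c chk κ≥0 with toWitness {a? = check? κ c} chk
    ... | (e₁ , e₂ , e₃ , e₄ , e₅) , eq = 0≤+ {c} ⊕ 0≤+ {6} ⊗ κ≥0 by trans (sym rhs) (trans (cong ⟦_⟧ (sym eq)) lhs)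
      where
      rhs : ⟦ constant (+ c) +ᵛ + 6 *ᵛ κ ⟧ ≡ + c + + 6 * ⟦ κ ⟧
      rhs = trans (⟦⟧-+* (constant (+ c)) (+ 6) κ) (cong (_+ + 6 * ⟦ κ ⟧) (dot-constant (+ c) ps))
      comb : ∀ {s₁ t₁ s₂ t₂ s₃ t₃ s₄ t₄ s₅ t₅ i j x y} → s₁ ≡ t₁ → s₂ ≡ t₂ → s₃ ≡ t₃ → s₄ ≡ t₄ → s₅ ≡ t₅ → i ≡ j → x ≡ y →
        combination s₁ s₂ s₃ s₄ s₅ i x ≡ combination t₁ t₂ t₃ t₄ t₅ j y
      comb refl refl refl refl refl refl refl = refl
      lhs : ⟦ defectᵛ ⟧ ≡ defect ρ
      lhs = trans (⟦combination⟧ (rowEndsᵛ 1) (rowEndsᵛ 2) (rowEndsᵛ 3) (rowEndsᵛ 4) (rowEndsᵛ 5) (floorᵛ innerᵛ) (σ 3))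
        (comb (⟦rows⟧ 1 (rows 1) e₁) (⟦rows⟧ 2 (rows 2) e₂) (⟦rows⟧ 3 (rows 3) e₃) (⟦rows⟧ 4 (rows 4) e₄) (⟦rows⟧ 5 (rows 5) e₅)
          (⟦inner⟧ (exact-inner 1 (rows 1) e₁)) (σ≡ρ 3))

vals : ∀ {A : Set} → A → A → A → A → ℕ → A
vals a b c d 0 = a
vals a b c d 1 = b
vals a b c d 2 = c
vals a b c d _ = d

dot-vals : ∀ {n} {ps : Vec ℤ n} {u v w z A B C D} →
  dot u ps ≡ A → dot v ps ≡ B → dot w ps ≡ C → dot z ps ≡ D → ∀ h → dot (vals u v w z h) ps ≡ vals A B C D h
dot-vals p q r s 0 = p
dot-vals p q r s 1 = q
dot-vals p q r s 2 = r
dot-vals p q r s (suc (suc (suc _))) = s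

-- Residue cases for the defect of one side

Bit : ℤ → Set
Bit π = π ≡ + 0 ⊎ π ≡ + 1

Parity : ℤ → Set
Parity n = ∃₂ λ a π → n ≡ + 2 * a + π × Bit π

parity : ∀ n → Parity n
parity n = cases (n ℤ.%ℕ 2) (ℤ.n%ℕd<d n 2) (ℤ.a≡a%ℕn+[a/ℕn]*n n 2)
  where
  q = n ℤ./ℕ 2
  swap : ∀ r q → r + q * + 2 ≡ + 2 * q + r
  swap = solve-∀
  cases : ∀ r → r ℕ.< 2 → n ≡ + r + q * + 2 → Parity n
  cases 0 _ eq = q , + 0 , trans eq (swap (+ 0) q) , inj₁ refl
  cases 1 _ eq = q , + 1 , trans eq (swap (+ 1) q) , inj₂ refl
  cases (suc (suc _)) (ℕ.s≤s (ℕ.s≤s ()))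

halve : ∀ κ → 0ℤ ≤ + 2 * κ + + 1 → 0ℤ ≤ κ
halve κ p = by-contra-≤ λ q → p ⊕ <⇒0≤ q ⊕ <⇒0≤ q by generic κ
  where
  generic : ∀ κ → + 2 * κ + + 1 + (0ℤ - κ - 1ℤ) + (0ℤ - κ - 1ℤ) ≡ - 1ℤ
  generic = solve-∀

-- Vertices at both inner heights. A row end weighs its breakpoints by (h + 1)k - 2j and 2j - hk, so
-- `ρ 1` and `ρ 3` always occur with even weight; hence only the parities of R₀ and R₂ have to be
-- fixed.
module Bends01 (π₀ π₂ : ℤ) where

  σ : ℕ → Vec ℤ 5
  σ = vals (+ 6 * π₀ ∷ⱽ + 12 ∷ⱽ + 0 ∷ⱽ + 0 ∷ⱽ + 0 ∷ⱽ []ⱽ) (+ 0 ∷ⱽ + 0 ∷ⱽ + 6 ∷ⱽ + 0 ∷ⱽ + 0 ∷ⱽ []ⱽ)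
           (+ 6 * π₂ ∷ⱽ + 0 ∷ⱽ + 0 ∷ⱽ + 12 ∷ⱽ + 0 ∷ⱽ []ⱽ) (+ 0 ∷ⱽ + 0 ∷ⱽ + 0 ∷ⱽ + 0 ∷ⱽ + 6 ∷ⱽ []ⱽ)

  -- This is 2R₂ - R₁ - R₃, the bend of the side at height 1.
  κ : Vec ℤ 5
  κ = + 2 * π₂ ∷ⱽ + 0 ∷ⱽ - 1ℤ ∷ⱽ + 4 ∷ⱽ - 1ℤ ∷ⱽ []ⱽ

  bound : ∀ c → True (Symbolic.check? σ κ c) → ∀ a m R₁ R₃ → 0ℤ ≤ + 2 * (+ 2 * m + π₂) - R₁ - R₃ →
    0ℤ ≤ defect (vals (+ 6 * (+ 2 * a + π₀)) (+ 6 * R₁) (+ 6 * (+ 2 * m + π₂)) (+ 6 * R₃))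
  bound c chk a m R₁ R₃ h = Symbolic.defect-≥0 σ _ (a ∷ⱽ R₁ ∷ⱽ m ∷ⱽ R₃ ∷ⱽ []ⱽ)
    (dot-vals (e₀ π₀ a R₁ m R₃) (e₁ a R₁ m R₃) (e₂ π₂ a R₁ m R₃) (e₃ a R₁ m R₃)) κ c chk (h by e π₂ a R₁ m R₃)
    where
    e₀ : ∀ π a R₁ m R₃ → + 6 * π * 1ℤ + (+ 12 * a + (+ 0 * R₁ + (+ 0 * m + (+ 0 * R₃ + 0ℤ)))) ≡ + 6 * (+ 2 * a + π)
    e₀ = solve-∀
    e₁ : ∀ a R₁ m R₃ → + 0 * 1ℤ + (+ 0 * a + (+ 6 * R₁ + (+ 0 * m + (+ 0 * R₃ + 0ℤ)))) ≡ + 6 * R₁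
    e₁ = solve-∀
    e₂ : ∀ π a R₁ m R₃ → + 6 * π * 1ℤ + (+ 0 * a + (+ 0 * R₁ + (+ 12 * m + (+ 0 * R₃ + 0ℤ)))) ≡ + 6 * (+ 2 * m + π)
    e₂ = solve-∀
    e₃ : ∀ a R₁ m R₃ → + 0 * 1ℤ + (+ 0 * a + (+ 0 * R₁ + (+ 0 * m + (+ 6 * R₃ + 0ℤ)))) ≡ + 6 * R₃
    e₃ = solve-∀
    e : ∀ π a R₁ m R₃ → + 2 * (+ 2 * m + π) - R₁ - R₃ ≡ + 2 * π * 1ℤ + (+ 0 * a + (- 1ℤ * R₁ + (+ 4 * m + (- 1ℤ * R₃ + 0ℤ))))
    e = solve-∀

defect-bends₁₂ : ∀ R₀ R₁ R₂ R₃ → 0ℤ ≤ + 2 * R₂ - R₁ - R₃ →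
  0ℤ ≤ defect (vals (+ 6 * R₀) (+ 6 * R₁) (+ 6 * R₂) (+ 6 * R₃))
defect-bends₁₂ R₀ R₁ R₂ R₃ = cases (parity R₀) (parity R₂)
  where
  cases : ∀ {R₀ R₂} → Parity R₀ → Parity R₂ → 0ℤ ≤ + 2 * R₂ - R₁ - R₃ →
    0ℤ ≤ defect (vals (+ 6 * R₀) (+ 6 * R₁) (+ 6 * R₂) (+ 6 * R₃))
  cases (a , _ , refl , inj₁ refl) (m , _ , refl , inj₁ refl) = Bends01.bound (+ 0) (+ 0) 0 tt a m R₁ R₃
  cases (a , _ , refl , inj₁ refl) (m , _ , refl , inj₂ refl) = Bends01.bound (+ 0) (+ 1) 18 tt a m R₁ R₃
  cases (a , _ , refl , inj₂ refl) (m , _ , refl , inj₁ refl) = Bends01.bound (+ 1) (+ 0) 0 tt a m R₁ R₃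
  cases (a , _ , refl , inj₂ refl) (m , _ , refl , inj₂ refl) = Bends01.bound (+ 1) (+ 1) 18 tt a m R₁ R₃

-- Without a vertex at Y = 1 the breakpoint there is the midpoint of R₀ and R₂, and concavity is
-- left only at Y = 2.
module Bends2 (π₀ π₂ t : ℤ) where

  σ : ℕ → Vec ℤ 4
  σ = vals (+ 6 * π₀ ∷ⱽ + 12 ∷ⱽ + 0 ∷ⱽ + 0 ∷ⱽ []ⱽ) (+ 3 * (π₀ + π₂) ∷ⱽ + 6 ∷ⱽ + 6 ∷ⱽ + 0 ∷ⱽ []ⱽ)
           (+ 6 * π₂ ∷ⱽ + 0 ∷ⱽ + 12 ∷ⱽ + 0 ∷ⱽ []ⱽ) (+ 0 ∷ⱽ + 0 ∷ⱽ + 0 ∷ⱽ + 6 ∷ⱽ []ⱽ)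

  -- The floor of (3R₂ - R₀ - 2R₃)/2, with t the floor of (3π₂ - π₀)/2 as its constant term. Since
  -- the numerator is non-negative, 2κ + 1 ≥ 0, and integrality gives κ ≥ 0.
  κ : Vec ℤ 4
  κ = t ∷ⱽ - 1ℤ ∷ⱽ + 3 ∷ⱽ - 1ℤ ∷ⱽ []ⱽ

  bound : ∀ c → True (Symbolic.check? σ κ c) → 0ℤ ≤ + 2 * t + + 1 - (+ 3 * π₂ - π₀) → ∀ a m R₃ →
    0ℤ ≤ + 3 * (+ 2 * m + π₂) - (+ 2 * a + π₀) - + 2 * R₃ →
    0ℤ ≤ defect (vals (+ 6 * (+ 2 * a + π₀)) (+ 3 * (+ 2 * a + π₀ + (+ 2 * m + π₂))) (+ 6 * (+ 2 * m + π₂)) (+ 6 * R₃))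
  bound c chk t≥ a m R₃ h = Symbolic.defect-≥0 σ _ (a ∷ⱽ m ∷ⱽ R₃ ∷ⱽ []ⱽ)
    (dot-vals (e₀ π₀ a m R₃) (e₁ π₀ π₂ a m R₃) (e₂ π₂ a m R₃) (e₃ a m R₃)) κ c chk
    (halve _ (h ⊕ t≥ by e t π₀ π₂ a m R₃))
    where
    e₀ : ∀ π a m R₃ → + 6 * π * 1ℤ + (+ 12 * a + (+ 0 * m + (+ 0 * R₃ + 0ℤ))) ≡ + 6 * (+ 2 * a + π)
    e₀ = solve-∀
    e₁ : ∀ π π′ a m R₃ → + 3 * (π + π′) * 1ℤ + (+ 6 * a + (+ 6 * m + (+ 0 * R₃ + 0ℤ))) ≡ + 3 * (+ 2 * a + π + (+ 2 * m + π′))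
    e₁ = solve-∀
    e₂ : ∀ π a m R₃ → + 6 * π * 1ℤ + (+ 0 * a + (+ 12 * m + (+ 0 * R₃ + 0ℤ))) ≡ + 6 * (+ 2 * m + π)
    e₂ = solve-∀
    e₃ : ∀ a m R₃ → + 0 * 1ℤ + (+ 0 * a + (+ 0 * m + (+ 6 * R₃ + 0ℤ))) ≡ + 6 * R₃
    e₃ = solve-∀
    e : ∀ t π π′ a m R₃ → + 3 * (+ 2 * m + π′) - (+ 2 * a + π) - + 2 * R₃ + (+ 2 * t + + 1 - (+ 3 * π′ - π)) ≡
      + 2 * (t * 1ℤ + (- 1ℤ * a + (+ 3 * m + (- 1ℤ * R₃ + 0ℤ)))) + + 1
    e = solve-∀

defect-bend₂ : ∀ R₀ R₂ R₃ → 0ℤ ≤ + 3 * R₂ - R₀ - + 2 * R₃ →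
  0ℤ ≤ defect (vals (+ 6 * R₀) (+ 3 * (R₀ + R₂)) (+ 6 * R₂) (+ 6 * R₃))
defect-bend₂ R₀ R₂ R₃ = cases (parity R₀) (parity R₂)
  where
  cases : ∀ {R₀ R₂} → Parity R₀ → Parity R₂ → 0ℤ ≤ + 3 * R₂ - R₀ - + 2 * R₃ →
    0ℤ ≤ defect (vals (+ 6 * R₀) (+ 3 * (R₀ + R₂)) (+ 6 * R₂) (+ 6 * R₃))
  cases (a , _ , refl , inj₁ refl) (m , _ , refl , inj₁ refl) = Bends2.bound (+ 0) (+ 0) (+ 0) 0 tt 0≤+ a m R₃
  cases (a , _ , refl , inj₁ refl) (m , _ , refl , inj₂ refl) = Bends2.bound (+ 0) (+ 1) (+ 1) 18 tt 0≤+ a m R₃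
  cases (a , _ , refl , inj₂ refl) (m , _ , refl , inj₁ refl) = Bends2.bound (+ 1) (+ 0) (- 1ℤ) 0 tt 0≤+ a m R₃
  cases (a , _ , refl , inj₂ refl) (m , _ , refl , inj₂ refl) = Bends2.bound (+ 1) (+ 1) (+ 1) 18 tt 0≤+ a m R₃

-- Without a vertex at Y = 2 the breakpoint there is the midpoint of R₁ and R₃. The parameters
-- satisfy R₁ = 2m + s - d and R₃ = 2m + s + t + d, which makes 12 divide the non-constant
-- coefficients of `ρ 2`, whose weight in a row may be odd. The defect is constant on each residue
-- class.
module Bends1 (π s t : ℤ) where

  σ : ℕ → Vec ℤ 4
  σ = vals (+ 6 * π ∷ⱽ + 12 ∷ⱽ + 0 ∷ⱽ + 0 ∷ⱽ []ⱽ) (+ 6 * s ∷ⱽ + 0 ∷ⱽ + 12 ∷ⱽ - (+ 6) ∷ⱽ []ⱽ)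
           (+ 6 * s + + 3 * t ∷ⱽ + 0 ∷ⱽ + 12 ∷ⱽ + 0 ∷ⱽ []ⱽ) (+ 6 * s + + 6 * t ∷ⱽ + 0 ∷ⱽ + 12 ∷ⱽ + 6 ∷ⱽ []ⱽ)

  bound : ∀ c → True (Symbolic.check? σ (constant (+ 0)) c) → ∀ R₀ R₁ R₃ a d m →
    R₀ ≡ + 2 * a + π → R₃ - R₁ ≡ + 2 * d + t → R₁ + d ≡ + 2 * m + s →
    0ℤ ≤ defect (vals (+ 6 * R₀) (+ 6 * R₁) (+ 3 * (R₁ + R₃)) (+ 6 * R₃))
  bound c chk R₀ R₁ R₃ a d m p q r = Symbolic.defect-≥0 σ _ (a ∷ⱽ m ∷ⱽ d ∷ⱽ []ⱽ)
    (dot-vals (trans (e₀ π a m d) (cong (+ 6 *_) (sym p)))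
      (trans (e₁ s a m d) (trans (cong (λ x → + 6 * (x - d)) (sym r)) (f₁ R₁ d)))
      (trans (e₂ s t a m d) (trans (cong₂ (λ x y → + 6 * (x - d) + + 3 * y) (sym r) (sym q)) (f₂ R₁ R₃ d)))
      (trans (e₃ s t a m d) (trans (cong₂ (λ x y → + 6 * (x - d) + + 6 * y) (sym r) (sym q)) (f₃ R₁ R₃ d))))
    (constant (+ 0)) c chk (0≤+ {0} by e a m d)
    where
    e₀ : ∀ π a m d → + 6 * π * 1ℤ + (+ 12 * a + (+ 0 * m + (+ 0 * d + 0ℤ))) ≡ + 6 * (+ 2 * a + π)
    e₀ = solve-∀
    e₁ : ∀ s a m d → + 6 * s * 1ℤ + (+ 0 * a + (+ 12 * m + (- (+ 6) * d + 0ℤ))) ≡ + 6 * (+ 2 * m + s - d)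
    e₁ = solve-∀
    e₂ : ∀ s t a m d → (+ 6 * s + + 3 * t) * 1ℤ + (+ 0 * a + (+ 12 * m + (+ 0 * d + 0ℤ))) ≡ + 6 * (+ 2 * m + s - d) + + 3 * (+ 2 * d + t)
    e₂ = solve-∀
    e₃ : ∀ s t a m d → (+ 6 * s + + 6 * t) * 1ℤ + (+ 0 * a + (+ 12 * m + (+ 6 * d + 0ℤ))) ≡ + 6 * (+ 2 * m + s - d) + + 6 * (+ 2 * d + t)
    e₃ = solve-∀
    f₁ : ∀ R d → + 6 * (R + d - d) ≡ + 6 * R
    f₁ = solve-∀
    f₂ : ∀ R R′ d → + 6 * (R + d - d) + + 3 * (R′ - R) ≡ + 3 * (R + R′)
    f₂ = solve-∀
    f₃ : ∀ R R′ d → + 6 * (R + d - d) + + 6 * (R′ - R) ≡ + 6 * R′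
    f₃ = solve-∀
    e : ∀ a m d → + 0 ≡ + 0 * 1ℤ + (+ 0 * a + (+ 0 * m + (+ 0 * d + 0ℤ)))
    e = solve-∀

defect-bend₁ : ∀ R₀ R₁ R₃ → 0ℤ ≤ defect (vals (+ 6 * R₀) (+ 6 * R₁) (+ 3 * (R₁ + R₃)) (+ 6 * R₃))
defect-bend₁ R₀ R₁ R₃ =
  let a , _ , p , π = parity R₀
      d , _ , q , t = parity (R₃ - R₁)
      m , _ , r , s = parity (R₁ + d)
  in cases {a} {d} {m} π s t p q r
  where
  cases : ∀ {a d m π s t} → Bit π → Bit s → Bit t → R₀ ≡ + 2 * a + π → R₃ - R₁ ≡ + 2 * d + t → R₁ + d ≡ + 2 * m + s →
    0ℤ ≤ defect (vals (+ 6 * R₀) (+ 6 * R₁) (+ 3 * (R₁ + R₃)) (+ 6 * R₃))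
  cases {a} {d} {m} (inj₁ refl) (inj₁ refl) (inj₁ refl) = Bends1.bound (+ 0) (+ 0) (+ 0) 0 tt R₀ R₁ R₃ a d m
  cases {a} {d} {m} (inj₁ refl) (inj₁ refl) (inj₂ refl) = Bends1.bound (+ 0) (+ 0) (+ 1) 24 tt R₀ R₁ R₃ a d m
  cases {a} {d} {m} (inj₁ refl) (inj₂ refl) (inj₁ refl) = Bends1.bound (+ 0) (+ 1) (+ 0) 18 tt R₀ R₁ R₃ a d m
  cases {a} {d} {m} (inj₁ refl) (inj₂ refl) (inj₂ refl) = Bends1.bound (+ 0) (+ 1) (+ 1) 6 tt R₀ R₁ R₃ a d m
  cases {a} {d} {m} (inj₂ refl) (inj₁ refl) (inj₁ refl) = Bends1.bound (+ 1) (+ 0) (+ 0) 0 tt R₀ R₁ R₃ a d m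
  cases {a} {d} {m} (inj₂ refl) (inj₁ refl) (inj₂ refl) = Bends1.bound (+ 1) (+ 0) (+ 1) 24 tt R₀ R₁ R₃ a d m
  cases {a} {d} {m} (inj₂ refl) (inj₂ refl) (inj₁ refl) = Bends1.bound (+ 1) (+ 1) (+ 0) 18 tt R₀ R₁ R₃ a d m
  cases {a} {d} {m} (inj₂ refl) (inj₂ refl) (inj₂ refl) = Bends1.bound (+ 1) (+ 1) (+ 1) 6 tt R₀ R₁ R₃ a d m

-- The two inner breakpoints divide the segment from R₀ to R₃ in thirds, so R₃ - R₀ is taken modulo
-- 3. The defect is again constant on each residue class.
module Straight (π t : ℤ) where

  σ : ℕ → Vec ℤ 3
  σ = vals (+ 6 * π ∷ⱽ + 12 ∷ⱽ + 0 ∷ⱽ []ⱽ) (+ 6 * π + + 2 * t ∷ⱽ + 12 ∷ⱽ + 6 ∷ⱽ []ⱽ)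
           (+ 6 * π + + 4 * t ∷ⱽ + 12 ∷ⱽ + 12 ∷ⱽ []ⱽ) (+ 6 * π + + 6 * t ∷ⱽ + 12 ∷ⱽ + 18 ∷ⱽ []ⱽ)

  bound : ∀ c → True (Symbolic.check? σ (constant (+ 0)) c) → ∀ R₀ R₃ a s → R₀ ≡ + 2 * a + π → R₃ - R₀ ≡ t + s * + 3 →
    0ℤ ≤ defect (vals (+ 6 * R₀) (+ 4 * R₀ + + 2 * R₃) (+ 2 * R₀ + + 4 * R₃) (+ 6 * R₃))
  bound c chk R₀ R₃ a s p q = Symbolic.defect-≥0 σ _ (a ∷ⱽ s ∷ⱽ []ⱽ)
    (dot-vals (trans (e₀ π a s) (cong (+ 6 *_) (sym p)))
      (trans (e₁ π t a s) (trans (cong₂ (λ x y → + 6 * x + + 2 * y) (sym p) (sym q)) (f₁ R₀ R₃)))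
      (trans (e₂ π t a s) (trans (cong₂ (λ x y → + 6 * x + + 4 * y) (sym p) (sym q)) (f₂ R₀ R₃)))
      (trans (e₃ π t a s) (trans (cong₂ (λ x y → + 6 * x + + 6 * y) (sym p) (sym q)) (f₃ R₀ R₃))))
    (constant (+ 0)) c chk (0≤+ {0} by e a s)
    where
    e₀ : ∀ π a s → + 6 * π * 1ℤ + (+ 12 * a + (+ 0 * s + 0ℤ)) ≡ + 6 * (+ 2 * a + π)
    e₀ = solve-∀
    e₁ : ∀ π t a s → (+ 6 * π + + 2 * t) * 1ℤ + (+ 12 * a + (+ 6 * s + 0ℤ)) ≡ + 6 * (+ 2 * a + π) + + 2 * (t + s * + 3)
    e₁ = solve-∀
    e₂ : ∀ π t a s → (+ 6 * π + + 4 * t) * 1ℤ + (+ 12 * a + (+ 12 * s + 0ℤ)) ≡ + 6 * (+ 2 * a + π) + + 4 * (t + s * + 3)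
    e₂ = solve-∀
    e₃ : ∀ π t a s → (+ 6 * π + + 6 * t) * 1ℤ + (+ 12 * a + (+ 18 * s + 0ℤ)) ≡ + 6 * (+ 2 * a + π) + + 6 * (t + s * + 3)
    e₃ = solve-∀
    f₁ : ∀ R R′ → + 6 * R + + 2 * (R′ - R) ≡ + 4 * R + + 2 * R′
    f₁ = solve-∀
    f₂ : ∀ R R′ → + 6 * R + + 4 * (R′ - R) ≡ + 2 * R + + 4 * R′
    f₂ = solve-∀
    f₃ : ∀ R R′ → + 6 * R + + 6 * (R′ - R) ≡ + 6 * R′
    f₃ = solve-∀
    e : ∀ a s → + 0 ≡ + 0 * 1ℤ + (+ 0 * a + (+ 0 * s + 0ℤ))
    e = solve-∀

defect-straight : ∀ R₀ R₃ → 0ℤ ≤ defect (vals (+ 6 * R₀) (+ 4 * R₀ + + 2 * R₃) (+ 2 * R₀ + + 4 * R₃) (+ 6 * R₃))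
defect-straight R₀ R₃ = let a , _ , p , π = parity R₀ in cases {a} π ((R₃ - R₀) ℤ.%ℕ 3) (ℤ.n%ℕd<d (R₃ - R₀) 3) p (ℤ.a≡a%ℕn+[a/ℕn]*n (R₃ - R₀) 3)
  where
  s = (R₃ - R₀) ℤ./ℕ 3
  cases : ∀ {a π} → Bit π → ∀ t → t ℕ.< 3 → R₀ ≡ + 2 * a + π → R₃ - R₀ ≡ + t + s * + 3 →
    0ℤ ≤ defect (vals (+ 6 * R₀) (+ 4 * R₀ + + 2 * R₃) (+ 2 * R₀ + + 4 * R₃) (+ 6 * R₃))
  cases {a} (inj₁ refl) 0 _ = Straight.bound (+ 0) (+ 0) 0 tt R₀ R₃ a s
  cases {a} (inj₁ refl) 1 _ = Straight.bound (+ 0) (+ 1) 18 tt R₀ R₃ a s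
  cases {a} (inj₁ refl) 2 _ = Straight.bound (+ 0) (+ 2) 6 tt R₀ R₃ a s
  cases {a} (inj₂ refl) 0 _ = Straight.bound (+ 1) (+ 0) 18 tt R₀ R₃ a s
  cases {a} (inj₂ refl) 1 _ = Straight.bound (+ 1) (+ 1) 0 tt R₀ R₃ a s
  cases {a} (inj₂ refl) 2 _ = Straight.bound (+ 1) (+ 2) 24 tt R₀ R₃ a s
  cases _ (suc (suc (suc _))) (ℕ.s≤s (ℕ.s≤s (ℕ.s≤s ())))

-- Side profiles

NonNegOn : List LatticePoint → Form → Set
NonNegOn gens φ = ∀ {X Y} → (X , Y) ∈ gens → 0ℤ ≤ ev φ X Y (+ 2)

-- The right side of the hull of the generators in the strip: `bounds` is containment, and
-- `attained` says in dual form that the breakpoints belong to P. It is stated for an arbitrary list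
-- so that the left side is the profile of the mirror image.
record Profile (gens : List LatticePoint) : Set where
  field
    ρ : ℕ → ℤ
    concave₁ : 0ℤ ≤ + 2 * ρ 1 - ρ 0 - ρ 2
    concave₂ : 0ℤ ≤ + 2 * ρ 2 - ρ 1 - ρ 3
    bounds   : ∀ h → h ℕ.≤ 3 → ∀ {X} → (X , + h) ∈ gens → 0ℤ ≤ ρ h - + 6 * X
    attained : ∀ h → h ℕ.≤ 3 → ∀ φ → NonNegOn gens φ → 0ℤ ≤ ev φ (ρ h) (+ 6 * + h) (+ 12)
    defective : 0ℤ ≤ defect ρ

upTo3 : (P : ℕ → Set) → P 0 → P 1 → P 2 → P 3 → ∀ h → h ℕ.≤ 3 → P h
upTo3 P a b c d 0 _ = a
upTo3 P a b c d 1 _ = b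
upTo3 P a b c d 2 _ = c
upTo3 P a b c d 3 _ = d
upTo3 P a b c d (suc (suc (suc (suc _)))) (ℕ.s≤s (ℕ.s≤s (ℕ.s≤s ())))

module _ {gens : List LatticePoint} where

  -- In the applications L is three times the abscissa, at height h, of the chord from (R₀ , 0) to
  -- (R₃ , 3).
  Above : ℤ → ℤ → Set
  Above h L = ∃ λ a → (a , h) ∈ gens × (∀ {X} → (X , h) ∈ gens → X ≤ a) × L < + 3 * a

  Below : ℤ → ℤ → Set
  Below h L = ∀ {X} → (X , h) ∈ gens → + 3 * X ≤ L

  max-onRow : ∀ {X} h → (X , h) ∈ gens → ∃ λ a → (a , h) ∈ gens × (∀ {X} → (X , h) ∈ gens → X ≤ a)
  max-onRow {X} h X∈ with ∃-max proj₁ (∈-filter⁺ (λ z → proj₂ z ℤ.≟ h) X∈ refl)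
  ... | (a , h′) , m∈ , max with ∈-filter⁻ (λ z → proj₂ z ℤ.≟ h) {xs = gens} m∈
  ... | a∈ , refl = a , a∈ , λ z∈ → max (∈-filter⁺ (λ z → proj₂ z ℤ.≟ h) z∈ refl)

  above∨below : ∀ h L → Above h L ⊎ Below h L
  above∨below h L = cases (onRow h gens) refl
    where
    cases : ∀ zs → onRow h gens ≡ zs → Above h L ⊎ Below h L
    cases [] eq = inj₂ λ z∈ → case subst (_ ∈_) eq (∈-filter⁺ (λ z → proj₂ z ℤ.≟ h) z∈ refl) of λ ()
    cases ((X , Y) ∷ _) eq with ∈-filter⁻ (λ z → proj₂ z ℤ.≟ h) {xs = gens} (subst ((X , Y) ∈_) (sym eq) (here refl))
    ... | X∈ , refl with max-onRow h X∈
    ... | a , a∈ , max with L ℤ.<? + 3 * a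
    ... | yes p = inj₁ (a , a∈ , max , p)
    ... | no ¬p = inj₂ λ z∈ → ℤ.≤-trans (ℤ.*-monoˡ-≤-nonNeg (+ 3) (max z∈)) (ℤ.≮⇒≥ ¬p)

  scaled : ∀ {X Y} → (X , Y) ∈ gens → ∀ φ → NonNegOn gens φ → 0ℤ ≤ ev φ (+ 6 * X) (+ 6 * Y) (+ 12)
  scaled {X} {Y} z∈ (α , β , γ) h = 0≤+ {6} ⊗ h z∈ by generic α β γ X Y
    where
    generic : ∀ α β γ X Y → + 6 * (α * X + β * Y + γ * + 2) ≡ α * (+ 6 * X) + β * (+ 6 * Y) + γ * + 12
    generic = solve-∀

  scale6 : ∀ {X a} → X ≤ a → 0ℤ ≤ + 6 * a - + 6 * X
  scale6 p = ≤⇒0≤ (ℤ.*-monoˡ-≤-nonNeg (+ 6) p)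

  module _ {R₀ R₃} (R₀∈ : (R₀ , + 0) ∈ gens) (R₃∈ : (R₃ , + 3) ∈ gens)
           (max₀ : ∀ {X} → (X , + 0) ∈ gens → X ≤ R₀) (max₃ : ∀ {X} → (X , + 3) ∈ gens → X ≤ R₃) where

    profile-bends₁₂ : ∀ {R₁ R₂} → (R₁ , + 1) ∈ gens → (R₂ , + 2) ∈ gens →
      (∀ {X} → (X , + 1) ∈ gens → X ≤ R₁) → (∀ {X} → (X , + 2) ∈ gens → X ≤ R₂) →
      R₀ + R₂ ≤ + 2 * R₁ → R₁ + R₃ ≤ + 2 * R₂ → Profile gens
    profile-bends₁₂ {R₁} {R₂} R₁∈ R₂∈ max₁ max₂ c₁ c₂ = record
      { ρ = vals (+ 6 * R₀) (+ 6 * R₁) (+ 6 * R₂) (+ 6 * R₃)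
      ; concave₁ = 0≤+ {6} ⊗ ≤⇒0≤ c₁ by generic R₀ R₁ R₂
      ; concave₂ = 0≤+ {6} ⊗ ≤⇒0≤ c₂ by generic R₁ R₂ R₃
      ; bounds = upTo3 _ (λ z∈ → scale6 (max₀ z∈)) (λ z∈ → scale6 (max₁ z∈)) (λ z∈ → scale6 (max₂ z∈)) (λ z∈ → scale6 (max₃ z∈))
      ; attained = upTo3 _ (scaled R₀∈) (scaled R₁∈) (scaled R₂∈) (scaled R₃∈)
      ; defective = defect-bends₁₂ R₀ R₁ R₂ R₃ (≤⇒0≤ c₂ by generic′ R₁ R₂ R₃)
      }
      where
      generic : ∀ a b c → + 6 * (+ 2 * b - (a + c)) ≡ + 2 * (+ 6 * b) - + 6 * a - + 6 * c
      generic = solve-∀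
      generic′ : ∀ a b c → + 2 * b - (a + c) ≡ + 2 * b - a - c
      generic′ = solve-∀

    profile-bend₂ : ∀ {R₂} → (R₂ , + 2) ∈ gens → (∀ {X} → (X , + 2) ∈ gens → X ≤ R₂) →
      (∀ {X} → (X , + 1) ∈ gens → + 2 * X ≤ R₀ + R₂) → R₀ + + 2 * R₃ ≤ + 3 * R₂ → Profile gens
    profile-bend₂ {R₂} R₂∈ max₂ max₁ c = record
      { ρ = vals (+ 6 * R₀) (+ 3 * (R₀ + R₂)) (+ 6 * R₂) (+ 6 * R₃)
      ; concave₁ = 0≤+ {0} by generic₁ R₀ R₂
      ; concave₂ = 0≤+ {3} ⊗ ≤⇒0≤ c by generic₂ R₀ R₂ R₃
      ; bounds = upTo3 _ (λ z∈ → scale6 (max₀ z∈)) (λ {X} z∈ → 0≤+ {3} ⊗ ≤⇒0≤ (max₁ z∈) by generic₃ R₀ R₂ X)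
                         (λ z∈ → scale6 (max₂ z∈)) (λ z∈ → scale6 (max₃ z∈))
      ; attained = upTo3 _ (scaled R₀∈)
          (λ (α , β , γ) h → 0≤+ {3} ⊗ h R₀∈ ⊕ 0≤+ {3} ⊗ h R₂∈ by generic₄ α β γ R₀ R₂)
          (scaled R₂∈) (scaled R₃∈)
      ; defective = defect-bend₂ R₀ R₂ R₃ (≤⇒0≤ c by generic₅ R₀ R₂ R₃)
      }
      where
      generic₁ : ∀ a b → + 0 ≡ + 2 * (+ 3 * (a + b)) - + 6 * a - + 6 * b
      generic₁ = solve-∀
      generic₂ : ∀ a b c → + 3 * (+ 3 * b - (a + + 2 * c)) ≡ + 2 * (+ 6 * b) - + 3 * (a + b) - + 6 * c
      generic₂ = solve-∀
      generic₃ : ∀ a b X → + 3 * (a + b - + 2 * X) ≡ + 3 * (a + b) - + 6 * X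
      generic₃ = solve-∀
      generic₄ : ∀ α β γ a b → + 3 * (α * a + β * + 0 + γ * + 2) + + 3 * (α * b + β * + 2 + γ * + 2) ≡
        α * (+ 3 * (a + b)) + β * + 6 + γ * + 12
      generic₄ = solve-∀
      generic₅ : ∀ a b c → + 3 * b - (a + + 2 * c) ≡ + 3 * b - a - + 2 * c
      generic₅ = solve-∀

    profile-bend₁ : ∀ {R₁} → (R₁ , + 1) ∈ gens → (∀ {X} → (X , + 1) ∈ gens → X ≤ R₁) →
      (∀ {X} → (X , + 2) ∈ gens → + 2 * X ≤ R₁ + R₃) → + 2 * R₀ + R₃ ≤ + 3 * R₁ → Profile gens
    profile-bend₁ {R₁} R₁∈ max₁ max₂ c = record
      { ρ = vals (+ 6 * R₀) (+ 6 * R₁) (+ 3 * (R₁ + R₃)) (+ 6 * R₃)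
      ; concave₁ = 0≤+ {3} ⊗ ≤⇒0≤ c by generic₁ R₀ R₁ R₃
      ; concave₂ = 0≤+ {0} by generic₂ R₁ R₃
      ; bounds = upTo3 _ (λ z∈ → scale6 (max₀ z∈)) (λ z∈ → scale6 (max₁ z∈))
                         (λ {X} z∈ → 0≤+ {3} ⊗ ≤⇒0≤ (max₂ z∈) by generic₃ R₁ R₃ X) (λ z∈ → scale6 (max₃ z∈))
      ; attained = upTo3 _ (scaled R₀∈) (scaled R₁∈)
          (λ (α , β , γ) h → 0≤+ {3} ⊗ h R₁∈ ⊕ 0≤+ {3} ⊗ h R₃∈ by generic₄ α β γ R₁ R₃)
          (scaled R₃∈)
      ; defective = defect-bend₁ R₀ R₁ R₃
      }
      where
      generic₁ : ∀ a b c → + 3 * (+ 3 * b - (+ 2 * a + c)) ≡ + 2 * (+ 6 * b) - + 6 * a - + 3 * (b + c)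
      generic₁ = solve-∀
      generic₂ : ∀ b c → + 0 ≡ + 2 * (+ 3 * (b + c)) - + 6 * b - + 6 * c
      generic₂ = solve-∀
      generic₃ : ∀ a b X → + 3 * (a + b - + 2 * X) ≡ + 3 * (a + b) - + 6 * X
      generic₃ = solve-∀
      generic₄ : ∀ α β γ a b → + 3 * (α * a + β * + 1 + γ * + 2) + + 3 * (α * b + β * + 3 + γ * + 2) ≡
        α * (+ 3 * (a + b)) + β * + 12 + γ * + 12
      generic₄ = solve-∀

    profile-straight : Below (+ 1) (+ 2 * R₀ + R₃) → Below (+ 2) (R₀ + + 2 * R₃) → Profile gens
    profile-straight b₁ b₂ = record
      { ρ = vals (+ 6 * R₀) (+ 4 * R₀ + + 2 * R₃) (+ 2 * R₀ + + 4 * R₃) (+ 6 * R₃)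
      ; concave₁ = 0≤+ {0} by generic₁ R₀ R₃
      ; concave₂ = 0≤+ {0} by generic₂ R₀ R₃
      ; bounds = upTo3 _ (λ z∈ → scale6 (max₀ z∈))
          (λ {X} z∈ → 0≤+ {2} ⊗ ≤⇒0≤ (b₁ z∈) by generic₃ R₀ R₃ X)
          (λ {X} z∈ → 0≤+ {2} ⊗ ≤⇒0≤ (b₂ z∈) by generic₄ R₀ R₃ X)
          (λ z∈ → scale6 (max₃ z∈))
      ; attained = upTo3 _ (scaled R₀∈)
          (λ (α , β , γ) h → 0≤+ {4} ⊗ h R₀∈ ⊕ 0≤+ {2} ⊗ h R₃∈ by generic₅ α β γ R₀ R₃)
          (λ (α , β , γ) h → 0≤+ {2} ⊗ h R₀∈ ⊕ 0≤+ {4} ⊗ h R₃∈ by generic₆ α β γ R₀ R₃)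
          (scaled R₃∈)
      ; defective = defect-straight R₀ R₃
      }
      where
      generic₁ : ∀ a b → + 0 ≡ + 2 * (+ 4 * a + + 2 * b) - + 6 * a - (+ 2 * a + + 4 * b)
      generic₁ = solve-∀
      generic₂ : ∀ a b → + 0 ≡ + 2 * (+ 2 * a + + 4 * b) - (+ 4 * a + + 2 * b) - + 6 * b
      generic₂ = solve-∀
      generic₃ : ∀ a b X → + 2 * (+ 2 * a + b - + 3 * X) ≡ + 4 * a + + 2 * b - + 6 * X
      generic₃ = solve-∀
      generic₄ : ∀ a b X → + 2 * (a + + 2 * b - + 3 * X) ≡ + 2 * a + + 4 * b - + 6 * X
      generic₄ = solve-∀
      generic₅ : ∀ α β γ a b → + 4 * (α * a + β * + 0 + γ * + 2) + + 2 * (α * b + β * + 3 + γ * + 2) ≡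
        α * (+ 4 * a + + 2 * b) + β * + 6 + γ * + 12
      generic₅ = solve-∀
      generic₆ : ∀ α β γ a b → + 2 * (α * a + β * + 0 + γ * + 2) + + 4 * (α * b + β * + 3 + γ * + 2) ≡
        α * (+ 2 * a + + 4 * b) + β * + 12 + γ * + 12
      generic₆ = solve-∀

    -- A convex hull computation with at most one candidate per row. A rightmost point beyond the
    -- chord from Y = 0 to Y = 3 may be a vertex; when both inner rows have one, the two midpoint
    -- tests decide which of them bend the boundary.
    profile-max : Profile gens
    profile-max = cases (above∨below (+ 1) (+ 2 * R₀ + R₃)) (above∨below (+ 2) (R₀ + + 2 * R₃))
      where
      double : ∀ {X a} → X ≤ a → 0ℤ ≤ + 2 * a - + 2 * X
      double p = ≤⇒0≤ (ℤ.*-monoˡ-≤-nonNeg (+ 2) p)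
      thirds₂ : ∀ a b c X → + 3 * a - (+ 2 * b + c) - 1ℤ + + 2 * (b + + 2 * c - + 3 * X) + 1ℤ ≡ + 3 * (a + c - + 2 * X)
      thirds₂ = solve-∀
      thirds₁ : ∀ a b c X → + 3 * a - (c + + 2 * b) - 1ℤ + + 2 * (+ 2 * c + b - + 3 * X) + 1ℤ ≡ + 3 * (c + a - + 2 * X)
      thirds₁ = solve-∀
      below₁ : ∀ {a₁ a₂} X → X ≤ a₁ → + 2 * a₁ < R₀ + a₂ → + 2 * X ≤ R₀ + a₂
      below₁ X p q = ℤ.≤-trans (0≤⇒≤ (double p)) (<⇒≤ q)
      below₂ : ∀ {a₁ a₂} X → X ≤ a₂ → + 2 * a₂ < a₁ + R₃ → + 2 * X ≤ a₁ + R₃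
      below₂ X p q = ℤ.≤-trans (0≤⇒≤ (double p)) (<⇒≤ q)
      both : ∀ {a₁ a₂} → Dec (R₀ + a₂ ≤ + 2 * a₁) → Dec (a₁ + R₃ ≤ + 2 * a₂) →
        (a₁ , + 1) ∈ gens → (∀ {X} → (X , + 1) ∈ gens → X ≤ a₁) → + 2 * R₀ + R₃ < + 3 * a₁ →
        (a₂ , + 2) ∈ gens → (∀ {X} → (X , + 2) ∈ gens → X ≤ a₂) → R₀ + + 2 * R₃ < + 3 * a₂ → Profile gens
      both (yes c₁) (yes c₂) a₁∈ max₁ _ a₂∈ max₂ _ = profile-bends₁₂ a₁∈ a₂∈ max₁ max₂ c₁ c₂
      both (no c) _ a₁∈ max₁ _ a₂∈ max₂ l₂ = profile-bend₂ a₂∈ max₂ (λ {X} z∈ → below₁ X (max₁ z∈) (≰⇒> c)) (<⇒≤ l₂)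
      both {a₁} {a₂} (yes _) (no c) a₁∈ max₁ l₁ a₂∈ max₂ _ = profile-bend₁ a₁∈ max₁ (λ {X} z∈ → below₂ {a₁} {a₂} X (max₂ z∈) (≰⇒> c)) (<⇒≤ l₁)
      cases : Above (+ 1) (+ 2 * R₀ + R₃) ⊎ Below (+ 1) (+ 2 * R₀ + R₃) →
              Above (+ 2) (R₀ + + 2 * R₃) ⊎ Below (+ 2) (R₀ + + 2 * R₃) → Profile gens
      cases (inj₁ (a₁ , a₁∈ , max₁ , l₁)) (inj₁ (a₂ , a₂∈ , max₂ , l₂)) =
        both (R₀ + a₂ ℤ.≤? + 2 * a₁) (a₁ + R₃ ℤ.≤? + 2 * a₂) a₁∈ max₁ l₁ a₂∈ max₂ l₂
      -- Replacing R₀ by a point beyond the chord moves the chord outwards, so the points at Y = 2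
      -- stay on its inner side.
      cases (inj₁ (a₁ , a₁∈ , max₁ , l₁)) (inj₂ b₂) = profile-bend₁ a₁∈ max₁
        (λ {X} z∈ → 0≤⇒≤ (cancel-≤ {+ 3} (+<+ (ℕ.s≤s ℕ.z≤n))
          (<⇒0≤ l₁ ⊕ 0≤+ {2} ⊗ ≤⇒0≤ (b₂ z∈) ⊕ 0≤+ {1} by thirds₂ a₁ R₀ R₃ X))) (<⇒≤ l₁)
      cases (inj₂ b₁) (inj₁ (a₂ , a₂∈ , max₂ , l₂)) = profile-bend₂ a₂∈ max₂
        (λ {X} z∈ → 0≤⇒≤ (cancel-≤ {+ 3} (+<+ (ℕ.s≤s ℕ.z≤n))
          (<⇒0≤ l₂ ⊕ 0≤+ {2} ⊗ ≤⇒0≤ (b₁ z∈) ⊕ 0≤+ {1} by thirds₁ a₂ R₃ R₀ X))) (<⇒≤ l₂)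
      cases (inj₂ b₁) (inj₂ b₂) = profile-straight b₁ b₂

  profile : ∀ {X₀ X₃} → (X₀ , + 0) ∈ gens → (X₃ , + 3) ∈ gens → Profile gens
  profile X₀∈ X₃∈ =
    let _ , R₀∈ , max₀ = max-onRow (+ 0) X₀∈
        _ , R₃∈ , max₃ = max-onRow (+ 3) X₃∈
    in profile-max R₀∈ R₃∈ max₀ max₃

-- Counting lattice points by rows

pos-mono : ∀ {m n} → m ℕ.≤ n → 0ℤ ≤ + n - + m
pos-mono p = ≤⇒0≤ (+≤+ p)

module RowSums (b c : ℕ → ℕ) where

  -- With b and c the numbers of boundary and interior lattice points per row, this is the part of b
  -- - 2i that comes from the rows 1 to n.
  excess : ℕ → ℤ
  excess n = + Σ₁ b n - + 2 * + Σ₁ c n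

  gain : ℕ → ℤ
  gain n = + b n - + 2 * + c n

  excess-suc : ∀ n → excess (suc n) ≡ excess n + gain (suc n)
  excess-suc n = trans
    (cong₂ (λ x y → x - + 2 * y) (ℤ.pos-+ (Σ₁ b n) (b (suc n))) (ℤ.pos-+ (Σ₁ c n) (c (suc n))))
    (generic (+ Σ₁ b n) (+ b (suc n)) (+ Σ₁ c n) (+ c (suc n)))
    where
    generic : ∀ B b C c → B + b - + 2 * (C + c) ≡ B - + 2 * C + (b - + 2 * c)
    generic = solve-∀

  excess-segment : ∀ e n k → (∀ y → n ℕ.< y → y ℕ.≤ n ℕ.+ k → gain y ≤ e) →
    0ℤ ≤ excess n + + k * e - excess (n ℕ.+ k)
  excess-segment e n zero h rewrite ℕ.+-identityʳ n = 0≤+ {0} by generic (excess n) e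
    where
    generic : ∀ x e → + 0 ≡ x + + 0 * e - x
    generic = solve-∀
  excess-segment e n (suc k) h rewrite ℕ.+-suc n k =
    excess-segment e n k (λ y p q → h y p (ℕ.m≤n⇒m≤1+n q))
      ⊕ ≤⇒0≤ (h (suc (n ℕ.+ k)) (ℕ.s≤s (ℕ.m≤m+n n k)) ℕ.≤-refl)
      by trans (generic (excess n) (+ k) e (excess (n ℕ.+ k)) (gain (suc (n ℕ.+ k))))
               (cong (λ z → excess n + (1ℤ + + k) * e - z) (sym (excess-suc (n ℕ.+ k))))
    where
    generic : ∀ x k e y g → x + k * e - y + (e - g) ≡ x + (1ℤ + k) * e - (y + g)
    generic = solve-∀

  -- The lattice points strictly inside a trapezoid of height t whose parallel sides have lengths N ≥ 3 (at y = 0)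
  -- and q outnumber, up to a small error, half of the lattice points on its two legs.
  module _ (N q T : ℤ) (N≥3 : + 3 ≤ N) (q≥0 : 0ℤ ≤ q) (t′ : ℕ) (T≡ : T - 1ℤ ≡ + t′) (t′≥1 : 1 ℕ.≤ t′)
           (legs : ∀ y → 1 ℕ.≤ y → y ℕ.≤ t′ → b y ℕ.≤ 2)
           (inner : ∀ y → 1 ℕ.≤ y → y ℕ.≤ t′ → ∀ m → T * + m < N * (T - + y) + q * + y → m ℕ.≤ c y) where

    private
      T≥1 : 0ℤ ≤ T - 1ℤ
      T≥1 = 0≤+ {t′} by sym T≡
      T≥0 : 0ℤ ≤ T
      T≥0 = T≥1 ⊕ 0≤+ {1} by solve (T ∷ [])

    -- A row has at most two boundary points, and an open segment of length w contains at least w -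
    -- 1 lattice points; here w = (N(T - y) + qy)/T, and the inequality is multiplied by T.
    gain-≤ : ∀ y {z} → z ≡ + y → 1 ℕ.≤ y → y ℕ.≤ t′ → 0ℤ ≤ + 4 * T - + 2 * (N * (T - z) + q * z) - T * gain y
    gain-≤ y refl 1≤y y≤t′ =
      subst (λ g → 0ℤ ≤ + 4 * T - + 2 * (N * (T - + y) + q * + y) - T * g) {+ b y - + 2 * + c y} {gain y} refl
        (T≥0 ⊗ pos-mono (legs y 1≤y y≤t′) ⊕ 0≤+ {2} ⊗ wide
          by generic T (+ c y) (+ b y) (N * (T - + y) + q * + y))
      where
      widen : ∀ {m} → m ≡ 1ℤ + + c y → N * (T - + y) + q * + y ≤ T * m
      widen refl = ℤ.≮⇒≥ λ p → ℕ.<-irrefl refl (inner y 1≤y y≤t′ (suc (c y)) p)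
      wide : 0ℤ ≤ T * (+ c y + 1ℤ) - (N * (T - + y) + q * + y)
      wide = ≤⇒0≤ (widen (ℤ.+-comm (+ c y) 1ℤ))
      generic : ∀ T c b L → T * (+ 2 - b) + + 2 * (T * (c + 1ℤ) - L) ≡ + 4 * T - + 2 * L - T * (b - + 2 * c)
      generic = solve-∀

    excess-average : ∀ n {z} → z ≡ + n → n ℕ.≤ t′ →
      0ℤ ≤ z * (+ 4 * T - + 2 * T * N) + (N - q) * (z * (z + 1ℤ)) - T * excess n
    excess-average zero {z} z≡0 _ = subst (λ z → 0ℤ ≤ z * (+ 4 * T - + 2 * T * N) + (N - q) * (z * (z + 1ℤ)) - T * + 0) (sym z≡0)
      (0≤+ {0} by generic T N q)
      where
      generic : ∀ T N q → + 0 ≡ + 0 * (+ 4 * T - + 2 * T * N) + (N - q) * (+ 0 * (+ 0 + 1ℤ)) - T * + 0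
      generic = solve-∀
    excess-average (suc n) {z} z≡ n<t′ =
      subst (λ e → 0ℤ ≤ z * (+ 4 * T - + 2 * T * N) + (N - q) * (z * (z + 1ℤ)) - T * e) (sym (excess-suc n))
        (excess-average n {z - 1ℤ} (cong (_- 1ℤ) z≡) (ℕ.<⇒≤ n<t′) ⊕ gain-≤ (suc n) z≡ (ℕ.s≤s ℕ.z≤n) n<t′
          by generic z T N q (excess n) (gain (suc n)))
      where
      generic : ∀ z T N q x g →
        (z - 1ℤ) * (+ 4 * T - + 2 * T * N) + (N - q) * ((z - 1ℤ) * (z - 1ℤ + 1ℤ)) - T * x
          + (+ 4 * T - + 2 * (N * (T - z) + q * z) - T * g) ≡
        z * (+ 4 * T - + 2 * T * N) + (N - q) * (z * (z + 1ℤ)) - T * (x + g)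
      generic = solve-∀

    -- The averaged bound at n = T - 1 reads excess ≤ (T - 1)(4 - N - q). For N + q ≥ 4 and T ≥ 2
    -- the right side is at most 4 - N - q.
    excess-wide : + 4 ≤ N + q → excess t′ + q + N ≤ + 5
    excess-wide w = 0≤⇒≤
      (cancel-≤ {T} {(T - 1ℤ) * (+ 4 - N - q) - excess t′} (0≤⇒pos T≥1) (excess-average t′ T≡ ℕ.≤-refl by averaged T N q (excess t′))
        ⊕ (pos-mono t′≥1 by cong (_- + 1) (sym T≡)) ⊗ ≤⇒0≤ w ⊕ 0≤+ {1} by generic T N q (excess t′))
      where
      averaged : ∀ t N q x →
        (t - 1ℤ) * (+ 4 * t - + 2 * t * N) + (N - q) * ((t - 1ℤ) * (t - 1ℤ + 1ℤ)) - t * x ≡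
        t * ((t - 1ℤ) * (+ 4 - N - q) - x)
      averaged = solve-∀
      generic : ∀ t N q x →
        (t - 1ℤ) * (+ 4 - N - q) - x + (t - 1ℤ - 1ℤ) * (N + q - + 4) + 1ℤ ≡ + 5 - (x + q + N)
      generic = solve-∀

    -- The averaging argument loses too much for a triangle with base 3; there the rows are counted in thirds.
    excess-narrow : N ≡ + 3 → q ≡ + 0 → excess t′ ≤ + 2
    excess-narrow refl refl = 0≤⇒≤
      (excess-segment (- (+ 2)) 0 u low
        ⊕ subst (λ m → 0ℤ ≤ excess u + + (w ℕ.∸ u) * + 0 - excess m) (ℕ.m+[n∸m]≡n u≤w)
            (excess-segment (+ 0) u (w ℕ.∸ u) middle)
        ⊕ subst (λ m → 0ℤ ≤ excess w + + (t′ ℕ.∸ w) * + 2 - excess m) (ℕ.m+[n∸m]≡n w≤t′)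
            (excess-segment (+ 2) w (t′ ℕ.∸ w) (λ y w<y y≤ → high y (ℕ.≤-trans (ℕ.s≤s ℕ.z≤n) w<y) (subst (y ℕ.≤_) (ℕ.m+[n∸m]≡n w≤t′) y≤)))
        ⊕ 0≤+ {2} ⊗ count
        by trans (cong (λ r → + 0 + + u * - (+ 2) - excess u + (excess u + + (w ℕ.∸ u) * + 0 - excess w)
                               + (excess w + r * + 2 - excess t′) + + 2 * (+ u + + w + 1ℤ - + t′))
                   (trans (sym (ℤ.⊖-≥ w≤t′)) (sym (ℤ.m-n≡m⊖n t′ w))))
                 (generic (excess u) (excess w) (excess t′) (+ u) (+ w) (+ t′) (+ (w ℕ.∸ u))))
      where
      -- With T = t′ + 1, row y has length 3(T - y)/T. It exceeds 2 for 3y < T, that is up to row u,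
      -- and exceeds 1 for 3y < 2T, that is up to row w.
      u w : ℕ
      u = t′ ℕ./ 3
      w = (2 ℕ.* t′ ℕ.+ 1) ℕ./ 3
      3u≤ : u ℕ.* 3 ℕ.≤ t′
      3u≤ = ℕ.m/n*n≤m t′ 3
      3w≤ : w ℕ.* 3 ℕ.≤ 2 ℕ.* t′ ℕ.+ 1
      3w≤ = ℕ.m/n*n≤m (2 ℕ.* t′ ℕ.+ 1) 3
      u≤w : u ℕ.≤ w
      u≤w = ℕ./-monoˡ-≤ 3 (ℕ.≤-trans (ℕ.m≤m+n t′ (t′ ℕ.+ 0)) (ℕ.m≤m+n (2 ℕ.* t′) 1))
      w≤t′ : w ℕ.≤ t′
      w≤t′ = ℕ.*-cancelʳ-≤ w t′ 3 (ℕ.≤-trans 3w≤ (ℕ.≤-trans (ℕ.+-monoʳ-≤ (2 ℕ.* t′) t′≥1) (ℕ.≤-reflexive (eq t′))))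
        where
        eq : ∀ t → 2 ℕ.* t ℕ.+ t ≡ t ℕ.* 3
        eq t = trans (ℕ.+-comm (2 ℕ.* t) t) (ℕ.*-comm 3 t)
      remainder : ∀ n → 0ℤ ≤ + 3 * + (n ℕ./ 3) + + 2 - + n
      remainder n = pos-mono (ℕ.m%n<n n 3) by
        trans (generic′ (+ (n ℕ./ 3)) (+ (n ℕ.% 3)))
          (cong (λ z → + 3 * + (n ℕ./ 3) + + 2 - z) (sym division))
        where
        generic′ : ∀ q r → + 3 - (1ℤ + r) ≡ + 3 * q + + 2 - (r + q * + 3)
        generic′ = solve-∀
        division : + n ≡ + (n ℕ.% 3) + + (n ℕ./ 3) * + 3
        division = trans (cong +_ (ℕ.m≡m%n+[m/n]*n n 3))
          (trans (ℤ.pos-+ (n ℕ.% 3) (n ℕ./ 3 ℕ.* 3)) (cong (λ z → + (n ℕ.% 3) + z) (ℤ.pos-* (n ℕ./ 3) 3)))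
      count : 0ℤ ≤ + u + + w + 1ℤ - + t′
      count = halve₃ (remainder t′ ⊕ (remainder (2 ℕ.* t′ ℕ.+ 1)
                by cong (λ z → + 3 * + w + + 2 - z) (trans (ℤ.pos-+ (2 ℕ.* t′) 1) (cong (_+ + 1) (ℤ.pos-* 2 t′))))
                by generic′ (+ u) (+ w) (+ t′))
        where
        generic′ : ∀ u w t → + 3 * u + + 2 - t + (+ 3 * w + + 2 - (+ 2 * t + + 1)) ≡ + 3 * (u + w + 1ℤ - t)
        generic′ = solve-∀
        halve₃ : ∀ {x} → 0ℤ ≤ + 3 * x → 0ℤ ≤ x
        halve₃ = cancel-≤ {+ 3} (+<+ (ℕ.s≤s ℕ.z≤n))
      high : ∀ y → 1 ℕ.≤ y → y ℕ.≤ t′ → gain y ≤ + 2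
      high y 1≤y y≤ = 0≤⇒≤ (pos-mono (legs y 1≤y y≤) ⊕ 0≤+ {2} ⊗ 0≤+ {c y} by generic′ (+ b y) (+ c y))
        where
        generic′ : ∀ b c → + 2 - b + + 2 * c ≡ + 2 - (b - + 2 * c)
        generic′ = solve-∀
      thirds : ∀ m y → 1 ℕ.≤ y → y ℕ.≤ t′ → + 3 * + y + T * + m < + 3 * T → gain y ≤ + 2 - + 2 * + m
      thirds m y 1≤y y≤ p = 0≤⇒≤ (pos-mono (legs y 1≤y y≤)
        ⊕ 0≤+ {2} ⊗ pos-mono (inner y 1≤y y≤ m (0≤⇒< (<⇒0≤ p by generic₁ T (+ y) (+ m)))) by generic₂ (+ b y) (+ c y) (+ m))
        where
        generic₁ : ∀ T y m → + 3 * T - (+ 3 * y + T * m) - 1ℤ ≡ + 3 * (T - y) + + 0 * y - T * m - 1ℤ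
        generic₁ = solve-∀
        generic₂ : ∀ b c m → + 2 - b + + 2 * (c - m) ≡ + 2 - + 2 * m - (b - + 2 * c)
        generic₂ = solve-∀
      low : ∀ y → 0 ℕ.< y → y ℕ.≤ 0 ℕ.+ u → gain y ≤ - (+ 2)
      low y 0<y y≤u = thirds 2 y 0<y (ℕ.≤-trans y≤u (ℕ.≤-trans u≤w w≤t′))
        (0≤⇒< (0≤+ {3} ⊗ pos-mono y≤u ⊕ (pos-mono 3u≤ by cong₂ _-_ (sym T≡) (ℤ.pos-* u 3)) by generic′ (+ y) (+ u) T))
        where
        generic′ : ∀ y u t → + 3 * (u - y) + (t - 1ℤ - u * + 3) ≡ + 3 * t - (+ 3 * y + t * + 2) - 1ℤ
        generic′ = solve-∀
      middle : ∀ y → u ℕ.< y → y ℕ.≤ u ℕ.+ (w ℕ.∸ u) → gain y ≤ + 0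
      middle y u<y y≤ = thirds 1 y (ℕ.≤-trans (ℕ.s≤s ℕ.z≤n) u<y) (ℕ.≤-trans y≤w w≤t′)
        (0≤⇒< (0≤+ {3} ⊗ pos-mono y≤w ⊕ (pos-mono 3w≤ by cong₂ _-_ (trans (ℤ.pos-+ (2 ℕ.* t′) 1) (cong (_+ + 1) (trans (ℤ.pos-* 2 t′) (cong (+ 2 *_) (sym T≡))))) (ℤ.pos-* w 3))
          by generic′ (+ y) (+ w) T))
        where
        y≤w : y ℕ.≤ w
        y≤w = subst (y ℕ.≤_) (ℕ.m+[n∸m]≡n u≤w) y≤
        generic′ : ∀ y w t → + 3 * (w - y) + (+ 2 * (t - 1ℤ) + + 1 - w * + 3) ≡ + 3 * t - (+ 3 * y + t * + 1) - 1ℤ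
        generic′ = solve-∀
      generic : ∀ a b c u w t k →
        + 0 + u * - (+ 2) - a + (a + k * + 0 - b) + (b + (t - w) * + 2 - c) + + 2 * (u + w + 1ℤ - t) ≡ + 2 - c
      generic = solve-∀

    excess-≤ : excess t′ + q + N ≤ + 5
    excess-≤ = cases (+ 4 ℤ.≤? N + q)
      where
      cases : Dec (+ 4 ≤ N + q) → excess t′ + q + N ≤ + 5
      cases (yes p) = excess-wide p
      cases (no ¬p) = ℤ.≤-trans
        (ℤ.+-mono-≤ (ℤ.+-mono-≤ (excess-narrow N≡3 q≡0) (ℤ.≤-reflexive q≡0)) (ℤ.≤-reflexive N≡3)) ℤ.≤-refl
        where
        sum≤3 : 0ℤ ≤ + 4 - (N + q) - 1ℤ
        sum≤3 = <⇒0≤ (≰⇒> ¬p)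
        N≡3 : N ≡ + 3
        N≡3 = ℤ.≤-antisym (0≤⇒≤ (sum≤3 ⊕ q≥0 by solve (N ∷ q ∷ []))) N≥3
        q≡0 : q ≡ + 0
        q≡0 = ℤ.≤-antisym (0≤⇒≤ (sum≤3 ⊕ ≤⇒0≤ N≥3 by solve (N ∷ q ∷ []))) q≥0

-- Forms on a trapezoid and on a row

form-zero : ∀ α β γ {N p t τ x y} → 0ℤ < N → 0ℤ < t →
  ev (α , β , γ) 0ℤ 0ℤ 1ℤ ≡ 0ℤ → ev (α , β , γ) N 0ℤ 1ℤ ≡ 0ℤ → ev (α , β , γ) p t τ ≡ 0ℤ →
  ev (α , β , γ) x y 1ℤ ≡ 0ℤ
form-zero α β γ {N} {p} {t} {τ} {x} {y} N>0 t>0 A≡0 D≡0 E≡0 = vanish γ≡0 α≡0 β≡0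
  where
  generic₀ : ∀ α β γ → γ ≡ α * + 0 + β * + 0 + γ * + 1
  generic₀ = solve-∀
  generic₁ : ∀ α β N → N * α ≡ α * N + β * + 0 + + 0 * + 1
  generic₁ = solve-∀
  generic₂ : ∀ β p t τ → t * β ≡ + 0 * p + β * t + + 0 * τ
  generic₂ = solve-∀
  generic₃ : ∀ x y → + 0 * x + + 0 * y + + 0 * + 1 ≡ + 0
  generic₃ = solve-∀
  γ≡0 : γ ≡ 0ℤ
  γ≡0 = trans (generic₀ α β γ) A≡0
  α≡0 : α ≡ 0ℤ
  α≡0 = cancel-0 {N} {α} N>0 (trans (generic₁ α β N) (subst (λ γ → α * N + β * + 0 + γ * + 1 ≡ 0ℤ) γ≡0 D≡0))
  β≡0 : β ≡ 0ℤ
  β≡0 = cancel-0 {t} {β} t>0 (trans (generic₂ β p t τ)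
    (subst (λ α → α * p + β * t + + 0 * τ ≡ 0ℤ) α≡0 (subst (λ γ → α * p + β * t + γ * τ ≡ 0ℤ) γ≡0 E≡0)))
  vanish : γ ≡ 0ℤ → α ≡ 0ℤ → β ≡ 0ℤ → α * x + β * y + γ * 1ℤ ≡ 0ℤ
  vanish refl refl refl = generic₃ x y

-- Up to the factor Wt the value is a bilinear combination of the corner values A, D, E, F: u and y
-- weigh base against top, W - s and s left against right. The weights of A, D, E are at least 1,
-- and A + D + E > 0, since a form vanishing at three non-collinear points would vanish at the
-- centre. The top corners lie in slice τ, which is 1 for lattice points and 2 for a vertex of 2P.
form-inside : ∀ α β γ {x₀ y₀ N p r t τ x y κ u s W} → 0ℤ < ev (α , β , γ) x₀ y₀ 1ℤ →
  0ℤ ≤ ev (α , β , γ) 0ℤ 0ℤ 1ℤ → 0ℤ ≤ ev (α , β , γ) N 0ℤ 1ℤ →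
  0ℤ ≤ ev (α , β , γ) p t τ → 0ℤ ≤ ev (α , β , γ) r t τ →
  0ℤ < N → 0ℤ < t → 0ℤ < y → u ≡ t * κ - τ * y → s ≡ t * x - p * y → W ≡ N * u + (r - p) * y →
  0ℤ < u → 0ℤ < s → s < W → 0ℤ < ev (α , β , γ) x y κ
form-inside α β γ {x₀} {y₀} {N} {p} {r} {t} {τ} {x} {y} {κ} {u} {s} {W}
  c≥ A≥ D≥ E≥ F≥ N>0 t>0 y>0 u≡ s≡ W≡ u>0 s>0 s<W =
  cancel-< {W * t} (W>0 ⊗₊ t>0)
    (sum>0 (A + D + E ℤ.≤? 0ℤ) ⊕₊ (pos⇒0≤ (W-s>0 ⊗₊ u>0) ⊗ A≥ ⊕ pos⇒0≤ (W-s>0 ⊗₊ y>0) ⊗ E≥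
        ⊕ pos⇒0≤ (s>0 ⊗₊ u>0) ⊗ D≥ ⊕ (<⇒≤ s>0 ⊗ <⇒≤ y>0) ⊗ F≥)
      by₊ trans (regroup A D E F (W - s) s u y) (sym (barycentric u≡ s≡ W≡)))
  where
  A D E F : ℤ
  A = α * 0ℤ + β * 0ℤ + γ * 1ℤ
  D = α * N + β * 0ℤ + γ * 1ℤ
  E = α * p + β * t + γ * τ
  F = α * r + β * t + γ * τ
  W-s>0 : 0ℤ < W - s
  W-s>0 = <⇒0< s<W
  W>0 : 0ℤ < W
  W>0 = ℤ.<-trans s>0 s<W
  regroup : ∀ A D E F v s u y →
    A + D + E + ((v * u - 1ℤ) * A + (v * y - 1ℤ) * E + (s * u - 1ℤ) * D + s * y * F) ≡
    v * (u * A + y * E) + s * (u * D + y * F)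
  regroup = solve-∀
  generic : ∀ α β γ N p r t τ x y κ →
    (N * (t * κ - τ * y) + (r - p) * y) * t * (α * x + β * y + γ * κ) ≡
    (N * (t * κ - τ * y) + (r - p) * y - (t * x - p * y)) *
      ((t * κ - τ * y) * (α * + 0 + β * + 0 + γ * + 1) + y * (α * p + β * t + γ * τ)) +
    (t * x - p * y) * ((t * κ - τ * y) * (α * N + β * + 0 + γ * + 1) + y * (α * r + β * t + γ * τ))
  generic = solve-∀
  barycentric : ∀ {u s W} → u ≡ t * κ - τ * y → s ≡ t * x - p * y → W ≡ N * u + (r - p) * y →
    W * t * (α * x + β * y + γ * κ) ≡ (W - s) * (u * A + y * E) + s * (u * D + y * F)
  barycentric refl refl refl = generic α β γ N p r t τ x y κ
  drop₁ : ∀ A D E → 0ℤ - (A + D + E) + D + E ≡ 0ℤ - A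
  drop₁ = solve-∀
  drop₂ : ∀ A D E → 0ℤ - (A + D + E) + A + E ≡ 0ℤ - D
  drop₂ = solve-∀
  drop₃ : ∀ A D E → 0ℤ - (A + D + E) + A + D ≡ 0ℤ - E
  drop₃ = solve-∀
  sum>0 : Dec (A + D + E ≤ 0ℤ) → 0ℤ < A + D + E
  sum>0 (no ¬p) = ≰⇒> ¬p
  sum>0 (yes p) = ⊥-elim (ℤ.<-irrefl (sym (form-zero α β γ {N} {p = _} {t} {τ} {x₀} {y₀} N>0 t>0
    (ℤ.≤-antisym (0≤⇒≤ (≤⇒0≤ p ⊕ D≥ ⊕ E≥ by drop₁ A D E)) A≥)
    (ℤ.≤-antisym (0≤⇒≤ (≤⇒0≤ p ⊕ A≥ ⊕ E≥ by drop₂ A D E)) D≥)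
    (ℤ.≤-antisym (0≤⇒≤ (≤⇒0≤ p ⊕ A≥ ⊕ D≥ by drop₃ A D E)) E≥))) c≥)

-- The form is affine along a row. Vanishing at b while being non-negative on both sides of b, it
-- has slope 0 and vanishes on the whole row, against its positive value at the point (u/κ , y).
form-no3 : ∀ α β γ {u y κ a b c} → 0ℤ < ev (α , β , γ) u (y * κ) κ →
  0ℤ ≤ ev (α , β , γ) a y 1ℤ → ev (α , β , γ) b y 1ℤ ≡ 0ℤ → 0ℤ ≤ ev (α , β , γ) c y 1ℤ → a < b → b < c → ⊥
form-no3 α β γ {u} {y} {κ} {a} {b} {c} G>0 A≥ B≡0 C≥ a<b b<c =
  cases (ℤ.≤-total 0ℤ (u - κ * b))
  where
  v G : ℤ
  v = u - κ * b
  G = α * u + β * (y * κ) + γ * κ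
  generic₀ : ∀ G κ → G ≡ G - κ * + 0
  generic₀ = solve-∀
  generic₁ : ∀ α β γ u y κ b →
    α * u + β * (y * κ) + γ * κ - κ * (α * b + β * y + γ * + 1) ≡ α * (u - κ * b)
  generic₁ = solve-∀
  generic₂ : ∀ α β γ y a b v → (b - a) * (α * v) + v * (α * a + β * y + γ * + 1) ≡ v * (α * b + β * y + γ * + 1)
  generic₂ = solve-∀
  generic₃ : ∀ α β γ y c b v →
    (c - b) * (α * v) + (+ 0 - v) * (α * c + β * y + γ * + 1) ≡ (+ 0 - v) * (α * b + β * y + γ * + 1)
  generic₃ = solve-∀
  slope : 0ℤ < α * v
  slope = subst (λ B → 0ℤ < G - κ * B) (sym B≡0) (G>0 by₊ generic₀ G κ) by₊ generic₁ α β γ u y κ b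
  vanish : ∀ w → 0ℤ < w * (α * b + β * y + γ * 1ℤ) → ⊥
  vanish w p = ℤ.<-irrefl refl (subst (0ℤ <_) (ℤ.*-zeroʳ w) (subst (λ B → 0ℤ < w * B) B≡0 p))
  cases : 0ℤ ≤ v ⊎ v ≤ 0ℤ → ⊥
  cases (inj₁ v≥0) = vanish v
    ((<⇒0< a<b ⊗₊ slope) ⊕₊ (v≥0 ⊗ A≥) by₊ generic₂ α β γ y a b v)
  cases (inj₂ v≤0) = vanish (0ℤ - v)
    ((<⇒0< b<c ⊗₊ slope) ⊕₊ (≤⇒0≤ v≤0 ⊗ C≥) by₊ generic₃ α β γ y c b v)

0<1+ : ∀ n → 0ℤ < + suc n
0<1+ n = +<+ (ℕ.s≤s ℕ.z≤n)

floor-exists : ∀ {t} n → 0ℤ < t → ∃ λ f → 0ℤ ≤ n - t * f × 0ℤ ≤ t - (n - t * f) - 1ℤ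
floor-exists {+ suc t} n _ = n ℤ./ℕ suc t ,
  (0≤+ {n ℤ.%ℕ suc t} by remainder) ,
  (<⇒0≤ (+<+ (ℤ.n%ℕd<d n (suc t))) by cong (λ r → + suc t - r - 1ℤ) remainder)
  where
  generic : ∀ r q t → r ≡ r + q * t - t * q
  generic = solve-∀
  remainder : + (n ℤ.%ℕ suc t) ≡ n - + suc t * (n ℤ./ℕ suc t)
  remainder = trans (generic (+ (n ℤ.%ℕ suc t)) (n ℤ./ℕ suc t) (+ suc t))
    (cong (λ z → z - + suc t * (n ℤ./ℕ suc t)) (sym (ℤ.a≡a%ℕn+[a/ℕn]*n n (suc t))))
floor-exists {+ 0} n (+<+ ())

-- Boundary and interior lattice points in the rows of P

module Lattice {i b : ℕ} (P : Body i b) where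
  open Body P

  interior⇒In : ∀ {x y k} → Int x y k → In x y k
  interior⇒In = All.map <⇒≤

  I-Int : ∀ {x y} → (x , y) ∈ I → Int x y 1ℤ
  I-Int = Equivalence.to (∈-⇔ interior)

  Int-I : ∀ {x y} → Int x y 1ℤ → (x , y) ∈ I
  Int-I = Equivalence.from (∈-⇔ interior)

  B-In : ∀ {x y} → (x , y) ∈ B → In x y 1ℤ
  B-In z∈ = proj₁ (Equivalence.to (∈-⇔ boundary) z∈)

  B-zero : ∀ {x y} → (x , y) ∈ B → ∃ λ g → g ∈ forms × ev g x y 1ℤ ≡ 0ℤ
  B-zero z∈ = find (proj₂ (Equivalence.to (∈-⇔ boundary) z∈))

  I-unique : Unique I
  I-unique = proj₁ (proj₂ interior)

  B-unique : Unique B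
  B-unique = proj₁ (proj₂ boundary)

  S : List LatticePoint
  S = I ++ B

  S-In : ∀ {x y} → (x , y) ∈ S → In x y 1ℤ
  S-In z∈ = [ (λ z∈I → interior⇒In (I-Int z∈I)) , B-In ]′ (∈-++⁻ I z∈)

  Int∨zero : ∀ {x y k} → In x y k → Int x y k ⊎ Any (λ g → ev g x y k ≡ 0ℤ) forms
  Int∨zero {x} {y} {k} = go
    where
    go : ∀ {gs} → All (λ g → 0ℤ ≤ ev g x y k) gs →
      All (λ g → 0ℤ < ev g x y k) gs ⊎ Any (λ g → ev g x y k ≡ 0ℤ) gs
    go []ᴬ = inj₁ []ᴬ
    go {g ∷ _} (p ∷ᴬ ps) with ev g x y k ℤ.≟ 0ℤ
    ... | yes eq = inj₂ (here eq)
    ... | no neq with go ps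
    ... | inj₁ qs = inj₁ (ℤ.≤∧≢⇒< p (λ eq → neq (sym eq)) ∷ᴬ qs)
    ... | inj₂ q = inj₂ (there q)

  In-S : ∀ {x y} → In x y 1ℤ → (x , y) ∈ S
  In-S p = [ (λ q → ∈-++⁺ˡ (Int-I q)) , (λ q → ∈-++⁺ʳ I (Equivalence.from (∈-⇔ boundary) (p , q))) ]′ (Int∨zero p)

  interpolate : ∀ α β γ a x c y k →
    (c - x) * (α * a + β * y + γ * k) + (x - a) * (α * c + β * y + γ * k) ≡ (c - a) * (α * x + β * y + γ * k)
  interpolate = solve-∀

  between : ∀ {a x c y k} → In a y k → In c y k → a ≤ x → x ≤ c → In x y k
  between {a} {x} {c} {y} {k} p q a≤x x≤c with x ℤ.≟ a
  ... | yes refl = p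
  ... | no x≢a = All.tabulate λ {g} g∈ → form g (All.lookup p g∈) (All.lookup q g∈)
    where
    a<c : 0ℤ < c - a
    a<c = <⇒0< (ℤ.<-≤-trans (ℤ.≤∧≢⇒< a≤x (λ eq → x≢a (sym eq))) x≤c)
    form : ∀ g → 0ℤ ≤ ev g a y k → 0ℤ ≤ ev g c y k → 0ℤ ≤ ev g x y k
    form (α , β , γ) A C = cancel-≤ {c - a} {α * x + β * y + γ * k} a<c
      (≤⇒0≤ x≤c ⊗ A ⊕ ≤⇒0≤ a≤x ⊗ C by interpolate α β γ a x c y k)

  between-Int : ∀ {a x c y k} → Int a y k → In c y k → a ≤ x → x < c → Int x y k
  between-Int {a} {x} {c} {y} {k} p q a≤x x<c = All.tabulate λ {g} g∈ → form g (All.lookup p g∈) (All.lookup q g∈)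
    where
    form : ∀ g → 0ℤ < ev g a y k → 0ℤ ≤ ev g c y k → 0ℤ < ev g x y k
    form (α , β , γ) A C = cancel-< {c - a} {α * x + β * y + γ * k} (<⇒0< (ℤ.≤-<-trans a≤x x<c))
      (<⇒0< x<c ⊗₊ A ⊕₊ ≤⇒0≤ a≤x ⊗ C by₊ interpolate α β γ a x c y k)

  between-Int′ : ∀ {a x c y k} → Int a y k → In c y k → c < x → x ≤ a → Int x y k
  between-Int′ {a} {x} {c} {y} {k} p q c<x x≤a = All.tabulate λ {g} g∈ → form g (All.lookup p g∈) (All.lookup q g∈)
    where
    generic : ∀ α β γ a x c y k →
      (x - c) * (α * a + β * y + γ * k) + (a - x) * (α * c + β * y + γ * k) ≡ (a - c) * (α * x + β * y + γ * k)
    generic = solve-∀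
    form : ∀ g → 0ℤ < ev g a y k → 0ℤ ≤ ev g c y k → 0ℤ < ev g x y k
    form (α , β , γ) A C = cancel-< {a - c} {α * x + β * y + γ * k} (<⇒0< (ℤ.<-≤-trans c<x x≤a))
      (<⇒0< c<x ⊗₊ A ⊕₊ ≤⇒0≤ x≤a ⊗ C by₊ generic α β γ a x c y k)

  -- A rational interior point (u/κ , y) is enough; the row may be free of interior lattice points.
  crossing-row : ∀ {xs u y κ} → Unique xs → (∀ {z} → z ∈ xs → z ∈ B) → Int u (y * κ) κ → length (onRow y xs) ℕ.≤ 2
  crossing-row {xs} {u} {y} {κ} uniq xs⊆B m = row-≤2 y uniq no3
    where
    no3 : ∀ {a b c} → a < b → b < c → (a , y) ∈ xs → (b , y) ∈ xs → (c , y) ∈ xs → ⊥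
    no3 {a} {b} {c} a<b b<c a∈ b∈ c∈ with B-zero (xs⊆B b∈)
    ... | (α , β , γ) , g∈ , eq = form-no3 α β γ {u} {y} {κ} {a} {b} {c} (All.lookup m g∈)
      (All.lookup (B-In (xs⊆B a∈)) g∈) eq (All.lookup (B-In (xs⊆B c∈)) g∈) a<b b<c

  module Interior {x₀ y₀} (centre : Int x₀ y₀ 1ℤ) where

    inside : ∀ {N p r t τ x y κ u s W} → In 0ℤ 0ℤ 1ℤ → In N 0ℤ 1ℤ → In p t τ → In r t τ →
      0ℤ < N → 0ℤ < t → 0ℤ < y → u ≡ t * κ - τ * y → s ≡ t * x - p * y → W ≡ N * u + (r - p) * y →
      0ℤ < u → 0ℤ < s → s < W → Int x y κ
    inside {N} {p} {r} {t} {τ} {x} {y} {κ} {u} {s} {W} A D E F N>0 t>0 y>0 u≡ s≡ W≡ u>0 s>0 s<W =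
      All.tabulate λ { {α , β , γ} g∈ → form-inside α β γ {x₀} {y₀} {N} {p} {r} {t} {τ} {x} {y} {κ} {u} {s} {W}
        (All.lookup centre g∈) (All.lookup A g∈) (All.lookup D g∈) (All.lookup E g∈) (All.lookup F g∈)
        N>0 t>0 y>0 u≡ s≡ W≡ u>0 s>0 s<W }

    inner-points : ∀ {N p r t τ y u} → In 0ℤ 0ℤ 1ℤ → In N 0ℤ 1ℤ → In p t τ → In r t τ →
      0ℤ < N → 0ℤ < t → 0ℤ < y → u ≡ t * 1ℤ - τ * y → 0ℤ < u → ∀ m → t * + m < N * u + (r - p) * y →
      ∃ λ f → ∀ x → f ≤ x → x < f + + m → Int x y 1ℤ
    -- The left leg meets row y at py/t, so the m integers following the floor of py/t are
    -- candidates.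
    inner-points {N} {p} {r} {t} {τ} {y} {u} A D E F N>0 t>0 y>0 u≡ u>0 m m<W = f + 1ℤ , λ x lo hi →
      inside {N} {p} {r} {t} {τ} {x} {y} {1ℤ} {u} {t * x - p * y} {W} A D E F N>0 t>0 y>0 u≡ refl refl u>0
        (0≤⇒pos (<⇒≤ t>0 ⊗ ≤⇒0≤ lo ⊕ above by generic₁ t x f (p * y)))
        (0≤⇒< (<⇒0≤ m<W ⊕ <⇒≤ t>0 ⊗ <⇒0≤ hi ⊕ below by generic₂ t x f (p * y) (+ m) W))
      where
      W = N * u + (r - p) * y
      f = proj₁ (floor-exists (p * y) t>0)
      below = proj₁ (proj₂ (floor-exists (p * y) t>0))
      above = proj₂ (proj₂ (floor-exists (p * y) t>0))
      generic₁ : ∀ t x f n → t * (x - (f + 1ℤ)) + (t - (n - t * f) - 1ℤ) ≡ t * x - n - 1ℤ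
      generic₁ = solve-∀
      generic₂ : ∀ t x f n m W → W - t * m - 1ℤ + t * (f + 1ℤ + m - x - 1ℤ) + (n - t * f) ≡ W - (t * x - n) - 1ℤ
      generic₂ = solve-∀

    module Base {N : ℤ} (N≥3 : + 3 ≤ N) (left : In 0ℤ 0ℤ 1ℤ) (right : In N 0ℤ 1ℤ)
                (longest : ∀ {a c y} → In a y 1ℤ → In c y 1ℤ → c - a ≤ N) where

      N>0 : 0ℤ < N
      N>0 = ℤ.<-≤-trans (0<1+ 2) N≥3

      Bᵘ Iᵘ : List LatticePoint
      Bᵘ = up 0ℤ B
      Iᵘ = up 0ℤ I

      ∈-Bᵘ⁻ : ∀ {z} → z ∈ Bᵘ → z ∈ B × 0ℤ < proj₂ z
      ∈-Bᵘ⁻ = ∈-filter⁻ (λ z → 0ℤ ℤ.<? proj₂ z) {xs = B}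

      ∈-Iᵘ⁻ : ∀ {z} → z ∈ Iᵘ → z ∈ I × 0ℤ < proj₂ z
      ∈-Iᵘ⁻ = ∈-filter⁻ (λ z → 0ℤ ℤ.<? proj₂ z) {xs = I}

      Bᵘ-unique : Unique Bᵘ
      Bᵘ-unique = Unique.filter⁺ _ B-unique

      rowB rowI : ℕ → ℕ
      rowB j = length (onRow (+ j) Bᵘ)
      rowI j = length (onRow (+ j) Iᵘ)

      module _ {p r t} (top-left : In p t 1ℤ) (top-right : In r t 1ℤ) (p≤r : p ≤ r) (t>0 : 0ℤ < t) where

        width : ∀ {y} → 0ℤ < y → y < t → 0ℤ < N * (t - y) + (r - p) * y
        width y>0 y<t = N>0 ⊗₊ <⇒0< y<t ⊕₊ ≤⇒0≤ p≤r ⊗ <⇒≤ y>0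

        leg : ∀ {y} → 0ℤ < y → y < t → length (onRow y Bᵘ) ℕ.≤ 2
        -- The interior point is the midpoint of the row inside the trapezoid: the row starts at
        -- py/t and has length W₀/t.
        leg {y} y>0 y<t = crossing-row {u = + 2 * (p * y) + W₀} {y} {+ 2 * t} Bᵘ-unique (λ z∈ → proj₁ (∈-Bᵘ⁻ z∈))
          (inside {N} {p} {r} {t} {1ℤ} {_} {y * (+ 2 * t)} {+ 2 * t} {+ 2 * (t * (t - y))} {t * W₀} {+ 2 * (t * W₀)}
            left right top-left top-right N>0 t>0 (y>0 ⊗₊ 2t>0)
            (generic₁ t y) (generic₂ t p y W₀) (generic₃ N t r p y)
            (0<1+ 1 ⊗₊ (t>0 ⊗₊ <⇒0< y<t)) tW>0
            (0≤⇒< (pos⇒0≤ tW>0 by generic₄ (t * W₀))))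
          where
          W₀ = N * (t - y) + (r - p) * y
          2t>0 : 0ℤ < + 2 * t
          2t>0 = 0<1+ 1 ⊗₊ t>0
          tW>0 : 0ℤ < t * W₀
          tW>0 = t>0 ⊗₊ width y>0 y<t
          generic₁ : ∀ t y → + 2 * (t * (t - y)) ≡ t * (+ 2 * t) - + 1 * (y * (+ 2 * t))
          generic₁ = solve-∀
          generic₂ : ∀ t p y W → t * W ≡ t * (+ 2 * (p * y) + W) - p * (y * (+ 2 * t))
          generic₂ = solve-∀
          generic₃ : ∀ N t r p y → + 2 * (t * (N * (t - y) + (r - p) * y)) ≡ N * (+ 2 * (t * (t - y))) + (r - p) * (y * (+ 2 * t))
          generic₃ = solve-∀
          generic₄ : ∀ x → x - 1ℤ ≡ + 2 * x - x - 1ℤ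
          generic₄ = solve-∀

        inner-row : ∀ {y} → 0ℤ < y → y < t → ∀ m → t * + m < N * (t - y) + (r - p) * y → m ℕ.≤ length (onRow y Iᵘ)
        inner-row {y} y>0 y<t m m<W =
          let f , inner = inner-points {N} {p} {r} {t} {1ℤ} {y} {t - y} left right top-left top-right N>0 t>0 y>0
                            (generic t y) (<⇒0< y<t) m m<W
          in row-≥ y f m (λ x lo hi → ∈-filter⁺ (λ z → 0ℤ ℤ.<? proj₂ z) (Int-I (inner x lo hi)) y>0)
          where
          generic : ∀ t y → t - y ≡ t * + 1 - + 1 * y
          generic = solve-∀

      leftmost : ∀ {x y} → (x , y) ∈ S → ∃ λ p → (p , y) ∈ S × (∀ {x} → (x , y) ∈ S → p ≤ x)
      leftmost {x} {y} x∈ with ∃-max (λ z → - proj₁ z) (∈-filter⁺ (λ z → proj₂ z ℤ.≟ y) x∈ refl)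
      ... | (p , y′) , m∈ , max with ∈-filter⁻ (λ z → proj₂ z ℤ.≟ y) {xs = S} m∈
      ... | p∈ , refl = p , p∈ , λ z∈ → ℤ.neg-cancel-≤ (max (∈-filter⁺ (λ z → proj₂ z ℤ.≟ y) z∈ refl))

      rows-up : ∀ n → (∀ {x y} → In x y 1ℤ → y ≤ + n) → length Bᵘ ≡ Σ₁ rowB n × length Iᵘ ≡ Σ₁ rowI n
      rows-up n h =
        length-rows n Bᵘ (All.tabulate λ z∈ → let z∈B , pos = ∈-Bᵘ⁻ z∈ in pos , h (B-In z∈B)) ,
        length-rows n Iᵘ (All.tabulate λ z∈ → let z∈I , pos = ∈-Iᵘ⁻ z∈ in pos , h (interior⇒In (I-Int z∈I)))

      -- Two regimes for the lattice points above the base: at most one further row, which is no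
      -- longer than the base, or at least two, when the trapezoid between the base and the topmost
      -- row supplies interior points.
      Flat Tall : Set
      Flat = + length Bᵘ ≤ N + 1ℤ × (∀ {x y} → In x y 1ℤ → y ≤ 1ℤ)
      Tall = + length Bᵘ + N ≤ + 2 * + length Iᵘ + + 6

      flat-empty : (∀ {x y} → In x y 1ℤ → y ≤ + 0) → Flat
      flat-empty h = subst (λ n → + n ≤ N + 1ℤ) (sym (proj₁ (rows-up 0 h)))
        (0≤⇒≤ (<⇒≤ N>0 ⊕ 0≤+ {1} by solve (N ∷ []))) , λ q → ℤ.≤-trans (h q) (+≤+ ℕ.z≤n)

      module _ (t′ : ℕ) {p r} (p∈ : (p , + suc t′) ∈ S) (r∈ : (r , + suc t′) ∈ S)
               (p-min : ∀ {x} → (x , + suc t′) ∈ S → p ≤ x) (r-max : ∀ {x} → (x , + suc t′) ∈ S → x ≤ r)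
               (top : ∀ {x y} → In x y 1ℤ → y ≤ + suc t′) where

        top-row : 0ℤ ≤ r - p + 1ℤ - + rowB (suc t′)
        top-row = bound (≤⇒0≤ (r-max p∈)) refl
          where
          bound : ∀ {q} → 0ℤ ≤ q → q ≡ r - p → 0ℤ ≤ r - p + 1ℤ - + rowB (suc t′)
          bound {+ q} _ q≡ = pos-mono (row-≤ (+ suc t′) p (suc q) Bᵘ-unique
            (λ {x} x∈ → let x∈S = ∈-++⁺ʳ I (proj₁ (∈-Bᵘ⁻ x∈)) in p-min x∈S ,
              0≤⇒< (≤⇒0≤ (r-max x∈S) by trans (generic x r p) (cong (λ q → p + (1ℤ + q) - x - 1ℤ) (sym q≡)))))
            by cong (_- + rowB (suc t′)) (trans (ℤ.+-comm 1ℤ (+ q)) (cong (_+ 1ℤ) q≡))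
            where
            generic : ∀ x r p → r - x ≡ p + (1ℤ + (r - p)) - x - 1ℤ
            generic = solve-∀

        flat : t′ ≡ 0 → Flat
        flat refl = subst (λ n → + n ≤ N + 1ℤ) (sym (proj₁ (rows-up 1 top)))
          (0≤⇒≤ (≤⇒0≤ (longest (S-In p∈) (S-In r∈)) ⊕ top-row by generic N r p (+ rowB 1))) , top
          where
          generic : ∀ N r p b → N - (r - p) + (r - p + 1ℤ - b) ≡ N + 1ℤ - b
          generic = solve-∀

        -- The rows strictly between contribute the 5 of the trapezoid estimate; the topmost row, of
        -- length q, adds at most q + 1 boundary points.
        tall : 1 ℕ.≤ t′ → Tall
        tall t′≥1 = 0≤⇒≤ (≤⇒0≤ excess ⊕ top-row ⊕ 0≤+ {2} ⊗ 0≤+ {rowI (suc t′)}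
          by trans (generic (+ Σ₁ rowB t′) (+ rowB (suc t′)) (+ Σ₁ rowI t′) (+ rowI (suc t′)) r p N)
            (sym (cong₂ (λ x y → + 2 * x + + 6 - (y + N)) sumI sumB)))
          where
          excess : + Σ₁ rowB t′ - + 2 * + Σ₁ rowI t′ + (r - p) + N ≤ + 5
          excess = RowSums.excess-≤ rowB rowI N (r - p) (+ suc t′) N≥3 (≤⇒0≤ (r-max p∈)) t′ refl t′≥1
            (λ y 1≤y y≤ → leg (S-In p∈) (S-In r∈) (r-max p∈) (0<1+ t′) (+<+ 1≤y) (+<+ (ℕ.s≤s y≤)))
            (λ y 1≤y y≤ → inner-row (S-In p∈) (S-In r∈) (r-max p∈) (0<1+ t′) (+<+ 1≤y) (+<+ (ℕ.s≤s y≤)))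
          sumB : + length Bᵘ ≡ + Σ₁ rowB t′ + + rowB (suc t′)
          sumB = trans (cong +_ (proj₁ (rows-up (suc t′) top))) (ℤ.pos-+ (Σ₁ rowB t′) _)
          sumI : + length Iᵘ ≡ + Σ₁ rowI t′ + + rowI (suc t′)
          sumI = trans (cong +_ (proj₂ (rows-up (suc t′) top))) (ℤ.pos-+ (Σ₁ rowI t′) _)
          generic : ∀ B b C c r p N →
            + 5 - (B - + 2 * C + (r - p) + N) + (r - p + 1ℤ - b) + + 2 * c ≡ + 2 * (C + c) + + 6 - (B + b + N)
          generic = solve-∀

      flat∨tall : Flat ⊎ Tall
      flat∨tall = let (x , t) , t∈ , max = ∃-max proj₂ (∈-++⁺ˡ {ys = B} (Int-I centre))
                  in cases t t∈ (λ q → max (In-S q))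
        where
        cases : ∀ t {x} → (x , t) ∈ S → (∀ {x y} → In x y 1ℤ → y ≤ t) → Flat ⊎ Tall
        cases (+ 0) _ h = inj₁ (flat-empty h)
        cases -[1+ n ] _ h = inj₁ (flat-empty λ q → ℤ.≤-trans (h q) -≤+)
        cases (+ suc t′) x∈ h with leftmost x∈ | max-onRow (+ suc t′) x∈
        ... | p , p∈ , p-min | r , r∈ , r-max with t′ ℕ.≟ 0
        ... | yes t′≡0 = inj₁ (flat t′ p∈ r∈ p-min r-max h t′≡0)
        ... | no t′≢0 = inj₂ (tall t′ p∈ r∈ p-min r-max h (ℕ.n≢0⇒n>0 t′≢0))

      -- A bound common to both regimes, weaker than `Tall` by 2N - 5. It suffices on each side of a
      -- row that passes through the interior.
      up-≤ : + length Bᵘ ≤ + 2 * + length Iᵘ + N + 1ℤ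
      up-≤ = [ (λ (p , _) → 0≤⇒≤ (≤⇒0≤ p ⊕ 0≤+ {2} ⊗ 0≤+ {length Iᵘ} by generic₁ N (+ length Iᵘ) (+ length Bᵘ)))
             , (λ p → 0≤⇒≤ (≤⇒0≤ p ⊕ 0≤+ {2} ⊗ ≤⇒0≤ N≥3 ⊕ 0≤+ {1} by generic₂ N (+ length Iᵘ) (+ length Bᵘ))) ]′ flat∨tall
        where
        generic₁ : ∀ N I B → N + 1ℤ - B + + 2 * I ≡ + 2 * I + N + 1ℤ - B
        generic₁ = solve-∀
        generic₂ : ∀ N I B → + 2 * I + + 6 - (B + N) + + 2 * (N - + 3) + 1ℤ ≡ + 2 * I + N + 1ℤ - B
        generic₂ = solve-∀

-- Polygons in the strip 0 ≤ y ≤ 3/2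

value-piece : ∀ k j → 2 ℕ.* j ℕ.≤ 3 ℕ.* k → piece k j ℕ.≤ 2 × piece k j ℕ.* k ℕ.≤ 2 ℕ.* j × 2 ℕ.* j ℕ.≤ suc (piece k j) ℕ.* k
value-piece k j 2j≤3k with 2 ℕ.* j ℕ.≤ᵇ k in eq₁
... | true = ℕ.z≤n , ℕ.z≤n , ℕ.≤-trans (ℕ.≤ᵇ⇒≤ (2 ℕ.* j) k (subst T (sym eq₁) tt)) (ℕ.≤-reflexive (sym (ℕ.+-identityʳ k)))
... | false with j ℕ.≤ᵇ k in eq₂
... | true = ℕ.s≤s ℕ.z≤n ,
  ℕ.≤-trans (ℕ.≤-reflexive (ℕ.+-identityʳ k)) (ℕ.<⇒≤ (ℕ.≰⇒> λ p → subst T eq₁ (ℕ.≤⇒≤ᵇ p))) ,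
  ℕ.*-monoʳ-≤ 2 {j} {k} (ℕ.≤ᵇ⇒≤ j k (subst T (sym eq₂) tt))
... | false = ℕ.≤-refl , ℕ.*-monoʳ-≤ 2 {k} {j} (ℕ.<⇒≤ (ℕ.≰⇒> λ p → subst T eq₂ (ℕ.≤⇒≤ᵇ p))) , 2j≤3k

-- The supporting line through the points at heights h/2 and (h+1)/2 of the right boundary.
line : ℤ → ℤ → ℤ → Form
line a b h = - (+ 12) , + 2 * (b - a) , a - h * (b - a)

ev-line : ∀ a b h k j x → ev (line a b h) x j k ≡ k * a + (+ 2 * j - h * k) * (b - a) - + 12 * x
ev-line a b h k j x = generic a b h k j x
  where
  generic : ∀ a b h k j x → - (+ 12) * x + + 2 * (b - a) * j + (a - h * (b - a)) * k ≡ k * a + (+ 2 * j - h * k) * (b - a) - + 12 * x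
  generic = solve-∀

InStrip : List LatticePoint → Set
InStrip gens = ∀ {X Y} → (X , Y) ∈ gens → 0ℤ ≤ Y × Y ≤ + 3

strip-elim : (Q : ℤ → Set) → Q (+ 0) → Q (+ 1) → Q (+ 2) → Q (+ 3) → ∀ {Y} → 0ℤ ≤ Y × Y ≤ + 3 → Q Y
strip-elim Q p q r s {+ 0} _ = p
strip-elim Q p q r s {+ 1} _ = q
strip-elim Q p q r s {+ 2} _ = r
strip-elim Q p q r s {+ 3} _ = s
strip-elim Q p q r s {+ suc (suc (suc (suc _)))} (_ , +≤+ (ℕ.s≤s (ℕ.s≤s (ℕ.s≤s ()))))

-- A concave piecewise linear function lies below the extension of each of its pieces; the gap at
-- another breakpoint is a non-negative combination of the two bends.
lines-nonneg : ∀ {gens} → InStrip gens → ∀ {a b c d} → 0ℤ ≤ + 2 * b - a - c → 0ℤ ≤ + 2 * c - b - d →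
  (∀ {X} → (X , + 0) ∈ gens → 0ℤ ≤ a - + 6 * X) → (∀ {X} → (X , + 1) ∈ gens → 0ℤ ≤ b - + 6 * X) →
  (∀ {X} → (X , + 2) ∈ gens → 0ℤ ≤ c - + 6 * X) → (∀ {X} → (X , + 3) ∈ gens → 0ℤ ≤ d - + 6 * X) →
  NonNegOn gens (line a b (+ 0)) × NonNegOn gens (line b c (+ 1)) × NonNegOn gens (line c d (+ 2))
lines-nonneg {gens} strip {a} {b} {c} {d} c₁ c₂ h₀ h₁ h₂ h₃ =
  (λ {X} z∈ → strip-elim (λ Y → (X , Y) ∈ gens → 0ℤ ≤ - (+ 12) * X + + 2 * (b - a) * Y + (a - + 0 * (b - a)) * + 2)
    (λ p → 0≤+ {2} ⊗ h₀ p by g₀₀ a b X)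
    (λ p → 0≤+ {2} ⊗ h₁ p by g₀₁ a b X)
    (λ p → 0≤+ {2} ⊗ h₂ p ⊕ 0≤+ {2} ⊗ c₁ by g₀₂ a b c X)
    (λ p → 0≤+ {2} ⊗ h₃ p ⊕ 0≤+ {4} ⊗ c₁ ⊕ 0≤+ {2} ⊗ c₂ by g₀₃ a b c d X) (strip z∈) z∈) ,
  (λ {X} z∈ → strip-elim (λ Y → (X , Y) ∈ gens → 0ℤ ≤ - (+ 12) * X + + 2 * (c - b) * Y + (b - + 1 * (c - b)) * + 2)
    (λ p → 0≤+ {2} ⊗ h₀ p ⊕ 0≤+ {2} ⊗ c₁ by g₁₀ a b c X)
    (λ p → 0≤+ {2} ⊗ h₁ p by g₁₁ b c X)
    (λ p → 0≤+ {2} ⊗ h₂ p by g₁₂ b c X)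
    (λ p → 0≤+ {2} ⊗ h₃ p ⊕ 0≤+ {2} ⊗ c₂ by g₁₃ b c d X) (strip z∈) z∈) ,
  (λ {X} z∈ → strip-elim (λ Y → (X , Y) ∈ gens → 0ℤ ≤ - (+ 12) * X + + 2 * (d - c) * Y + (c - + 2 * (d - c)) * + 2)
    (λ p → 0≤+ {2} ⊗ h₀ p ⊕ 0≤+ {4} ⊗ c₂ ⊕ 0≤+ {2} ⊗ c₁ by g₂₀ a b c d X)
    (λ p → 0≤+ {2} ⊗ h₁ p ⊕ 0≤+ {2} ⊗ c₂ by g₂₁ b c d X)
    (λ p → 0≤+ {2} ⊗ h₂ p by g₂₂ c d X)
    (λ p → 0≤+ {2} ⊗ h₃ p by g₂₃ c d X) (strip z∈) z∈)
  where
  g₀₀ : ∀ a b X → + 2 * (a - + 6 * X) ≡ - (+ 12) * X + + 2 * (b - a) * + 0 + (a - + 0 * (b - a)) * + 2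
  g₀₀ = solve-∀
  g₀₁ : ∀ a b X → + 2 * (b - + 6 * X) ≡ - (+ 12) * X + + 2 * (b - a) * + 1 + (a - + 0 * (b - a)) * + 2
  g₀₁ = solve-∀
  g₀₂ : ∀ a b c X → + 2 * (c - + 6 * X) + + 2 * (+ 2 * b - a - c) ≡ - (+ 12) * X + + 2 * (b - a) * + 2 + (a - + 0 * (b - a)) * + 2
  g₀₂ = solve-∀
  g₀₃ : ∀ a b c d X → + 2 * (d - + 6 * X) + + 4 * (+ 2 * b - a - c) + + 2 * (+ 2 * c - b - d) ≡
    - (+ 12) * X + + 2 * (b - a) * + 3 + (a - + 0 * (b - a)) * + 2
  g₀₃ = solve-∀
  g₁₀ : ∀ a b c X → + 2 * (a - + 6 * X) + + 2 * (+ 2 * b - a - c) ≡ - (+ 12) * X + + 2 * (c - b) * + 0 + (b - + 1 * (c - b)) * + 2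
  g₁₀ = solve-∀
  g₁₁ : ∀ b c X → + 2 * (b - + 6 * X) ≡ - (+ 12) * X + + 2 * (c - b) * + 1 + (b - + 1 * (c - b)) * + 2
  g₁₁ = solve-∀
  g₁₂ : ∀ b c X → + 2 * (c - + 6 * X) ≡ - (+ 12) * X + + 2 * (c - b) * + 2 + (b - + 1 * (c - b)) * + 2
  g₁₂ = solve-∀
  g₁₃ : ∀ b c d X → + 2 * (d - + 6 * X) + + 2 * (+ 2 * c - b - d) ≡ - (+ 12) * X + + 2 * (c - b) * + 3 + (b - + 1 * (c - b)) * + 2
  g₁₃ = solve-∀
  g₂₀ : ∀ a b c d X → + 2 * (a - + 6 * X) + + 4 * (+ 2 * c - b - d) + + 2 * (+ 2 * b - a - c) ≡
    - (+ 12) * X + + 2 * (d - c) * + 0 + (c - + 2 * (d - c)) * + 2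
  g₂₀ = solve-∀
  g₂₁ : ∀ b c d X → + 2 * (b - + 6 * X) + + 2 * (+ 2 * c - b - d) ≡ - (+ 12) * X + + 2 * (d - c) * + 1 + (c - + 2 * (d - c)) * + 2
  g₂₁ = solve-∀
  g₂₂ : ∀ c d X → + 2 * (c - + 6 * X) ≡ - (+ 12) * X + + 2 * (d - c) * + 2 + (c - + 2 * (d - c)) * + 2
  g₂₂ = solve-∀
  g₂₃ : ∀ c d X → + 2 * (d - + 6 * X) ≡ - (+ 12) * X + + 2 * (d - c) * + 3 + (c - + 2 * (d - c)) * + 2
  g₂₃ = solve-∀

module Side {gens : List LatticePoint} (strip : InStrip gens) (profile : Profile gens) where
  open Profile profile

  line-nonneg : ∀ h → h ℕ.≤ 2 → NonNegOn gens (line (ρ h) (ρ (suc h)) (+ h))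
  line-nonneg = cases (lines-nonneg strip {ρ 0} {ρ 1} {ρ 2} {ρ 3} concave₁ concave₂ (bounds 0 ℕ.z≤n) (bounds 1 (ℕ.s≤s ℕ.z≤n))
                        (bounds 2 (ℕ.s≤s (ℕ.s≤s ℕ.z≤n))) (bounds 3 ℕ.≤-refl))
    where
    cases : NonNegOn gens (line (ρ 0) (ρ 1) (+ 0)) × NonNegOn gens (line (ρ 1) (ρ 2) (+ 1)) × NonNegOn gens (line (ρ 2) (ρ 3) (+ 2)) →
      ∀ h → h ℕ.≤ 2 → NonNegOn gens (line (ρ h) (ρ (suc h)) (+ h))
    cases (p , _) 0 _ = p
    cases (_ , p , _) 1 _ = p
    cases (_ , _ , p) 2 _ = p
    cases _ (suc (suc (suc _))) (ℕ.s≤s (ℕ.s≤s ()))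

  -- The end of a row is a convex combination of the two neighbouring breakpoints, with weights
  -- proportional to (h + 1)k - 2j and 2j - hk.
  reaches : ∀ k j → 2 ℕ.* j ℕ.≤ 3 ℕ.* k → ∀ φ → NonNegOn gens φ →
    0ℤ ≤ ev φ (value ρ (piece k j) k j) (+ 12 * + j) (+ 12 * + k)
  reaches k j le φ@(α , β , γ) φ≥0 =
    let h = piece k j
        h≤2 , lo , hi = value-piece k j le
    in subst₂ (λ a b → 0ℤ ≤ a - b) (ℤ.pos-* (suc h) k) (ℤ.pos-* 2 j) (pos-mono hi) ⊗ attained h (ℕ.m≤n⇒m≤1+n h≤2) φ φ≥0
       ⊕ subst₂ (λ a b → 0ℤ ≤ a - b) (ℤ.pos-* 2 j) (ℤ.pos-* h k) (pos-mono lo) ⊗ attained (suc h) (ℕ.s≤s h≤2) φ φ≥0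
       by generic α β γ (ρ h) (ρ (suc h)) (+ h) (+ suc h) refl (+ k) (+ j) (value ρ h k j) refl
    where
    generic′ : ∀ α β γ a b h k j →
      ((1ℤ + h) * k - + 2 * j) * (α * a + β * (+ 6 * h) + γ * + 12) +
      (+ 2 * j - h * k) * (α * b + β * (+ 6 * (1ℤ + h)) + γ * + 12) ≡
      α * (k * a + (+ 2 * j - h * k) * (b - a)) + β * (+ 12 * j) + γ * (+ 12 * k)
    generic′ = solve-∀
    generic : ∀ α β γ a b h h′ → h′ ≡ 1ℤ + h → ∀ k j v → v ≡ k * a + (+ 2 * j - h * k) * (b - a) →
      (h′ * k - + 2 * j) * (α * a + β * (+ 6 * h) + γ * + 12) +
      (+ 2 * j - h * k) * (α * b + β * (+ 6 * h′) + γ * + 12) ≡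
      α * v + β * (+ 12 * j) + γ * (+ 12 * k)
    generic α β γ a b h _ refl k j _ refl = generic′ α β γ a b h k j

-- Enumeration by rows, reflection and perturbation

Σℕ : ℕ → (ℕ → ℕ) → ℕ
Σℕ zero f = 0
Σℕ (suc n) f = Σℕ n f ℕ.+ f n

hasCount-rows : ∀ {A : LatticePoint → Set} n (lo : ℕ → ℤ) (len : ℕ → ℕ) →
  (∀ {x y} → A (x , y) → ∃ λ j → j ℕ.< n × y ≡ + j) →
  (∀ {x} j → j ℕ.< n → A (x , + j) ⇔ (lo j ≤ x × x < lo j + + len j)) →
  HasCount A (Σℕ n len)
hasCount-rows {A} n lo len cover spec =
  points n , unique n , count n , λ { (x , y) → mk⇔ (λ z∈ → to z∈) from }
  where
  points : ℕ → List LatticePoint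
  points zero = []
  points (suc m) = points m ++ segment (+ m) (lo m) (len m)
  count : ∀ m → length (points m) ≡ Σℕ m len
  count zero = refl
  count (suc m) = trans (length-++ (points m)) (cong₂ ℕ._+_ (count m) (length-segment (+ m) (lo m) (len m)))
  below : ∀ m {x y} → (x , y) ∈ points m → ∃ λ j → j ℕ.< m × y ≡ + j × lo j ≤ x × x < lo j + + len j
  below (suc m) z∈ with ∈-++⁻ (points m) z∈
  ... | inj₁ p = let j , j<m , rest = below m p in j , ℕ.m≤n⇒m≤1+n j<m , rest
  ... | inj₂ p with ∈-map⁻ (_, + m) p
  ... | x , x∈ , refl = m , ℕ.≤-refl , refl , ∈-interval⁻ (lo m) (len m) x∈
  unique : ∀ m → Unique (points m)
  unique zero = []ᴾ
  unique (suc m) = Unique.++⁺ (unique m) (segment-unique (+ m) (lo m) (len m)) λ { {x , y} (p , q) → disjoint p q }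
    where
    disjoint : ∀ {x y} → (x , y) ∈ points m → (x , y) ∈ segment (+ m) (lo m) (len m) → ⊥
    disjoint p q with below m p | ∈-map⁻ (_, + m) q
    ... | j , j<m , y≡j , _ | _ , _ , eq = ℕ.<-irrefl (ℤ.+-injective (trans (sym y≡j) (,-injectiveʳ eq))) j<m
  member : ∀ m {j x} → j ℕ.< m → lo j ≤ x → x < lo j + + len j → (x , + j) ∈ points m
  member (suc m) {j} j<1+m a b with j ℕ.≟ m
  ... | yes refl = ∈-++⁺ʳ (points m) (∈-map⁺ (_, + m) (∈-interval⁺ (lo m) (len m) a b))
  ... | no j≢m = ∈-++⁺ˡ (member m (ℕ.≤∧≢⇒< (ℕ.≤-pred j<1+m) j≢m) a b)
  to : ∀ {x y} → (x , y) ∈ points n → A (x , y)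
  to z∈ with below n z∈
  ... | j , j<n , refl , a , b = Equivalence.from (spec j j<n) (a , b)
  from : ∀ {x y} → A (x , y) → (x , y) ∈ points n
  from s with cover s
  ... | j , j<n , refl = let a , b = Equivalence.to (spec j j<n) s in member n j<n a b

mirror : LatticePoint → LatticePoint
mirror (X , Y) = - X , Y

mirrored : Form → Form
mirrored (α , β , γ) = - α , β , γ

ev-mirrored : ∀ φ x y k → ev (mirrored φ) x y k ≡ ev φ (- x) y k
ev-mirrored (α , β , γ) x y k = generic α β γ x y k
  where
  generic : ∀ α β γ x y k → - α * x + β * y + γ * k ≡ α * (- x) + β * y + γ * k
  generic = solve-∀

NonNegOn-mirror⁺ : ∀ {gens} φ → NonNegOn gens φ → NonNegOn (map mirror gens) (mirrored φ)
NonNegOn-mirror⁺ φ h z∈ with ∈-map⁻ mirror z∈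
... | (X , Y) , w∈ , refl = h w∈ by trans (cong (λ x → ev φ x Y (+ 2)) (sym (ℤ.neg-involutive X))) (sym (ev-mirrored φ (- X) Y (+ 2)))

NonNegOn-mirror⁻ : ∀ {gens} φ → NonNegOn (map mirror gens) φ → NonNegOn gens (mirrored φ)
NonNegOn-mirror⁻ φ h {X} {Y} z∈ = h (∈-map⁺ mirror z∈) by sym (ev-mirrored φ X Y (+ 2))

-- The point is lifted by 1/m. Every form is at least 1 at an integral interior point, so m times
-- its value outweighs the change β once m ≥ |β|; the sum of all |β| serves every form.
perturb : ∀ {x y} gs → All (λ g → 0ℤ < ev g x y 1ℤ) gs →
  ∃ λ n → ∀ m → + n ≤ m → All (λ g → 0ℤ ≤ ev g (m * x) (m * y + 1ℤ) m) gs
perturb [] []ᴬ = 0 , λ _ _ → []ᴬ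
perturb {x} {y} ((α , β , γ) ∷ gs) (p ∷ᴬ ps) =
  let n , h = perturb gs ps
  in ℤ.∣ β ∣ ℕ.+ n , λ m n≤m →
    let n≤m′ = ≤⇒0≤ n≤m by cong (λ z → m - z) (ℤ.pos-+ ℤ.∣ β ∣ n)
    in ((0≤+ {ℤ.∣ β ∣} ⊕ 0≤+ {n} ⊕ n≤m′ by generic₁ (+ ℤ.∣ β ∣) (+ n) m) ⊗ pos⇒0≤ p
         ⊕ n≤m′ ⊕ 0≤+ {n} ⊕ β≥ β by generic₂ α β γ x y m (+ ℤ.∣ β ∣) (+ n))
       ∷ᴬ h m (0≤⇒≤ (n≤m′ ⊕ 0≤+ {ℤ.∣ β ∣} by generic₃ (+ ℤ.∣ β ∣) (+ n) m))
  where
  generic₁ : ∀ b n m → b + n + (m - (b + n)) ≡ m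
  generic₁ = solve-∀
  generic₂ : ∀ α β γ x y m b n →
    m * (α * x + β * y + γ * 1ℤ - 1ℤ) + (m - (b + n)) + n + (b + β) ≡ α * (m * x) + β * (m * y + 1ℤ) + γ * m
  generic₂ = solve-∀
  generic₃ : ∀ b n m → m - (b + n) + b ≡ m - n
  generic₃ = solve-∀
  β≥ : ∀ β → 0ℤ ≤ + ℤ.∣ β ∣ + β
  β≥ (+ n) = 0≤+ {n} ⊕ 0≤+ {n}
  β≥ -[1+ n ] = 0≤+ {0} by sym (ℤ.+-inverseˡ -[1+ n ])

module Strip {i b : ℕ} (P : Body i b) where
  open Body P
  open Lattice P

  ev-scale : ∀ c α β γ x y k → α * (c * x) + β * (c * y) + γ * (c * k) ≡ c * (α * x + β * y + γ * k)
  ev-scale = solve-∀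

  In-scale⁻ : ∀ {c x y k} → 0ℤ < c → In (c * x) (c * y) (c * k) → In x y k
  In-scale⁻ {c} {x} {y} {k} c>0 = All.map λ { {α , β , γ} p →
    cancel-≤ {c} {α * x + β * y + γ * k} c>0 (p by ev-scale c α β γ x y k) }

  Int-scale⁻ : ∀ {c x y k} → 0ℤ < c → Int (c * x) (c * y) (c * k) → Int x y k
  Int-scale⁻ {c} {x} {y} {k} c>0 = All.map λ { {α , β , γ} p →
    cancel-< {c} {α * x + β * y + γ * k} c>0 (p by₊ ev-scale c α β γ x y k) }

  Int-scale⁺ : ∀ {c x y k} → 0ℤ < c → Int x y k → Int (c * x) (c * y) (c * k)
  Int-scale⁺ {c} {x} {y} {k} c>0 = All.map λ { {α , β , γ} p → c>0 ⊗₊ p by₊ sym (ev-scale c α β γ x y k) }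

  NonNegOn-forms : ∀ {g} → g ∈ forms → NonNegOn gens g
  NonNegOn-forms g∈ z∈ = All.lookup (gens-In z∈) g∈

  length-I : length I ≡ i
  length-I = proj₁ (proj₂ (proj₂ interior))

  length-B : length B ≡ b
  length-B = proj₁ (proj₂ (proj₂ boundary))

  row-≤i : ∀ {m f y} → (∀ x → f ≤ x → x < f + + m → Int x y 1ℤ) → m ℕ.≤ i
  row-≤i {m} {f} {y} h = subst (m ℕ.≤_) length-I
    (ℕ.≤-trans (row-≥ y f m (λ x lo hi → Int-I (h x lo hi))) (length-filter _ I))

  points₁ : Points 1 (i ℕ.+ b)
  points₁ = S , Unique.++⁺ I-unique B-unique (λ { {x , y} (p , q) → disjoint p q }) ,
    trans (length-++ I) (cong₂ ℕ._+_ length-I length-B) , λ { (x , y) → mk⇔ S-In In-S }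
    where
    disjoint : ∀ {x y} → (x , y) ∈ I → (x , y) ∈ B → ⊥
    disjoint p q = let g , g∈ , eq = B-zero q in ℤ.<-irrefl (sym eq) (All.lookup (I-Int p) g∈)

  module _ {x₀} (centre : Int x₀ 1ℤ 1ℤ) (strip : InStrip gens)
           {X₀} (bottom : (X₀ , + 0) ∈ gens) {X₃} (top : (X₃ , + 3) ∈ gens) where

    rightSide : Profile gens
    rightSide = profile bottom top

    leftSide : Profile (map mirror gens)
    leftSide = profile (∈-map⁺ mirror bottom) (∈-map⁺ mirror top)

    strip′ : InStrip (map mirror gens)
    strip′ z∈ with ∈-map⁻ mirror z∈
    ... | _ , w∈ , refl = strip w∈

    module R = Side strip rightSide
    module L = Side strip′ leftSide

    ρ λᴸ : ℕ → ℤ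
    ρ = Profile.ρ rightSide
    λᴸ = Profile.ρ leftSide

    left-line-nonneg : ∀ h → h ℕ.≤ 2 → NonNegOn gens (mirrored (line (λᴸ h) (λᴸ (suc h)) (+ h)))
    left-line-nonneg h h≤2 = NonNegOn-mirror⁻ (line (λᴸ h) (λᴸ (suc h)) (+ h)) (L.line-nonneg h h≤2)

    right-end : ∀ k j → 2 ℕ.* j ℕ.≤ 3 ℕ.* k → In (value ρ (piece k j) k j) (+ 12 * + j) (+ 12 * + k)
    right-end k j le = All.tabulate λ {g} g∈ → R.reaches k j le g (NonNegOn-forms g∈)

    left-end : ∀ k j → 2 ℕ.* j ℕ.≤ 3 ℕ.* k → In (- value λᴸ (piece k j) k j) (+ 12 * + j) (+ 12 * + k)
    left-end k j le = All.tabulate λ {g} g∈ →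
      L.reaches k j le (mirrored g) (NonNegOn-mirror⁺ g (NonNegOn-forms g∈)) by ev-mirrored g _ _ _

    row-≤-right : ∀ {x} k j → 2 ℕ.* j ℕ.≤ 3 ℕ.* k → In x (+ j) (+ k) → + 12 * x ≤ value ρ (piece k j) k j
    row-≤-right {x} k j le p = 0≤⇒≤ (dual (line (ρ h) (ρ (suc h)) (+ h)) (R.line-nonneg h (proj₁ (value-piece k j le))) 0≤+ p
      by ev-line (ρ h) (ρ (suc h)) (+ h) (+ k) (+ j) x)
      where h = piece k j

    row-≥-left : ∀ {x} k j → 2 ℕ.* j ℕ.≤ 3 ℕ.* k → In x (+ j) (+ k) → - value λᴸ (piece k j) k j ≤ + 12 * x
    row-≥-left {x} k j le p = 0≤⇒≤ (dual (mirrored ℓ) (left-line-nonneg h (proj₁ (value-piece k j le))) 0≤+ p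
      by trans (ev-mirrored ℓ x (+ j) (+ k)) (trans (ev-line (λᴸ h) (λᴸ (suc h)) (+ h) (+ k) (+ j) (- x)) (generic v x)))
      where
      h = piece k j
      v = value λᴸ h k j
      ℓ = line (λᴸ h) (λᴸ (suc h)) (+ h)
      generic : ∀ v x → v - + 12 * (- x) ≡ + 12 * x - (- v)
      generic = solve-∀

    ends : ℕ → ℕ → ℤ
    ends k j = rowEnd ρ k j + rowEnd λᴸ k j + 1ℤ

    -- From v + w ≥ 0 it follows that the floors of v/12 and w/12 add up to at least -1. So the
    -- formula for the number of lattice points in a row is correct even for an empty row.
    ends-nonneg : ∀ k j → 2 ℕ.* j ℕ.≤ 3 ℕ.* k → 0ℤ ≤ ends k j
    ends-nonneg k j le = ≤⇒0≤ (by-contra-≤ {0ℤ} {ends k j} λ r →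
      0≤+ {12} ⊗ <⇒0≤ r ⊕ (cancel-≤ {+ 12} {v + w} (0<1+ 11) wide ⊕ floor-gap v ⊕ floor-gap w) ⊕ 0≤+ {1}
        by generic₁ v w (rowEnd ρ k j) (rowEnd λᴸ k j)) by generic₀ (ends k j)
      where
      h = piece k j
      v = value ρ h k j
      w = value λᴸ h k j
      ℓ = line (λᴸ h) (λᴸ (suc h)) (+ h)
      generic₀ : ∀ x → x - 0ℤ ≡ x
      generic₀ = solve-∀
      generic₁ : ∀ v w a b → + 12 * (0ℤ - (a + b + 1ℤ) - 1ℤ) + (v + w + (+ 12 * a + + 11 - v) + (+ 12 * b + + 11 - w)) + + 1 ≡ - 1ℤ
      generic₁ = solve-∀
      generic₂ : ∀ a b h k j v → + 12 * k * a + (+ 2 * (+ 12 * j) - h * (+ 12 * k)) * (b - a) - + 12 * (- v) ≡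
        + 12 * (v + (k * a + (+ 2 * j - h * k) * (b - a)))
      generic₂ = solve-∀
      wide : 0ℤ ≤ + 12 * (v + w)
      wide = R.reaches k j le (mirrored ℓ) (left-line-nonneg h (proj₁ (value-piece k j le)))
        by trans (ev-mirrored ℓ v (+ 12 * + j) (+ 12 * + k))
          (trans (ev-line (λᴸ h) (λᴸ (suc h)) (+ h) (+ 12 * + k) (+ 12 * + j) (- v))
            (generic₂ (λᴸ h) (λᴸ (suc h)) (+ h) (+ k) (+ j) v))
      floor-gap : ∀ v → 0ℤ ≤ + 12 * (v ℤ./ℕ 12) + + 11 - v
      floor-gap v = <⇒0≤ {v} {(1ℤ + v ℤ./ℕ 12) * + 12} (ℤ.n<s[n/ℕd]*d v 12) by gap v (v ℤ./ℕ 12)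
        where
        gap : ∀ v q → (1ℤ + q) * + 12 - v - 1ℤ ≡ + 12 * q + + 11 - v
        gap = solve-∀

    len : ℕ → ℕ → ℕ
    len k j = ℤ.∣ ends k j ∣

    In-row : ∀ {x} k j → 2 ℕ.* j ℕ.≤ 3 ℕ.* k →
      In x (+ j) (+ k) ⇔ (- rowEnd λᴸ k j ≤ x × x < - rowEnd λᴸ k j + + len k j)
    In-row {x} k j le = mk⇔ to from
      where
      h = piece k j
      a = rowEnd ρ k j
      c = rowEnd λᴸ k j
      len≡ : + len k j ≡ ends k j
      len≡ = ℤ.0≤i⇒+∣i∣≡i (ends-nonneg k j le)
      generic₁ : ∀ w x → + 12 * x - - w ≡ w - + 12 * (- x)
      generic₁ = solve-∀
      generic₂ : ∀ c x → c - - x ≡ x - - c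
      generic₂ = solve-∀
      generic₃ : ∀ a c x → a - x ≡ - c + (a + c + 1ℤ) - x - 1ℤ
      generic₃ = solve-∀
      to : In x (+ j) (+ k) → - c ≤ x × x < - c + + len k j
      to p = 0≤⇒≤ (≤⇒0≤ (≤-floor 12 (value λᴸ h k j) (- x) (0≤⇒≤ (≤⇒0≤ (row-≥-left k j le p) by generic₁ (value λᴸ h k j) x)))
               by generic₂ c x) ,
             subst (λ n → x < - c + n) (sym len≡)
               (0≤⇒< (≤⇒0≤ (≤-floor 12 (value ρ h k j) x (row-≤-right k j le p)) by generic₃ a c x))
      from : - c ≤ x × x < - c + + len k j → In x (+ j) (+ k)
      from (lo , hi) = In-scale⁻ {+ 12} (0<1+ 11) (between (left-end k j le) (right-end k j le)
        (0≤⇒≤ (≤⇒0≤ (floor-≤ 12 (value λᴸ h k j) (- x) (0≤⇒≤ (≤⇒0≤ lo by sym (generic₂ c x)))) by sym (generic₁ (value λᴸ h k j) x)))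
        (floor-≤ 12 (value ρ h k j) x (0≤⇒≤ (<⇒0≤ (subst (λ n → x < - c + n) len≡ hi) by sym (generic₃ a c x)))))

    In-height : ∀ {x y} k → In x y (+ k) → ∃ λ j → j ℕ.< rows k × y ≡ + j
    In-height {x} {y} k p = cases y (dual (+ 0 , + 1 , + 0) bottom-nonneg 0≤+ p by generic₁ x y (+ k))
                                    (dual (+ 0 , - (+ 2) , + 3) top-nonneg 0≤+ p by generic₂ x y (+ k))
      where
      generic₁ : ∀ x y k → + 0 * x + + 1 * y + + 0 * k ≡ y
      generic₁ = solve-∀
      generic₂ : ∀ x y k → + 0 * x + - (+ 2) * y + + 3 * k ≡ + 3 * k - + 2 * y
      generic₂ = solve-∀
      bottom-nonneg : NonNegOn gens (+ 0 , + 1 , + 0)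
      bottom-nonneg {X} {Y} z∈ = proj₁ (strip z∈) by sym (generic₁ X Y (+ 2))
      top-nonneg : NonNegOn gens (+ 0 , - (+ 2) , + 3)
      top-nonneg {X} {Y} z∈ = 0≤+ {2} ⊗ ≤⇒0≤ (proj₂ (strip z∈)) by generic₃ X Y
        where
        generic₃ : ∀ X Y → + 2 * (+ 3 - Y) ≡ + 0 * X + - (+ 2) * Y + + 3 * + 2
        generic₃ = solve-∀
      cases : ∀ y → 0ℤ ≤ y → 0ℤ ≤ + 3 * + k - + 2 * y → ∃ λ j → j ℕ.< rows k × y ≡ + j
      cases (+ j) _ q = j , ℕ.s≤s (subst (ℕ._≤ 3 ℕ.* k ℕ./ 2) (ℕ.m*n/n≡m j 2) (ℕ./-monoˡ-≤ 2 le)) , refl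
        where
        le : j ℕ.* 2 ℕ.≤ 3 ℕ.* k
        le = subst (ℕ._≤ 3 ℕ.* k) (ℕ.*-comm 2 j) (ℤ.drop‿+≤+ (subst₂ _≤_ (sym (ℤ.pos-* 2 j)) (sym (ℤ.pos-* 3 k)) (0≤⇒≤ q)))

    rows-≤ : ∀ k {j} → j ℕ.< rows k → 2 ℕ.* j ℕ.≤ 3 ℕ.* k
    rows-≤ k {j} (ℕ.s≤s p) = ℕ.≤-trans (ℕ.≤-reflexive (ℕ.*-comm 2 j))
      (ℕ.≤-trans (ℕ.*-monoˡ-≤ 2 p) (ℕ.m/n*n≤m (3 ℕ.* k) 2))

    points : ∀ k → Points k (Σℕ (rows k) (len k))
    points k = hasCount-rows (rows k) (λ j → - rowEnd λᴸ k j) (len k) (In-height k) (λ j j< → In-row k j (rows-≤ k j<))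

    count : ∀ k → + Σℕ (rows k) (len k) ≡ rowEnds ρ k + rowEnds λᴸ k + + rows k
    count k = go (rows k) (λ j< → rows-≤ k j<)
      where
      generic : ∀ a b n x y → a + b + n + (x + y + 1ℤ) ≡ a + x + (b + y) + (1ℤ + n)
      generic = solve-∀
      go : ∀ n → (∀ {j} → j ℕ.< n → 2 ℕ.* j ℕ.≤ 3 ℕ.* k) →
        + Σℕ n (len k) ≡ Σ< n (rowEnd ρ k) + Σ< n (rowEnd λᴸ k) + + n
      go zero _ = refl
      go (suc n) h = trans (ℤ.pos-+ (Σℕ n (len k)) (len k n))
        (trans (cong₂ _+_ (go n (λ j< → h (ℕ.m≤n⇒m≤1+n j<))) (ℤ.0≤i⇒+∣i∣≡i (ends-nonneg k n (h ℕ.≤-refl))))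
          (generic (Σ< n (rowEnd ρ k)) (Σ< n (rowEnd λᴸ k)) (+ n) (rowEnd ρ k n) (rowEnd λᴸ k n)))

    -- Row 1 contains the interior point `centre`; every lattice point of the row strictly between
    -- the two ends lies between it and an end of the row, hence is interior as well.
    inner-≤ : 0ℤ ≤ + i - (innerEnd ρ + innerEnd λᴸ + 1ℤ)
    inner-≤ = cases (innerEnd ρ + innerEnd λᴸ + 1ℤ) refl
      where
      a = innerEnd ρ
      c = innerEnd λᴸ
      at-row₁ : ∀ σ → value σ 1 1 1 ≡ σ 2
      at-row₁ σ = generic (σ 1) (σ 2)
        where
        generic : ∀ x y → + 1 * x + (+ 2 * + 1 - + 1 * + 1) * (y - x) ≡ y
        generic = solve-∀
      right₁ : In (ρ 2) (+ 12 * 1ℤ) (+ 12 * 1ℤ)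
      right₁ = subst (λ v → In v (+ 12 * 1ℤ) (+ 12 * 1ℤ)) (at-row₁ ρ) (right-end 1 1 (ℕ.s≤s (ℕ.s≤s ℕ.z≤n)))
      left₁ : In (- λᴸ 2) (+ 12 * 1ℤ) (+ 12 * 1ℤ)
      left₁ = subst (λ v → In (- v) (+ 12 * 1ℤ) (+ 12 * 1ℤ)) (at-row₁ λᴸ) (left-end 1 1 (ℕ.s≤s (ℕ.s≤s ℕ.z≤n)))
      strict : ∀ {x} σ → x ≤ innerEnd σ → + 12 * x < σ 2
      strict {x} σ p = 0≤⇒< (≤⇒0≤ (floor-≤ 12 (σ 2 - 1ℤ) x p) by generic (σ 2) x)
        where
        generic : ∀ s x → s - 1ℤ - + 12 * x ≡ s - + 12 * x - 1ℤ
        generic = solve-∀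
      inner : ∀ x → - c ≤ x → x ≤ a → Int x 1ℤ 1ℤ
      inner x lo hi = Int-scale⁻ {+ 12} (0<1+ 11)
        ([ (λ x₀≤x → between-Int centre₁₂ right₁ (ℤ.*-monoˡ-≤-nonNeg (+ 12) x₀≤x) (strict ρ hi))
         , (λ x≤x₀ → between-Int′ centre₁₂ left₁
             (0≤⇒< (<⇒0≤ (strict { - x } λᴸ (0≤⇒≤ (≤⇒0≤ lo by generic₁ c x))) by generic₂ (λᴸ 2) x))
             (ℤ.*-monoˡ-≤-nonNeg (+ 12) x≤x₀)) ]′
         (ℤ.≤-total x₀ x))
        where
        centre₁₂ : Int (+ 12 * x₀) (+ 12 * 1ℤ) (+ 12 * 1ℤ)
        centre₁₂ = Int-scale⁺ {+ 12} (0<1+ 11) centre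
        generic₁ : ∀ c x → x - - c ≡ c - - x
        generic₁ = solve-∀
        generic₂ : ∀ l x → l - + 12 * (- x) - 1ℤ ≡ + 12 * x - (- l) - 1ℤ
        generic₂ = solve-∀
      cases : ∀ m → a + c + 1ℤ ≡ m → 0ℤ ≤ + i - m
      cases (+ m) eq = pos-mono (row-≤i {m} { - c} λ x lo hi → inner x lo
        (0≤⇒≤ (<⇒0≤ hi by trans (cong (λ m → - c + m - x - 1ℤ) (sym eq)) (generic a c x))))
        where
        generic : ∀ a c x → - c + (a + c + 1ℤ) - x - 1ℤ ≡ a - x
        generic = solve-∀
      -- A negative value is no number of points, but the inequality is then immediate.
      cases -[1+ m ] _ = 0≤+ {i ℕ.+ suc m}

    boundary-bound : + b ≤ + 2 * + i + + 7
    boundary-bound = 0≤⇒≤ (cancel-≤ {+ 6} (0<1+ 5)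
      (Profile.defective rightSide ⊕ Profile.defective leftSide ⊕ apex ⊕ 0≤+ {18} ⊗ inner-≤
        by generic (rowEnds ρ 1) (rowEnds ρ 2) (rowEnds ρ 3) (rowEnds ρ 4) (rowEnds ρ 5)
             (rowEnds λᴸ 1) (rowEnds λᴸ 2) (rowEnds λᴸ 3) (rowEnds λᴸ 4) (rowEnds λᴸ 5)
             (innerEnd ρ) (innerEnd λᴸ) (ρ 3) (λᴸ 3) (+ i) (+ b) n₁ related))
      where
      n₁ : + i + + b ≡ rowEnds ρ 1 + rowEnds λᴸ 1 + + 2
      n₁ = trans (sym (ℤ.pos-+ i b)) (trans (cong +_ (hasCount-unique points₁ (points 1))) (count 1))
      -- Each count is the sum of the two sides plus the number of rows, which is 2, 4, 5, 7, 8 for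
      -- the first five dilates.
      related : + 9 * (rowEnds ρ 2 + rowEnds λᴸ 2 + + 4) + + 3 * (rowEnds ρ 5 + rowEnds λᴸ 5 + + 8) ≡
        + 4 * (rowEnds ρ 1 + rowEnds λᴸ 1 + + 2) + + 3 * (rowEnds ρ 3 + rowEnds λᴸ 3 + + 5) + + 5 * (rowEnds ρ 4 + rowEnds λᴸ 4 + + 7)
      related = substitute (count 1) (count 2) (count 3) (count 4) (count 5)
        (relation (points 1) (points 2) (points 3) (points 4) (points 5))
        where
        substitute : ∀ {a b c d e a′ b′ c′ d′ e′} → a ≡ a′ → b ≡ b′ → c ≡ c′ → d ≡ d′ → e ≡ e′ →
          + 9 * b + + 3 * e ≡ + 4 * a + + 3 * c + + 5 * d → + 9 * b′ + + 3 * e′ ≡ + 4 * a′ + + 3 * c′ + + 5 * d′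
        substitute refl refl refl refl refl p = p
      -- This is 12 times the width of P at height 3/2, tested by the supporting line of the left
      -- side's top piece.
      apex : 0ℤ ≤ ρ 3 + λᴸ 3
      apex = cancel-≤ {+ 12} {ρ 3 + λᴸ 3} (0<1+ 11)
        (Profile.attained rightSide 3 ℕ.≤-refl (mirrored ℓ) (left-line-nonneg 2 ℕ.≤-refl)
          by trans (ev-mirrored ℓ (ρ 3) (+ 18) (+ 12)) (apex-generic (λᴸ 2) (λᴸ 3) (ρ 3)))
        where
        ℓ = line (λᴸ 2) (λᴸ 3) (+ 2)
        apex-generic : ∀ a b r → - (+ 12) * (- r) + + 2 * (b - a) * + 18 + (a - + 2 * (b - a)) * + 12 ≡ + 12 * (r + b)
        apex-generic = solve-∀
      generic : ∀ a₁ a₂ a₃ a₄ a₅ b₁ b₂ b₃ b₄ b₅ p q s t i b →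
        i + b ≡ a₁ + b₁ + + 2 →
        + 9 * (a₂ + b₂ + + 4) + + 3 * (a₅ + b₅ + + 8) ≡
          + 4 * (a₁ + b₁ + + 2) + + 3 * (a₃ + b₃ + + 5) + + 5 * (a₄ + b₄ + + 7) →
        combination a₁ a₂ a₃ a₄ a₅ p s + combination b₁ b₂ b₃ b₄ b₅ q t + (s + t) + + 18 * (i - (p + q + 1ℤ)) ≡
        + 6 * (+ 2 * i + + 7 - b)
      generic a₁ a₂ a₃ a₄ a₅ b₁ b₂ b₃ b₄ b₅ p q s t i b e₁ e₂ = trans
        (regroup a₁ a₂ a₃ a₄ a₅ b₁ b₂ b₃ b₄ b₅ p q s t i b)
        (trans (cong₂ (λ x y → + 6 * (+ 2 * i + + 7 - b) + + 6 * x - + 6 * y) (difference e₁) (difference e₂)) (cancel (+ 6 * (+ 2 * i + + 7 - b))))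
        where
        difference : ∀ {x y} → x ≡ y → x - y ≡ 0ℤ
        difference {x} refl = ℤ.+-inverseʳ x
        cancel : ∀ z → z + + 6 * 0ℤ - + 6 * 0ℤ ≡ z
        cancel = solve-∀
        regroup : ∀ a₁ a₂ a₃ a₄ a₅ b₁ b₂ b₃ b₄ b₅ p q s t i b →
          + 18 - + 6 * (+ 9 * a₂ + + 3 * a₅ - + 3 * a₁ - + 3 * a₃ - + 5 * a₄ - + 3 * p) - s
          + (+ 18 - + 6 * (+ 9 * b₂ + + 3 * b₅ - + 3 * b₁ - + 3 * b₃ - + 5 * b₄ - + 3 * q) - t)
          + (s + t) + + 18 * (i - (p + q + 1ℤ)) ≡
          + 6 * (+ 2 * i + + 7 - b) + + 6 * (i + b - (a₁ + b₁ + + 2))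
          - + 6 * (+ 9 * (a₂ + b₂ + + 4) + + 3 * (a₅ + b₅ + + 8)
                   - (+ 4 * (a₁ + b₁ + + 2) + + 3 * (a₃ + b₃ + + 5) + + 5 * (a₄ + b₄ + + 7)))
        regroup = solve-∀

module HalfPlane {i b : ℕ} (P : Body i b) {x₀ y₀} (centre : Body.Int P x₀ y₀ 1ℤ)
                 (above : ∀ {X Y} → (X , Y) ∈ Body.gens P → 0ℤ ≤ Y) (y₀>0 : 0ℤ < y₀)
                 {N : ℤ} (N≥3 : + 3 ≤ N) (left : Body.In P 0ℤ 0ℤ 1ℤ) (right : Body.In P N 0ℤ 1ℤ)
                 (longest : ∀ {a c y} → Body.In P a y 1ℤ → Body.In P c y 1ℤ → c - a ≤ N) where
  open Body P
  open Lattice P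
  open Strip P
  open Interior centre
  open Base N≥3 left right longest

  In-above : ∀ {x y k} → 0ℤ ≤ k → In x y k → 0ℤ ≤ y
  In-above {x} {y} {k} k≥0 p = dual (+ 0 , + 1 , + 0) (λ {X} {Y} z∈ → above z∈ by sym (generic X Y (+ 2))) k≥0 p by generic x y k
    where
    generic : ∀ x y k → + 0 * x + + 1 * y + + 0 * k ≡ y
    generic = solve-∀

  module _ (N≥2i+5 : + 2 * + i + + 5 ≤ N) (y₀≡1 : y₀ ≡ 1ℤ) where

    centre₁ : Int x₀ 1ℤ 1ℤ
    centre₁ = subst (λ y → Int x₀ y 1ℤ) y₀≡1 centre

    -- If Y ≥ 4, the triangle over the base with apex (X/2 , Y/2) meets row 1 in length N(Y - 2)/Y ≥
    -- N/2 > i + 1, and row 1 would contain i + 1 interior lattice points.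
    gens-≤3 : ∀ {X Y} → (X , Y) ∈ gens → Y ≤ + 3
    gens-≤3 {X} {Y} z∈ = by-contra-≤ {Y} {+ 3} λ r → ⊥-elim (ℕ.<-irrefl refl (row-≤i (proj₂ (chord r))))
      where
      generic₂ : ∀ Y → Y - + 2 ≡ Y * + 1 - + 2 * + 1
      generic₂ = solve-∀
      generic₃ : ∀ Y N i X → (N - (+ 2 * i + + 5)) * (Y - + 3 - 1ℤ + + 2) + i * (Y - + 3 - 1ℤ) + + 4 * (Y - + 3 - 1ℤ) + + 5 ≡
        N * (Y - + 2) + (X - X) * + 1 - Y * (1ℤ + i) - 1ℤ
      generic₃ = solve-∀
      chord : + 3 < Y → ∃ λ f → ∀ x → f ≤ x → x < f + + suc i → Int x 1ℤ 1ℤ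
      chord r = inner-points {N} {X} {X} {Y} {+ 2} {1ℤ} {Y - + 2} left right (gens-In z∈) (gens-In z∈) N>0
        (ℤ.<-trans (0<1+ 2) r) (0<1+ 0) (generic₂ Y) (<⇒0< (ℤ.<-trans (+<+ (ℕ.s≤s (ℕ.s≤s (ℕ.s≤s ℕ.z≤n)))) r)) (suc i) many
        where
        Y-4 : 0ℤ ≤ Y - + 3 - 1ℤ
        Y-4 = <⇒0≤ r
        many : Y * + suc i < N * (Y - + 2) + (X - X) * 1ℤ
        many = 0≤⇒< (≤⇒0≤ N≥2i+5 ⊗ (Y-4 ⊕ 0≤+ {2}) ⊕ 0≤+ {i} ⊗ Y-4 ⊕ 0≤+ {4} ⊗ Y-4 ⊕ 0≤+ {5}
          by generic₃ Y N (+ i) X)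

    gens-in-strip : InStrip gens
    gens-in-strip z∈ = above z∈ , gens-≤3 z∈

    -- Otherwise P would lie in y ≤ 1, whereas the interior point in row 1 can be moved up a little
    -- without leaving P.
    some-top : ∃ λ X → (X , + 3) ∈ gens
    some-top = cases (onRow (+ 3) gens) refl
      where
      generic₁ : ∀ x y k → + 0 * x + - 1ℤ * y + + 1 * k ≡ k - y
      generic₁ = solve-∀
      generic₂ : ∀ m → m - (m * 1ℤ + 1ℤ) ≡ - 1ℤ
      generic₂ = solve-∀
      generic₃ : ∀ Y → + 3 - Y - 1ℤ ≡ + 2 - Y
      generic₃ = solve-∀
      cases : ∀ zs → onRow (+ 3) gens ≡ zs → ∃ λ X → (X , + 3) ∈ gens
      cases ((X , Y) ∷ _) eq with ∈-filter⁻ (λ z → proj₂ z ℤ.≟ + 3) {xs = gens} (subst ((X , Y) ∈_) (sym eq) (here refl))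
      ... | X∈ , refl = X , X∈
      cases [] eq =
        let n , h = perturb forms centre₁
            m = + suc n
        in ⊥-elim (0≰-1 (dual (+ 0 , - 1ℤ , + 1) flat-nonneg 0≤+ (h m (+≤+ (ℕ.n≤1+n n)))
             by trans (generic₁ (m * x₀) (m * 1ℤ + 1ℤ) m) (generic₂ m)))
        where
        flat-nonneg : NonNegOn gens (+ 0 , - 1ℤ , + 1)
        flat-nonneg {X} {Y} z∈ = <⇒0≤ (ℤ.≤∧≢⇒< (gens-≤3 z∈) λ { refl → ∉ (subst ((X , + 3) ∈_) eq (∈-filter⁺ (λ z → proj₂ z ℤ.≟ + 3) z∈ refl)) })
          by trans (generic₃ Y) (sym (generic₁ X Y (+ 2)))
          where
          ∉ : ∀ {z : LatticePoint} → z ∈ [] → ⊥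
          ∉ ()

    -- Otherwise P would lie in y ≥ 1/2, although it contains (0 , 0).
    some-bottom : ∃ λ X → (X , + 0) ∈ gens
    some-bottom = cases (onRow (+ 0) gens) refl
      where
      generic : ∀ X Y → + 2 * (Y - + 0 - 1ℤ) ≡ + 0 * X + + 2 * Y + - 1ℤ * + 2
      generic = solve-∀
      cases : ∀ zs → onRow (+ 0) gens ≡ zs → ∃ λ X → (X , + 0) ∈ gens
      cases ((X , Y) ∷ _) eq with ∈-filter⁻ (λ z → proj₂ z ℤ.≟ + 0) {xs = gens} (subst ((X , Y) ∈_) (sym eq) (here refl))
      ... | X∈ , refl = X , X∈
      cases [] eq = ⊥-elim (0≰-1 (dual (+ 0 , + 2 , - 1ℤ) high 0≤+ left))
        where
        high : NonNegOn gens (+ 0 , + 2 , - 1ℤ)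
        high {X} {Y} z∈ = 0≤+ {2} ⊗ <⇒0≤ (ℤ.≤∧≢⇒< (above z∈) λ { refl → ∉ (subst ((X , + 0) ∈_) eq (∈-filter⁺ (λ z → proj₂ z ℤ.≟ + 0) z∈ refl)) })
          by generic X Y
          where
          ∉ : ∀ {z : LatticePoint} → z ∈ [] → ⊥
          ∉ ()

    strip-bound : + b ≤ + 2 * + i + + 7
    strip-bound = boundary-bound centre₁ gens-in-strip (proj₂ some-bottom) (proj₂ some-top)

  row₀ : 0ℤ ≤ N + 1ℤ - + length (onRow 0ℤ B)
  row₀ = cases N refl (ℤ.≤-trans (+≤+ ℕ.z≤n) N≥3)
    where
    generic₁ : ∀ N x → N - (N - x) ≡ x - 0ℤ
    generic₁ = solve-∀
    generic₂ : ∀ N x → N - (x - 0ℤ) ≡ 0ℤ + (1ℤ + N) - x - 1ℤ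
    generic₂ = solve-∀
    cases : ∀ n → N ≡ n → 0ℤ ≤ n → 0ℤ ≤ N + 1ℤ - + length (onRow 0ℤ B)
    cases (+ n) eq _ = pos-mono (row-≤ 0ℤ 0ℤ (suc n) B-unique (λ {x} x∈ →
        0≤⇒≤ (≤⇒0≤ (longest (B-In x∈) right) by generic₁ N x) ,
        0≤⇒< (≤⇒0≤ (longest left (B-In x∈)) by trans (generic₂ N x) (cong (λ n → 0ℤ + (1ℤ + n) - x - 1ℤ) eq))))
      by cong (_- + length (onRow 0ℤ B)) (trans (ℤ.+-comm 1ℤ (+ n)) (cong (_+ 1ℤ) (sym eq)))

  length-B-split : + b ≡ + length Bᵘ + + length (onRow 0ℤ B)
  length-B-split = trans (cong +_ (trans (sym length-B) (trans (length-split 0ℤ B)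
      (trans (cong (λ n → length Bᵘ ℕ.+ length (onRow 0ℤ B) ℕ.+ n) down-empty) (ℕ.+-identityʳ _)))))
    (ℤ.pos-+ (length Bᵘ) _)
    where
    down-empty : length (down 0ℤ B) ≡ 0
    down-empty with down 0ℤ B in eq
    ... | [] = refl
    ... | (x , y) ∷ _ with ∈-filter⁻ (λ z → proj₂ z ℤ.<? 0ℤ) {xs = B} (subst ((x , y) ∈_) (sym eq) (here refl))
    ... | z∈ , y<0 = ⊥-elim (ℤ.<-irrefl refl (ℤ.<-≤-trans y<0 (In-above 0≤+ (B-In z∈))))

  -- The base has at most N + 1 lattice points. In the tall regime this cancels the N gained by the
  -- trapezoid and leaves 6 + 1. In the flat regime b ≤ N + 3, so b > 2i + 7 forces N ≥ 2i + 5 and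
  -- thereby the strip.
  half-plane-bound : + b ≤ + 2 * + i + + 7
  half-plane-bound = [ flat-case , tall-case ]′ flat∨tall
    where
    length-Iᵘ : 0ℤ ≤ + i - + length Iᵘ
    length-Iᵘ = pos-mono (subst (length Iᵘ ℕ.≤_) length-I (length-filter _ I))
    tall-case : Tall → + b ≤ + 2 * + i + + 7
    tall-case p = 0≤⇒≤ (≤⇒0≤ p ⊕ row₀ ⊕ 0≤+ {2} ⊗ length-Iᵘ
      by trans (generic (+ length Bᵘ) (+ length Iᵘ) N (+ length (onRow 0ℤ B)) (+ i)) (cong (λ b → + 2 * + i + + 7 - b) (sym length-B-split)))
      where
      generic : ∀ B I N r i → + 2 * I + + 6 - (B + N) + (N + 1ℤ - r) + + 2 * (i - I) ≡ + 2 * i + + 7 - (B + r)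
      generic = solve-∀
    flat-case : Flat → + b ≤ + 2 * + i + + 7
    flat-case (_ , y≤1) = cases (+ b ℤ.≤? + 2 * + i + + 7)
      where
      y₀≡1 : y₀ ≡ 1ℤ
      y₀≡1 = ℤ.≤-antisym (y≤1 (interior⇒In centre)) (ℤ.i<j⇒suc[i]≤j y₀>0)
      -- The interior point lies in row 1, so this row carries at most two boundary points.
      few : 0ℤ ≤ + 2 - + length Bᵘ
      few = pos-mono (subst (ℕ._≤ 2) (sym (proj₁ (rows-up 1 y≤1)))
        (crossing-row {u = x₀} {1ℤ} {1ℤ} Bᵘ-unique (λ z∈ → proj₁ (∈-Bᵘ⁻ z∈)) (subst (λ y → Int x₀ y 1ℤ) y₀≡1 centre)))
      generic : ∀ b B r N i → b - (+ 2 * i + + 7) - 1ℤ + (+ 2 - B) + (N + 1ℤ - r) ≡ N - (+ 2 * i + + 5) + (b - (B + r))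
      generic = solve-∀
      cases : Dec (+ b ≤ + 2 * + i + + 7) → + b ≤ + 2 * + i + + 7
      cases (yes p) = p
      cases (no ¬p) = strip-bound (0≤⇒≤ (<⇒0≤ (≰⇒> ¬p) ⊕ few ⊕ row₀
        by trans (generic (+ b) (+ length Bᵘ) (+ length (onRow 0ℤ B)) N (+ i))
             (trans (cong (λ e → N - (+ 2 * + i + + 5) + e) (trans (cong (_- (+ length Bᵘ + + length (onRow 0ℤ B))) length-B-split) (ℤ.+-inverseʳ (+ length Bᵘ + + length (onRow 0ℤ B)))))
               (ℤ.+-identityʳ (N - (+ 2 * + i + + 5)))))) y₀≡1

-- Choice of coordinates

flip : Affine
flip = record
  { a = + 1 ; b = + 0 ; c = + 0 ; d = - 1ℤ ; e = + 0 ; f = + 0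
  ; a′ = + 1 ; b′ = + 0 ; c′ = + 0 ; d′ = - 1ℤ ; e′ = + 0 ; f′ = + 0
  ; X′-inverse = first ; Y′-inverse = second ; X-inverse = first ; Y-inverse = second }
  where
  first : ∀ x y k → + 1 * (+ 1 * x + + 0 * y + + 0 * k) + + 0 * (+ 0 * x + - 1ℤ * y + + 0 * k) + + 0 * k ≡ x
  first = solve-∀
  second : ∀ x y k → + 0 * (+ 1 * x + + 0 * y + + 0 * k) + - 1ℤ * (+ 0 * x + - 1ℤ * y + + 0 * k) + + 0 * k ≡ y
  second = solve-∀

translation : ℤ → ℤ → Affine
translation p q = record
  { a = + 1 ; b = + 0 ; c = + 0 ; d = + 1 ; e = - p ; f = - q
  ; a′ = + 1 ; b′ = + 0 ; c′ = + 0 ; d′ = + 1 ; e′ = p ; f′ = q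
  ; X′-inverse = λ x y k → first p q x y k ; Y′-inverse = λ x y k → second p q x y k
  ; X-inverse = λ x y k → third p q x y k ; Y-inverse = λ x y k → fourth p q x y k }
  where
  first : ∀ p q x y k → + 1 * (+ 1 * x + + 0 * y + - p * k) + + 0 * (+ 0 * x + + 1 * y + - q * k) + p * k ≡ x
  first = solve-∀
  second : ∀ p q x y k → + 0 * (+ 1 * x + + 0 * y + - p * k) + + 1 * (+ 0 * x + + 1 * y + - q * k) + q * k ≡ y
  second = solve-∀
  third : ∀ p q x y k → + 1 * (+ 1 * x + + 0 * y + p * k) + + 0 * (+ 0 * x + + 1 * y + q * k) + - p * k ≡ x
  third = solve-∀
  fourth : ∀ p q x y k → + 0 * (+ 1 * x + + 0 * y + p * k) + + 1 * (+ 0 * x + + 1 * y + q * k) + - q * k ≡ y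
  fourth = solve-∀

-- For a primitive vector (u , v) with su + rv = 1: the unimodular map sending (u , v) to (1 , 0).
straighten : ∀ s r u v → s * u + r * v ≡ 1ℤ → Affine
straighten s r u v bezout = record
  { a = s ; b = r ; c = - v ; d = u ; e = + 0 ; f = + 0
  ; a′ = u ; b′ = - r ; c′ = v ; d′ = s ; e′ = + 0 ; f′ = + 0
  ; X′-inverse = λ x y k → trans (first s r u v x y k) (unit x)
  ; Y′-inverse = λ x y k → trans (second s r u v x y k) (unit y)
  ; X-inverse = λ x y k → trans (third s r u v x y k) (unit x)
  ; Y-inverse = λ x y k → trans (fourth s r u v x y k) (unit y) }
  where
  unit : ∀ x → (s * u + r * v) * x ≡ x
  unit x = subst (λ e → e * x ≡ x) (sym bezout) (ℤ.*-identityˡ x)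
  first : ∀ s r u v x y k → u * (s * x + r * y + + 0 * k) + - r * (- v * x + u * y + + 0 * k) + + 0 * k ≡ (s * u + r * v) * x
  first = solve-∀
  second : ∀ s r u v x y k → v * (s * x + r * y + + 0 * k) + s * (- v * x + u * y + + 0 * k) + + 0 * k ≡ (s * u + r * v) * y
  second = solve-∀
  third : ∀ s r u v x y k → s * (u * x + - r * y + + 0 * k) + r * (v * x + s * y + + 0 * k) + + 0 * k ≡ (s * u + r * v) * x
  third = solve-∀
  fourth : ∀ s r u v x y k → - v * (u * x + - r * y + + 0 * k) + u * (v * x + s * y + + 0 * k) + + 0 * k ≡ (s * u + r * v) * y
  fourth = solve-∀

module Flipped {i b : ℕ} (P : Body i b) where
  open Body P
  open Transform flip using (pull; at)

  P⁻ : Body i b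
  P⁻ = Transform.transform flip P

  private
    X≡ : ∀ x y k → + 1 * x + + 0 * y + + 0 * k ≡ x
    X≡ = solve-∀
    Y≡ : ∀ x y k → + 0 * x + - 1ℤ * y + + 0 * k ≡ - y
    Y≡ = solve-∀

  In⁺ : ∀ {x y k} → In x y k → Body.In P⁻ x (- y) k
  In⁺ {x} {y} {k} p = subst₂ (λ x y → Body.In P⁻ x y k) (X≡ x y k) (Y≡ x y k) (Transform.In⁺ flip P p)

  In⁻ : ∀ {x y k} → Body.In P⁻ x y k → In x (- y) k
  In⁻ {x} {y} {k} p = subst₂ (λ x y → In x y k) (X≡ x y k) (Y≡ x y k) (Transform.In⁻ flip P p)

  Int⁺ : ∀ {x y k} → Int x y k → Body.Int P⁻ x (- y) k
  Int⁺ {x} {y} {k} p = subst₂ (λ x y → Body.Int P⁻ x y k) (X≡ x y k) (Y≡ x y k) (Transform.Int⁺ flip P p)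

  Int⁻ : ∀ {x y k} → Body.Int P⁻ x y k → Int x (- y) k
  Int⁻ {x} {y} {k} p = subst₂ (λ x y → Int x y k) (X≡ x y k) (Y≡ x y k) (Transform.Int⁻ flip P p)

  gens⁻ : ∀ {X Y} → (X , Y) ∈ Body.gens P⁻ → (X , - Y) ∈ gens
  gens⁻ z∈ with ∈-map⁻ (at 2) z∈
  ... | (X , Y) , w∈ , refl = subst (_∈ gens) (cong₂ _,_ (sym (X≡ X Y (+ 2))) (generic X Y)) w∈
    where
    generic : ∀ X Y → Y ≡ - (+ 0 * X + - 1ℤ * Y + + 0 * + 2)
    generic = solve-∀

  length-down-B : length (down 0ℤ B) ℕ.≤ length (up 0ℤ (Body.B P⁻))
  length-down-B = subst (ℕ._≤ length (up 0ℤ (Body.B P⁻))) (length-map (at 1) (down 0ℤ B))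
    (unique⇒length≤ (Unique.map⁺ at-injective (Unique.filter⁺ _ (Lattice.B-unique P))) sub)
    where
    at-injective : ∀ {z w} → at 1 z ≡ at 1 w → z ≡ w
    at-injective {z} {w} eq = trans (sym (Transform.at′-at flip 1 z)) (trans (cong (Transform.at′ flip 1) eq) (Transform.at′-at flip 1 w))
    sub : ∀ {z} → z ∈ map (at 1) (down 0ℤ B) → z ∈ up 0ℤ (Body.B P⁻)
    sub z∈ with ∈-map⁻ (at 1) z∈
    ... | (x , y) , w∈ , refl with ∈-filter⁻ (λ z → proj₂ z ℤ.<? 0ℤ) {xs = B} w∈
    ... | w∈B , y<0 = ∈-filter⁺ (λ z → 0ℤ ℤ.<? proj₂ z) (∈-map⁺ (at 1) w∈B) (<⇒0< y<0 by₊ generic x y)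
      where
      generic : ∀ x y → 0ℤ - y ≡ + 0 * x + - 1ℤ * y + + 0 * + 1
      generic = solve-∀

  length-up-I : length (up 0ℤ (Body.I P⁻)) ℕ.≤ length (down 0ℤ I)
  length-up-I = subst (ℕ._≤ length (down 0ℤ I)) (length-map mirror′ (up 0ℤ (Body.I P⁻)))
    (unique⇒length≤ (Unique.map⁺ mirror-injective (Unique.filter⁺ _ (Lattice.I-unique P⁻))) sub)
    where
    mirror′ : LatticePoint → LatticePoint
    mirror′ (x , y) = x , - y
    mirror-injective : ∀ {z w} → mirror′ z ≡ mirror′ w → z ≡ w
    mirror-injective eq = cong₂ _,_ (,-injectiveˡ eq) (ℤ.neg-injective (,-injectiveʳ eq))
    sub : ∀ {z} → z ∈ map mirror′ (up 0ℤ (Body.I P⁻)) → z ∈ down 0ℤ I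
    sub z∈ with ∈-map⁻ mirror′ z∈
    ... | (x , y) , w∈ , refl with ∈-filter⁻ (λ z → 0ℤ ℤ.<? proj₂ z) {xs = Body.I P⁻} w∈
    ... | w∈I , y>0 = ∈-filter⁺ (λ z → proj₂ z ℤ.<? 0ℤ) (Lattice.Int-I P (Int⁻ (Lattice.I-Int P⁻ w∈I))) (ℤ.neg-mono-< y>0)

module LongestRow {i b : ℕ} (P : Body i b) {x₀ y₀} (centre : Body.Int P x₀ y₀ 1ℤ)
                  {N : ℤ} (N≥3 : + 3 ≤ N) (left : Body.In P 0ℤ 0ℤ 1ℤ) (right : Body.In P N 0ℤ 1ℤ)
                  (longest : ∀ {a c y} → Body.In P a y 1ℤ → Body.In P c y 1ℤ → c - a ≤ N) where
  open Body P
  open Lattice P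
  open Flipped P using (P⁻; In⁺; In⁻; Int⁺; gens⁻; length-down-B; length-up-I)

  left⁻ : Body.In P⁻ 0ℤ 0ℤ 1ℤ
  left⁻ = In⁺ left

  right⁻ : Body.In P⁻ N 0ℤ 1ℤ
  right⁻ = In⁺ right

  longest⁻ : ∀ {a c y} → Body.In P⁻ a y 1ℤ → Body.In P⁻ c y 1ℤ → c - a ≤ N
  longest⁻ p q = longest (In⁻ p) (In⁻ q)

  -- Beyond twice their interior points, the two sides of the row have at most 2(N + 1) boundary
  -- points, and the row itself has at most 2. Its N - 1 interior points account for 2N - 2 of
  -- these, which leaves 6.
  interior-row-bound : Int 1ℤ 0ℤ 1ℤ → + b ≤ + 2 * + i + + 7
  interior-row-bound m = 0≤⇒≤
    (≤⇒0≤ above ⊕ ≤⇒0≤ below ⊕ pos-mono length-down-B ⊕ 0≤+ {2} ⊗ pos-mono length-up-I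
      ⊕ pos-mono row₀ ⊕ 0≤+ {2} ⊗ inner-row₀ N refl (ℤ.≤-trans (+≤+ (ℕ.s≤s ℕ.z≤n)) N≥3) ⊕ 0≤+ {1}
      by generic (+ length (up 0ℤ B)) (+ length (up 0ℤ I)) (+ length (down 0ℤ B)) (+ length (down 0ℤ I))
           (+ length (up 0ℤ (Body.B P⁻))) (+ length (up 0ℤ (Body.I P⁻)))
           (+ length (onRow 0ℤ B)) (+ length (onRow 0ℤ I)) N (+ i) (+ b)
           (split B (proj₁ (proj₂ (proj₂ boundary)))) (split I (proj₁ (proj₂ (proj₂ interior)))))
    where
    above : + length (up 0ℤ B) ≤ + 2 * + length (up 0ℤ I) + N + 1ℤ
    above = Lattice.Interior.Base.up-≤ P centre N≥3 left right longest
    below : + length (up 0ℤ (Body.B P⁻)) ≤ + 2 * + length (up 0ℤ (Body.I P⁻)) + N + 1ℤ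
    below = Lattice.Interior.Base.up-≤ P⁻ (Int⁺ centre) N≥3 left⁻ right⁻ longest⁻
    row₀ : length (onRow 0ℤ B) ℕ.≤ 2
    row₀ = crossing-row {u = 1ℤ} {0ℤ} {1ℤ} B-unique id m
    inner-row₀ : ∀ n → N ≡ n → + 1 ≤ n → 0ℤ ≤ + length (onRow 0ℤ I) - (N - + 1)
    inner-row₀ (+ suc n) eq _ = pos-mono (row-≥ 0ℤ 1ℤ n (λ x lo hi →
        Int-I (between-Int m right lo (subst (x <_) (sym eq) hi))))
      by cong (λ n → + length (onRow 0ℤ I) - (n - + 1)) (sym eq)
    inner-row₀ (+ 0) _ (+≤+ ())
    split : ∀ xs {n} → length xs ≡ n → + n ≡ + length (up 0ℤ xs) + + length (onRow 0ℤ xs) + + length (down 0ℤ xs)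
    split xs refl = trans (cong +_ (length-split 0ℤ xs))
      (trans (ℤ.pos-+ (length (up 0ℤ xs) ℕ.+ length (onRow 0ℤ xs)) _) (cong (_+ + length (down 0ℤ xs)) (ℤ.pos-+ (length (up 0ℤ xs)) _)))
    generic : ∀ u v d e u⁻ v⁻ r s N i b → b ≡ u + r + d → i ≡ v + s + e →
      + 2 * v + N + 1ℤ - u + (+ 2 * v⁻ + N + 1ℤ - u⁻) + (u⁻ - d) + + 2 * (e - v⁻) + (+ 2 - r) + + 2 * (s - (N - + 1)) + + 1 ≡
      + 2 * i + + 7 - b
    generic u v d e u⁻ v⁻ r s N _ _ refl refl = identity u v d e u⁻ v⁻ r s N
      where
      identity : ∀ u v d e u⁻ v⁻ r s N →
        + 2 * v + N + 1ℤ - u + (+ 2 * v⁻ + N + 1ℤ - u⁻) + (u⁻ - d) + + 2 * (e - v⁻) + (+ 2 - r) + + 2 * (s - (N - + 1)) + + 1 ≡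
        + 2 * (v + s + e) + + 7 - (u + r + d)
      identity = solve-∀

  -- An edge form that vanishes at (1 , 0) and is non-negative at (0 , 0) and (N , 0) is constant
  -- along the row, hence equal to βy. The sign of β tells on which side P lies; for β < 0 the
  -- polygon is reflected.
  boundary-row-bound : ∀ g → g ∈ forms → ev g 1ℤ 0ℤ 1ℤ ≡ 0ℤ → + b ≤ + 2 * + i + + 7
  boundary-row-bound (α , β , γ) g∈ zero-at-1 = cases (ℤ.<-cmp 0ℤ β)
    where
    A : 0ℤ ≤ α * 0ℤ + β * 0ℤ + γ * 1ℤ
    A = All.lookup left g∈
    D : 0ℤ ≤ α * N + β * 0ℤ + γ * 1ℤ
    D = All.lookup right g∈
    generic₁ : ∀ α β γ → α * + 0 + β * + 0 + γ * + 1 - (α * + 1 + β * + 0 + γ * + 1) ≡ 0ℤ - α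
    generic₁ = solve-∀
    generic₂ : ∀ α β γ N → α * N + β * + 0 + γ * + 1 - (α * + 1 + β * + 0 + γ * + 1) ≡ (N - + 1) * α
    generic₂ = solve-∀
    generic₃ : ∀ α β γ → γ ≡ α * + 1 + β * + 0 + γ * + 1 - α
    generic₃ = solve-∀
    minus-zero : ∀ {x} → 0ℤ ≤ x → 0ℤ ≤ x - (α * 1ℤ + β * 0ℤ + γ * 1ℤ)
    minus-zero {x} p = p ⊕ ≤⇒0≤ (ℤ.≤-reflexive zero-at-1) by generic x (α * 1ℤ + β * 0ℤ + γ * 1ℤ)
      where
      generic : ∀ x e → x + (0ℤ - e) ≡ x - e
      generic = solve-∀
    N-1>0 : 0ℤ < N - + 1
    N-1>0 = <⇒0< (ℤ.<-≤-trans (+<+ (ℕ.s≤s (ℕ.s≤s ℕ.z≤n))) N≥3)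
    α≡0 : α ≡ 0ℤ
    α≡0 = ℤ.≤-antisym (0≤⇒≤ (minus-zero A by generic₁ α β γ))
      (cancel-≤ {N - + 1} {α} N-1>0 (minus-zero D by generic₂ α β γ N))
    γ≡0 : γ ≡ 0ℤ
    γ≡0 = trans (generic₃ α β γ) (cong₂ _-_ zero-at-1 α≡0)
    on-y : ∀ {x y k} → ev (α , β , γ) x y k ≡ β * y
    on-y {x} {y} {k} = subst₂ (λ α γ → α * x + β * y + γ * k ≡ β * y) (sym α≡0) (sym γ≡0) (generic β x y k)
      where
      generic : ∀ β x y k → + 0 * x + β * y + + 0 * k ≡ β * y
      generic = solve-∀
    centre-β : 0ℤ < β * y₀
    centre-β = All.lookup centre g∈ by₊ on-y {x₀} {y₀} {1ℤ}
    gens-β : ∀ {X Y} → (X , Y) ∈ gens → 0ℤ ≤ β * Y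
    gens-β {X} {Y} z∈ = All.lookup (gens-In z∈) g∈ by on-y {X} {Y} {+ 2}
    neg-* : ∀ β y → β * y ≡ (0ℤ - β) * - y
    neg-* = solve-∀
    neg-*′ : ∀ β y → β * - y ≡ (0ℤ - β) * y
    neg-*′ = solve-∀
    cases : _ → + b ≤ + 2 * + i + + 7
    cases (tri< β>0 _ _) = HalfPlane.half-plane-bound P centre
      (λ {X} {Y} z∈ → cancel-≤ {β} {Y} β>0 (gens-β z∈)) (cancel-< {β} {y₀} β>0 centre-β) N≥3 left right longest
    cases (tri≈ _ β≡0 _) = ⊥-elim (ℤ.<-irrefl refl (subst (λ β → 0ℤ < β * y₀) (sym β≡0) centre-β))
    cases (tri> _ _ β<0) = HalfPlane.half-plane-bound P⁻ (Int⁺ centre)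
      (λ {X} {Y} z∈ → cancel-≤ {0ℤ - β} {Y} (<⇒0< β<0) (gens-β (gens⁻ z∈) by neg-*′ β Y))
      (cancel-< {0ℤ - β} { - y₀} (<⇒0< β<0) (centre-β by₊ neg-* β y₀)) N≥3 left⁻ right⁻ longest⁻

  bound : + b ≤ + 2 * + i + + 7
  -- As 0 < 1 < N, the point (1 , 0) decides whether the row runs through the interior or along an
  -- edge.
  bound = [ interior-row-bound , (λ p → let g , g∈ , eq = find p in boundary-row-bound g g∈ eq) ]′
    (Int∨zero (between left right (+≤+ ℕ.z≤n) (ℤ.≤-trans (+≤+ (ℕ.s≤s ℕ.z≤n)) N≥3)))

-- Pigeonhole modulo 3 and primitive vectors

duplicate : ∀ {A C : Set} (f : A → C) → (∀ c d → Dec (c ≡ d)) → ∀ {xs} (ys : List C) → Unique xs →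
  (∀ {x} → x ∈ xs → f x ∈ ys) → length ys ℕ.< length xs → ∃₂ λ x x′ → x ∈ xs × x′ ∈ xs × x ≢ x′ × f x ≡ f x′
duplicate {A} {C} f _≟_ {xs} ys uniq into shorter with go uniq
  where
  Duplicate : List A → Set
  Duplicate xs = ∃₂ λ x x′ → x ∈ xs × x′ ∈ xs × x ≢ x′ × f x ≡ f x′
  go : ∀ {xs} → Unique xs → Unique (map f xs) ⊎ Duplicate xs
  go []ᴾ = inj₁ []ᴾ
  go {x ∷ xs} (x∉ ∷ᴾ u) with go u | Any.any? (λ w → f x ≟ f w) xs
  ... | inj₂ (a , c , a∈ , c∈ , rest) | _ = inj₂ (a , c , there a∈ , there c∈ , rest)
  ... | inj₁ _ | yes p = let w , w∈ , eq = find p in inj₂ (x , w , here refl , there w∈ , All.lookup x∉ w∈ , eq)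
  ... | inj₁ v | no ¬p = inj₁ (All.map⁺ (All.tabulate λ w∈ eq → ¬p (lose w∈ eq)) ∷ᴾ v)
... | inj₂ d = d
... | inj₁ v = ⊥-elim (ℕ.<⇒≱ shorter (subst (ℕ._≤ length ys) (length-map f xs) (unique⇒length≤ v sub)))
  where
  sub : ∀ {z} → z ∈ map f xs → z ∈ ys
  sub z∈ with ∈-map⁻ f z∈
  ... | x , x∈ , refl = into x∈

congruent : ∀ x y → x ℤ.%ℕ 3 ≡ y ℤ.%ℕ 3 → ∃ λ a → y - x ≡ + 3 * a
congruent x y eq = y ℤ./ℕ 3 - x ℤ./ℕ 3 , trans
  (cong₂ _-_ (ℤ.a≡a%ℕn+[a/ℕn]*n y 3) (trans (ℤ.a≡a%ℕn+[a/ℕn]*n x 3) (cong (λ r → + r + x ℤ./ℕ 3 * + 3) eq)))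
  (generic (+ (y ℤ.%ℕ 3)) (x ℤ./ℕ 3) (y ℤ./ℕ 3))
  where
  generic : ∀ r p q → r + q * + 3 - (r + p * + 3) ≡ + 3 * (q - p)
  generic = solve-∀

congruent-pair : ∀ {xs : List LatticePoint} → Unique xs → 10 ℕ.≤ length xs →
  ∃₂ λ z w → z ∈ xs × w ∈ xs × z ≢ w × ∃₂ λ a c → proj₁ w - proj₁ z ≡ + 3 * a × proj₂ w - proj₂ z ≡ + 3 * c
congruent-pair uniq long with duplicate (λ z → proj₁ z ℤ.%ℕ 3 , proj₂ z ℤ.%ℕ 3) (≡-dec ℕ._≟_ ℕ._≟_)
  (cartesianProduct (upTo 3) (upTo 3)) uniq
  (λ {z} _ → ∈-cartesianProduct⁺ (∈-upTo⁺ (ℤ.n%ℕd<d (proj₁ z) 3)) (∈-upTo⁺ (ℤ.n%ℕd<d (proj₂ z) 3))) long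
... | z , w , z∈ , w∈ , z≢w , eq = z , w , z∈ , w∈ , z≢w ,
  let a , p = congruent (proj₁ z) (proj₁ w) (,-injectiveˡ eq)
      c , q = congruent (proj₂ z) (proj₂ w) (,-injectiveʳ eq)
  in a , c , p , q

record Primitive (a c : ℤ) : Set where
  field
    d u v s r : ℤ
    d>0 : 0ℤ < d
    a≡ : a ≡ d * u
    c≡ : c ≡ d * v
    bezout : s * u + r * v ≡ 1ℤ

-- The extended Euclidean algorithm, by recursion on a bound n for the second argument.
primitive-part-ℕ : ∀ n a c → c ℕ.< n → ¬ (a ≡ 0ℤ × c ≡ 0) → Primitive a (+ c)
primitive-part-ℕ (suc n) (+ 0) 0 _ ≢0 = ⊥-elim (≢0 (refl , refl))
primitive-part-ℕ (suc n) a@(+ suc _) 0 _ _ = record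
  { d = a ; u = + 1 ; v = + 0 ; s = + 1 ; r = + 0 ; d>0 = 0<1+ _ ; a≡ = sym (ℤ.*-identityʳ a) ; c≡ = sym (ℤ.*-zeroʳ a) ; bezout = refl }
primitive-part-ℕ (suc n) a@(-[1+ m ]) 0 _ _ = record
  { d = + suc m ; u = - (+ 1) ; v = + 0 ; s = - (+ 1) ; r = + 0 ; d>0 = 0<1+ m
  ; a≡ = trans (cong -_ (sym (ℤ.*-identityʳ (+ suc m)))) (ℤ.neg-distribʳ-* (+ suc m) (+ 1)) ; c≡ = sym (ℤ.*-zeroʳ (+ suc m)) ; bezout = refl }
primitive-part-ℕ (suc n) a (suc c) (ℕ.s≤s c<n) _ = record
  { d = d ; u = q * u + v ; v = u ; s = r ; r = s - q * r ; d>0 = d>0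
  ; a≡ = trans (ℤ.a≡a%ℕn+[a/ℕn]*n a (suc c)) (trans (cong₂ (λ x y → x + q * y) c≡ a≡) (generic₁ d u v q))
  ; c≡ = a≡
  ; bezout = trans (generic₂ s r u v q) bezout }
  where
  q = a ℤ./ℕ suc c
  open Primitive (primitive-part-ℕ n (+ suc c) (a ℤ.%ℕ suc c) (ℕ.<-≤-trans (ℤ.n%ℕd<d a (suc c)) c<n) (λ ()))
  generic₁ : ∀ d u v q → d * v + q * (d * u) ≡ d * (q * u + v)
  generic₁ = solve-∀
  generic₂ : ∀ s r u v q → r * (q * u + v) + (s - q * r) * u ≡ s * u + r * v
  generic₂ = solve-∀

primitive-part : ∀ a c → ¬ (a ≡ 0ℤ × c ≡ 0ℤ) → Primitive a c
primitive-part a (+ c) ≢0 = primitive-part-ℕ (suc c) a c ℕ.≤-refl (λ (p , q) → ≢0 (p , cong +_ q))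
primitive-part a c@(-[1+ n ]) _ = record
  { d = d ; u = u ; v = - v ; s = s ; r = - r ; d>0 = d>0 ; a≡ = a≡
  ; c≡ = trans (cong -_ c≡) (ℤ.neg-distribʳ-* d v) ; bezout = trans (generic s r u v) bezout }
  where
  open Primitive (primitive-part-ℕ (suc (suc n)) a (suc n) ℕ.≤-refl (λ ()))
  generic : ∀ s r u v → s * u + - r * - v ≡ s * u + r * v
  generic = solve-∀

-- The longest lattice segment in a row of P is translated to [0 , N] × {0}.
row-bound : ∀ {i b} (P : Body i b) {x₀ y₀} → Body.Int P x₀ y₀ 1ℤ → ∀ {x x′ y} → Body.In P x y 1ℤ → Body.In P x′ y 1ℤ →
  + 3 ≤ x′ - x → + b ≤ + 2 * + i + + 7
row-bound {i} {b} P {x₀} {y₀} centre {x} {x′} {y} p p′ wide =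
  bound (∃-max (λ (z , w) → proj₁ w - proj₁ z) (∈-filter⁺ same? (∈-cartesianProduct⁺ (In-S p) (In-S p′)) refl))
  where
  open Body P
  open Lattice P
  same? : ∀ (zw : LatticePoint × LatticePoint) → Dec (proj₂ (proj₁ zw) ≡ proj₂ (proj₂ zw))
  same? (z , w) = proj₂ z ℤ.≟ proj₂ w
  pairs : List (LatticePoint × LatticePoint)
  pairs = filter same? (cartesianProduct S S)
  bound : (∃ λ m → m ∈ pairs × (∀ {w} → w ∈ pairs → proj₁ (proj₂ w) - proj₁ (proj₁ w) ≤ proj₁ (proj₂ m) - proj₁ (proj₁ m))) →
    + b ≤ + 2 * + i + + 7
  bound (((l , h) , (r , h′)) , m∈ , max) with ∈-filter⁻ same? {xs = cartesianProduct S S} m∈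
  ... | lr∈ , refl = LongestRow.bound P′ centre′ (ℤ.≤-trans wide (longest p p′)) left right longest′
    where
    open Transform (translation l h)
    P′ : Body i b
    P′ = transform P
    l∈ : (l , h) ∈ S
    l∈ = proj₁ (∈-cartesianProduct⁻ S S lr∈)
    r∈ : (r , h) ∈ S
    r∈ = proj₂ (∈-cartesianProduct⁻ S S lr∈)
    longest : ∀ {a c y} → In a y 1ℤ → In c y 1ℤ → c - a ≤ r - l
    longest q q′ = max (∈-filter⁺ same? (∈-cartesianProduct⁺ (In-S q) (In-S q′)) refl)
    centre′ : Body.Int P′ _ _ 1ℤ
    centre′ = Int⁺ P centre
    x-shift : ∀ l x y → + 1 * x + + 0 * y + - l * + 1 ≡ x - l
    x-shift = solve-∀
    y-shift : ∀ h x y → + 0 * x + + 1 * y + - h * + 1 ≡ y - h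
    y-shift = solve-∀
    unshift : ∀ l a c y → + 1 * c + + 0 * y + l * + 1 - (+ 1 * a + + 0 * y + l * + 1) ≡ c - a
    unshift = solve-∀
    y-unshift : ∀ h x y → + 0 * x + + 1 * y + h * + 1 ≡ y + h
    y-unshift = solve-∀
    place : ∀ {x} → (x , h) ∈ S → Body.In P′ (x - l) 0ℤ 1ℤ
    place {x} x∈ = subst₂ (λ x y → Body.In P′ x y 1ℤ) (x-shift l x h) (trans (y-shift h x h) (ℤ.+-inverseʳ h)) (In⁺ P (S-In x∈))
    left : Body.In P′ 0ℤ 0ℤ 1ℤ
    left = subst (λ x → Body.In P′ x 0ℤ 1ℤ) (ℤ.+-inverseʳ l) (place l∈)
    right : Body.In P′ (r - l) 0ℤ 1ℤ
    right = place r∈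
    longest′ : ∀ {a c y} → Body.In P′ a y 1ℤ → Body.In P′ c y 1ℤ → c - a ≤ r - l
    longest′ {a} {c} {y} q q′ = subst (_≤ r - l) (unshift l a c y)
      (longest (subst (λ y → In (+ 1 * a + + 0 * y′ + l * + 1) y 1ℤ) (y-unshift h a y) (In⁻ P q))
               (subst (λ y → In (+ 1 * c + + 0 * y′ + l * + 1) y 1ℤ) (y-unshift h c y) (In⁻ P q′)))
      where y′ = y

body-bound : ∀ {i b} → Body i b → 0 ℕ.< i → 10 ℕ.≤ b → + b ≤ + 2 * + i + + 7
body-bound {i} {b} P 0<i 10≤b = reduce (congruent-pair B-unique (subst (10 ℕ.≤_) (sym length-B) 10≤b))
  where
  open Body P
  open Lattice P
  length-B : length B ≡ b
  length-B = proj₁ (proj₂ (proj₂ boundary))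
  centre : ∃₂ λ x y → Int x y 1ℤ
  centre = cases I refl
    where
    cases : ∀ zs → I ≡ zs → ∃₂ λ x y → Int x y 1ℤ
    cases ((x , y) ∷ _) eq = x , y , I-Int (subst ((x , y) ∈_) (sym eq) (here refl))
    cases [] eq = ⊥-elim (ℕ.<-irrefl (trans (sym (cong length eq)) (proj₁ (proj₂ (proj₂ interior)))) 0<i)
  reduce : (∃₂ λ z w → z ∈ B × w ∈ B × z ≢ w × ∃₂ λ a c → proj₁ w - proj₁ z ≡ + 3 * a × proj₂ w - proj₂ z ≡ + 3 * c) →
    + b ≤ + 2 * + i + + 7
  reduce ((x , y) , (x′ , y′) , z∈ , w∈ , z≢w , a , c , 3a , 3c) =
    -- The two points differ by 3d(u , v), which the straightening sends to (3d , 0).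
    row-bound P′ (Int⁺ P (proj₂ (proj₂ centre))) {x = X x y 1ℤ} {X x′ y′ 1ℤ} {Y x y 1ℤ}
      (In⁺ P (B-In z∈)) (subst (λ h → Body.In P′ (X x′ y′ 1ℤ) h 1ℤ) same-row (In⁺ P (B-In w∈)))
      (0≤⇒≤ (0≤+ {3} ⊗ pos⇒0≤ d>0 by sym 3d))
    where
    nonzero : ¬ (a ≡ 0ℤ × c ≡ 0ℤ)
    nonzero (refl , refl) = z≢w (cong₂ _,_ (sym (ℤ.i-j≡0⇒i≡j x′ x 3a)) (sym (ℤ.i-j≡0⇒i≡j y′ y 3c)))
    open Primitive (primitive-part a c nonzero)
    open Transform (straighten s r u v bezout)
    open Affine (straighten s r u v bezout) using (X; Y)
    P′ : Body i b
    P′ = transform P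
    Δx : x′ - x ≡ + 3 * (d * u)
    Δx = trans 3a (cong (+ 3 *_) a≡)
    Δy : y′ - y ≡ + 3 * (d * v)
    Δy = trans 3c (cong (+ 3 *_) c≡)
    rise : ∀ u v x y x′ y′ → - v * x′ + u * y′ + + 0 * + 1 ≡ - v * x + u * y + + 0 * + 1 + (u * (y′ - y) - v * (x′ - x))
    rise = solve-∀
    level : ∀ d u v h → h + (u * (+ 3 * (d * v)) - v * (+ 3 * (d * u))) ≡ h
    level = solve-∀
    same-row : Y x′ y′ 1ℤ ≡ Y x y 1ℤ
    same-row = trans (rise u v x y x′ y′)
      (subst₂ (λ p q → Y x y 1ℤ + (u * p - v * q) ≡ Y x y 1ℤ) (sym Δy) (sym Δx) (level d u v (Y x y 1ℤ)))
    run : ∀ s r x y x′ y′ → s * x′ + r * y′ + + 0 * + 1 - (s * x + r * y + + 0 * + 1) - + 3 ≡ s * (x′ - x) + r * (y′ - y) - + 3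
    run = solve-∀
    factor : ∀ s r u v d → s * (+ 3 * (d * u)) + r * (+ 3 * (d * v)) - + 3 ≡ + 3 * (d * (s * u + r * v) - 1ℤ)
    factor = solve-∀
    3d : X x′ y′ 1ℤ - X x y 1ℤ - + 3 ≡ + 3 * (d - 1ℤ)
    3d = trans (run s r x y x′ y′)
      (subst₂ (λ p q → s * p + r * q - + 3 ≡ + 3 * (d - 1ℤ)) (sym Δx) (sym Δy)
        (trans (factor s r u v d) (subst (λ e → + 3 * (e - 1ℤ) ≡ + 3 * (d - 1ℤ)) (sym (trans (subst (λ e → d * e ≡ d * 1ℤ) (sym bezout) refl) (ℤ.*-identityʳ d))) refl)))

-- Ehrhart polynomials

evalℤ : List ℤ → ℤ → ℤ
evalℤ [] t = 0ℤ
evalℤ (c ∷ cs) t = c + t * evalℤ cs t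

abs-bounds : ∀ c → 0ℤ ≤ + ℤ.∣ c ∣ - c × 0ℤ ≤ + ℤ.∣ c ∣ + c
abs-bounds (+ n) = (0≤+ {0} by sym (ℤ.+-inverseʳ (+ n))) , (0≤+ {n} ⊕ 0≤+ {n})
abs-bounds -[1+ n ] = (0≤+ {suc n} ⊕ 0≤+ {suc n}) , (0≤+ {0} by sym (ℤ.+-inverseʳ (+ suc n)))

-- Write the polynomial as c + kq. Then kq(k) is bounded by C + |c|, so q vanishes by induction.
-- What remains is the constant c with k|c| ≤ C for all k, and k = C + 1 gives c = 0.
vanishing : ∀ cs C → 0ℤ ≤ C →
  (∀ k → 0ℤ < k → 0ℤ ≤ C - k * evalℤ cs k × 0ℤ ≤ C + k * evalℤ cs k) → ∀ k → 0ℤ < k → evalℤ cs k ≡ 0ℤ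
vanishing [] C C≥0 bnd k k>0 = refl
vanishing (c ∷ cs) C C≥0 bnd k k>0 =
  trans (cong (λ q → c + k * q) (tail k k>0)) (trans (cong (λ x → c + x) (ℤ.*-zeroʳ k)) (trans (ℤ.+-identityʳ c) c≡0))
  where
  C′ : ℤ
  C′ = C + + ℤ.∣ c ∣
  C′≥0 : 0ℤ ≤ C′
  C′≥0 = C≥0 ⊕ 0≤+
  g₁ : ∀ C c k q A → C - k * (c + k * q) + C * (k - 1ℤ) + k * (A + c) ≡ k * (C + A - k * q)
  g₁ = solve-∀
  g₂ : ∀ C c k q A → C + k * (c + k * q) + C * (k - 1ℤ) + k * (A - c) ≡ k * (C + A + k * q)
  g₂ = solve-∀
  tail : ∀ k → 0ℤ < k → evalℤ cs k ≡ 0ℤ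
  tail = vanishing cs C′ C′≥0 λ k k>0 → let lo , hi = bnd k k>0 in
    cancel-≤ {k} {C′ - k * evalℤ cs k} k>0
      (lo ⊕ C≥0 ⊗ pos⇒0≤ k>0 ⊕ <⇒≤ k>0 ⊗ proj₂ (abs-bounds c) by g₁ C c k (evalℤ cs k) (+ ℤ.∣ c ∣)) ,
    cancel-≤ {k} {C′ + k * evalℤ cs k} k>0
      (hi ⊕ C≥0 ⊗ pos⇒0≤ k>0 ⊕ <⇒≤ k>0 ⊗ proj₁ (abs-bounds c) by g₂ C c k (evalℤ cs k) (+ ℤ.∣ c ∣))
  K : ℤ
  K = C + 1ℤ
  K>0 : 0ℤ < K
  K>0 = 0≤⇒pos (C≥0 by generic C)
    where
    generic : ∀ C → C ≡ C + 1ℤ - 1ℤ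
    generic = solve-∀
  value-at-K : c + K * evalℤ cs K ≡ c
  value-at-K = trans (cong (λ q → c + K * q) (tail K K>0)) (trans (cong (λ x → c + x) (ℤ.*-zeroʳ K)) (ℤ.+-identityʳ c))
  lo : 0ℤ ≤ C - K * c
  lo = subst (λ v → 0ℤ ≤ C - K * v) value-at-K (proj₁ (bnd K K>0))
  hi : 0ℤ ≤ C + K * c
  hi = subst (λ v → 0ℤ ≤ C + K * v) value-at-K (proj₂ (bnd K K>0))
  c≡0 : c ≡ 0ℤ
  c≡0 = ℤ.≤-antisym
    (by-contra-≤ {c} {0ℤ} λ r → lo ⊕ K>0′ ⊗ <⇒0≤ r by g₃ C c)
    (by-contra-≤ {0ℤ} {c} λ r → hi ⊕ K>0′ ⊗ <⇒0≤ r by g₄ C c)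
    where
    K>0′ = <⇒≤ K>0
    g₃ : ∀ C c → C - (C + 1ℤ) * c + (C + 1ℤ) * (c - 0ℤ - 1ℤ) ≡ - 1ℤ
    g₃ = solve-∀
    g₄ : ∀ C c → C + (C + 1ℤ) * c + (C + 1ℤ) * (0ℤ - c - 1ℤ) ≡ - 1ℤ
    g₄ = solve-∀

uncons : List ℤ → ℤ × List ℤ
uncons [] = 0ℤ , []
uncons (c ∷ cs) = c , cs

evalℤ-uncons : ∀ cs t → evalℤ cs t ≡ proj₁ (uncons cs) + t * evalℤ (proj₂ (uncons cs)) t
evalℤ-uncons [] t = sym (trans (ℤ.+-identityˡ (t * 0ℤ)) (ℤ.*-zeroʳ t))
evalℤ-uncons (c ∷ cs) t = refl

-- Split off the three lowest coefficients. Division of the growth bound by k² shows that k times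
-- the remaining polynomial is bounded, so that `vanishing` applies to it.
quadratic : ∀ cs C → 0ℤ ≤ C → (∀ k → 0ℤ < k → 0ℤ ≤ evalℤ cs k × 0ℤ ≤ C * (k * k) - evalℤ cs k) →
  ∃ λ c₀ → ∃₂ λ c₁ c₂ → ∀ k → 0ℤ < k → evalℤ cs k ≡ c₀ + k * (c₁ + k * c₂)
quadratic cs C C≥0 bnd = c₀ , c₁ , c₂ , λ k k>0 → trans (expand k)
  (trans (cong (λ r → c₀ + k * (c₁ + k * (c₂ + k * r))) (rest k k>0)) (generic k c₀ c₁ c₂))
  where
  c₀ c₁ c₂ : ℤ
  cs₁ cs₂ cs₃ : List ℤ
  c₀ = proj₁ (uncons cs)
  cs₁ = proj₂ (uncons cs)
  c₁ = proj₁ (uncons cs₁)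
  cs₂ = proj₂ (uncons cs₁)
  c₂ = proj₁ (uncons cs₂)
  cs₃ = proj₂ (uncons cs₂)
  generic : ∀ k a b c → a + k * (b + k * (c + k * 0ℤ)) ≡ a + k * (b + k * c)
  generic = solve-∀
  expand : ∀ k → evalℤ cs k ≡ c₀ + k * (c₁ + k * (c₂ + k * evalℤ cs₃ k))
  expand k = trans (evalℤ-uncons cs k) (subst (λ e → c₀ + k * evalℤ cs₁ k ≡ c₀ + k * e)
    (trans (evalℤ-uncons cs₁ k) (subst (λ e → c₁ + k * evalℤ cs₂ k ≡ c₁ + k * e) (evalℤ-uncons cs₂ k) refl)) refl)
  A₀ A₁ A₂ C′ : ℤ
  A₀ = + ℤ.∣ c₀ ∣
  A₁ = + ℤ.∣ c₁ ∣
  A₂ = + ℤ.∣ c₂ ∣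
  C′ = C + A₀ + A₁ + A₂
  g₁ : ∀ C a b c A B D k r → C * (k * k) - (a + k * (b + k * (c + k * r))) + (A + a) + A * ((k - 1ℤ) * (k + 1ℤ)) + k * (B + b)
    + B * (k * (k - 1ℤ)) + k * k * (D + c) ≡ k * k * (C + A + B + D - k * r)
  g₁ = solve-∀
  g₂ : ∀ C a b c A B D k r → a + k * (b + k * (c + k * r)) + (A - a) + A * ((k - 1ℤ) * (k + 1ℤ)) + k * (B - b)
    + B * (k * (k - 1ℤ)) + k * k * (D - c) + C * (k * k) ≡ k * k * (C + A + B + D + k * r)
  g₂ = solve-∀
  rest : ∀ k → 0ℤ < k → evalℤ cs₃ k ≡ 0ℤ
  rest = vanishing cs₃ C′ (C≥0 ⊕ 0≤+ ⊕ 0≤+ ⊕ 0≤+) λ k k>0 →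
    let lo , hi = bnd k k>0
        k≥0 = <⇒≤ k>0
        k-1≥0 = pos⇒0≤ k>0
        k+1≥0 = k≥0 ⊕ 0≤+ {1}
        r = evalℤ cs₃ k
    in cancel-≤ {k * k} {C′ - k * r} (k>0 ⊗₊ k>0)
         (subst (λ e → 0ℤ ≤ C * (k * k) - e) (expand k) hi
           ⊕ proj₂ (abs-bounds c₀) ⊕ 0≤+ {ℤ.∣ c₀ ∣} ⊗ (k-1≥0 ⊗ k+1≥0) ⊕ k≥0 ⊗ proj₂ (abs-bounds c₁)
           ⊕ 0≤+ {ℤ.∣ c₁ ∣} ⊗ (k≥0 ⊗ k-1≥0) ⊕ (k≥0 ⊗ k≥0) ⊗ proj₂ (abs-bounds c₂)
           by g₁ C c₀ c₁ c₂ A₀ A₁ A₂ k r) ,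
       cancel-≤ {k * k} {C′ + k * r} (k>0 ⊗₊ k>0)
         (subst (λ e → 0ℤ ≤ e) (expand k) lo
           ⊕ proj₁ (abs-bounds c₀) ⊕ 0≤+ {ℤ.∣ c₀ ∣} ⊗ (k-1≥0 ⊗ k+1≥0) ⊕ k≥0 ⊗ proj₁ (abs-bounds c₁)
           ⊕ 0≤+ {ℤ.∣ c₁ ∣} ⊗ (k≥0 ⊗ k-1≥0) ⊕ (k≥0 ⊗ k≥0) ⊗ proj₁ (abs-bounds c₂) ⊕ C≥0 ⊗ (k≥0 ⊗ k≥0)
           by g₂ C c₀ c₁ c₂ A₀ A₁ A₂ k r)

-- Pseudo-integrality speaks of counts that are given. Enumerating kP inside a box supplies a count
-- for every k, together with a bound of order k² that makes the Ehrhart polynomial quadratic.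
module Counting (forms : List Form) (gens : List LatticePoint)
                (dual : ∀ φ → NonNegOn gens φ → ∀ {x y k} → 0ℤ ≤ k → All (λ g → 0ℤ ≤ ev g x y k) forms → 0ℤ ≤ ev φ x y k) where

  In : ℤ → ℤ → ℤ → Set
  In x y k = All (λ g → 0ℤ ≤ ev g x y k) forms

  Points : ℕ → ℕ → Set
  Points k = HasCount (λ z → In (proj₁ z) (proj₂ z) (+ k))

  bounded : ∀ gens → ∃ λ M → ∀ {X Y} → (X , Y) ∈ gens → ℤ.∣ X ∣ ℕ.≤ M × ℤ.∣ Y ∣ ℕ.≤ M
  bounded [] = 0 , λ ()
  bounded ((X , Y) ∷ zs) with bounded zs
  ... | M , h = ℤ.∣ X ∣ ℕ.+ ℤ.∣ Y ∣ ℕ.+ M , λ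
    { (here refl) → ℕ.≤-trans (ℕ.m≤m+n ℤ.∣ X ∣ ℤ.∣ Y ∣) (ℕ.m≤m+n _ M) ,
                    ℕ.≤-trans (ℕ.m≤n+m ℤ.∣ Y ∣ ℤ.∣ X ∣) (ℕ.m≤m+n _ M)
    ; (there z∈) → ℕ.≤-trans (proj₁ (h z∈)) (ℕ.m≤n+m M _) , ℕ.≤-trans (proj₂ (h z∈)) (ℕ.m≤n+m M _) }

  M : ℕ
  M = proj₁ (bounded gens)

  side : ℕ → ℕ
  side k = suc (2 ℕ.* (M ℕ.* k))

  range : ℕ → List ℤ
  range k = interval (- + (M ℕ.* k)) (side k)

  box : ℕ → List LatticePoint
  box k = cartesianProduct (range k) (range k)

  In? : ∀ k z → Dec (In (proj₁ z) (proj₂ z) (+ k))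
  In? k z = All.all? (λ g → 0ℤ ℤ.≤? ev g (proj₁ z) (proj₂ z) (+ k)) forms

  in-range : ∀ k {x} → 0ℤ ≤ + M * + k + x → 0ℤ ≤ + M * + k - x → x ∈ range k
  in-range k {x} lo hi = ∈-interval⁺ (- + (M ℕ.* k)) (side k)
    (0≤⇒≤ (lo by trans (generic₁ (+ M * + k) x) (cong (λ m → x - - m) (sym (ℤ.pos-* M k)))))
    (0≤⇒< (hi by trans (generic₂ (+ M * + k) x) (cong₂ (λ m n → - m + (1ℤ + n) - x - 1ℤ) (sym (ℤ.pos-* M k))
      (trans (cong (+ 2 *_) (sym (ℤ.pos-* M k))) (sym (ℤ.pos-* 2 (M ℕ.* k)))))))
    where
    generic₁ : ∀ m x → m + x ≡ x - - m
    generic₁ = solve-∀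
    generic₂ : ∀ m x → m - x ≡ - m + (1ℤ + + 2 * m) - x - 1ℤ
    generic₂ = solve-∀

  in-box : ∀ k {x y} → In x y (+ k) → (x , y) ∈ box k
  in-box k {x} {y} p = ∈-cartesianProduct⁺
    (in-range k (dual (+ 1 , + 0 , + M) (λ {X} {Y} z∈ → proj₂ (coordinate X (proj₁ (M-bounds z∈))) by g₁ X Y (+ M) (+ 2)) 0≤+ p by sym (g₁ x y (+ M) (+ k)))
                (dual (- 1ℤ , + 0 , + M) (λ {X} {Y} z∈ → proj₁ (coordinate X (proj₁ (M-bounds z∈))) by g₂ X Y (+ M) (+ 2)) 0≤+ p by sym (g₂ x y (+ M) (+ k))))
    (in-range k (dual (+ 0 , + 1 , + M) (λ {X} {Y} z∈ → proj₂ (coordinate Y (proj₂ (M-bounds z∈))) by g₃ X Y (+ M) (+ 2)) 0≤+ p by sym (g₃ x y (+ M) (+ k)))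
                (dual (+ 0 , - 1ℤ , + M) (λ {X} {Y} z∈ → proj₁ (coordinate Y (proj₂ (M-bounds z∈))) by g₄ X Y (+ M) (+ 2)) 0≤+ p by sym (g₄ x y (+ M) (+ k))))
    where
    M-bounds : ∀ {X Y} → (X , Y) ∈ gens → ℤ.∣ X ∣ ℕ.≤ M × ℤ.∣ Y ∣ ℕ.≤ M
    M-bounds = proj₂ (bounded gens)
    h₁ : ∀ a m x → a - x + (m - a) + m ≡ m * + 2 - x
    h₁ = solve-∀
    h₂ : ∀ a m x → a + x + (m - a) + m ≡ m * + 2 + x
    h₂ = solve-∀
    g₁ : ∀ x y m k → m * k + x ≡ + 1 * x + + 0 * y + m * k
    g₁ = solve-∀
    g₂ : ∀ x y m k → m * k - x ≡ - 1ℤ * x + + 0 * y + m * k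
    g₂ = solve-∀
    g₃ : ∀ x y m k → m * k + y ≡ + 0 * x + + 1 * y + m * k
    g₃ = solve-∀
    g₄ : ∀ x y m k → m * k - y ≡ + 0 * x + - 1ℤ * y + m * k
    g₄ = solve-∀
    coordinate : ∀ X → ℤ.∣ X ∣ ℕ.≤ M → 0ℤ ≤ + M * + 2 - X × 0ℤ ≤ + M * + 2 + X
    coordinate X le = (proj₁ (abs-bounds X) ⊕ pos-mono le ⊕ 0≤+ {M} by h₁ (+ ℤ.∣ X ∣) (+ M) X) ,
                      (proj₂ (abs-bounds X) ⊕ pos-mono le ⊕ 0≤+ {M} by h₂ (+ ℤ.∣ X ∣) (+ M) X)

  number : ℕ → ℕ
  number k = length (filter (In? k) (box k))

  points : ∀ k → Points k (number k)
  points k = filter (In? k) (box k) ,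
    Unique.filter⁺ (In? k) (Unique.cartesianProduct⁺ (interval-unique (- + (M ℕ.* k)) (side k)) (interval-unique (- + (M ℕ.* k)) (side k))) , refl ,
    λ z → mk⇔ (λ z∈ → proj₂ (∈-filter⁻ (In? k) {xs = box k} z∈)) (λ p → ∈-filter⁺ (In? k) (in-box k p) p)

  length-product : ∀ {A B : Set} (xs : List A) (ys : List B) → length (cartesianProduct xs ys) ≡ length xs ℕ.* length ys
  length-product [] ys = refl
  length-product (x ∷ xs) ys = trans (length-++ (map (x ,_) ys)) (cong₂ ℕ._+_ (length-map (x ,_) ys) (length-product xs ys))

  S : ℤ
  S = + 2 * + M + 1ℤ

  number-≤ : ∀ k → 1 ℕ.≤ k → 0ℤ ≤ S * S * (+ k * + k) - + number k
  number-≤ k 1≤k = few ⊕ wide ⊗ (wide ⊕ 0≤+ {2} ⊗ 0≤+ {side k})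
    by trans (cong (λ w → w - + number k + (S * + k - + side k) * (S * + k - + side k + + 2 * + side k)) (ℤ.pos-* (side k) (side k)))
         (generic S (+ k) (+ side k) (+ number k))
    where
    few : 0ℤ ≤ + (side k ℕ.* side k) - + number k
    few = pos-mono (ℕ.≤-trans (length-filter (In? k) (box k)) (ℕ.≤-reflexive (trans (length-product (range k) (range k))
      (cong₂ ℕ._*_ (length-interval (- + (M ℕ.* k)) (side k)) (length-interval (- + (M ℕ.* k)) (side k))))))
    side≡ : + side k ≡ 1ℤ + + 2 * (+ M * + k)
    side≡ = cong (λ n → 1ℤ + n) (trans (ℤ.pos-* 2 (M ℕ.* k)) (cong (+ 2 *_) (ℤ.pos-* M k)))
    generic₁ : ∀ M k → k - 1ℤ ≡ (+ 2 * M + 1ℤ) * k - (1ℤ + + 2 * (M * k))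
    generic₁ = solve-∀
    wide : 0ℤ ≤ S * + k - + side k
    wide = pos-mono 1≤k by trans (generic₁ (+ M) (+ k)) (cong (λ w → S * + k - w) (sym side≡))
    generic : ∀ S k w n → w * w - n + (S * k - w) * (S * k - w + + 2 * w) ≡ S * S * (k * k) - n
    generic = solve-∀

  -- The weights 9, 3 and 4, 3, 5 balance for 1, k and k²: both sides give 12, 33 and 111. The
  -- factor D is a common denominator of the coefficients.
  polynomial-relation : ∀ D cs → 0ℤ < D → (∀ k n → 1 ℕ.≤ k → Points k n → D * + n ≡ evalℤ cs (+ k)) →
    ∀ {n₁ n₂ n₃ n₄ n₅} → Points 1 n₁ → Points 2 n₂ → Points 3 n₃ → Points 4 n₄ → Points 5 n₅ →
    + 9 * + n₂ + + 3 * + n₅ ≡ + 4 * + n₁ + + 3 * + n₃ + + 5 * + n₄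
  polynomial-relation D cs D>0 poly {n₁} {n₂} {n₃} {n₄} {n₅} p₁ p₂ p₃ p₄ p₅ = combine
    (quadratic cs (D * (S * S)) (<⇒≤ D>0 ⊗ (S≥0 ⊗ S≥0)) growth)
    where
    S≥0 : 0ℤ ≤ S
    S≥0 = 0≤+ {2} ⊗ 0≤+ {M} ⊕ 0≤+ {1}
    generic : ∀ D S k n → D * (S * (k * k) - n) ≡ D * S * (k * k) - D * n
    generic = solve-∀
    growth : ∀ k → 0ℤ < k → 0ℤ ≤ evalℤ cs k × 0ℤ ≤ D * (S * S) * (k * k) - evalℤ cs k
    growth (+ suc k) _ =
      (<⇒≤ D>0 ⊗ 0≤+ {number (suc k)} by poly (suc k) _ (ℕ.s≤s ℕ.z≤n) (points (suc k))) ,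
      subst (λ e → 0ℤ ≤ D * (S * S) * (+ suc k * + suc k) - e) (poly (suc k) _ (ℕ.s≤s ℕ.z≤n) (points (suc k)))
        (<⇒≤ D>0 ⊗ number-≤ (suc k) (ℕ.s≤s ℕ.z≤n) by generic D (S * S) (+ suc k) (+ number (suc k)))
    growth (+ 0) (+<+ ())
    combine : (∃ λ c₀ → ∃₂ λ c₁ c₂ → ∀ k → 0ℤ < k → evalℤ cs k ≡ c₀ + k * (c₁ + k * c₂)) →
      + 9 * + n₂ + + 3 * + n₅ ≡ + 4 * + n₁ + + 3 * + n₃ + + 5 * + n₄
    combine (a , b , c , eq) = ℤ.i-j≡0⇒i≡j _ _ (cancel-0 {D} {+ 9 * + n₂ + + 3 * + n₅ - (+ 4 * + n₁ + + 3 * + n₃ + + 5 * + n₄)} D>0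
      (trans (distribute D (+ n₁) (+ n₂) (+ n₃) (+ n₄) (+ n₅))
        (substitute (at 1 p₁) (at 2 p₂) (at 3 p₃) (at 4 p₄) (at 5 p₅))))
      where
      at : ∀ k {n} → Points (suc (ℕ.pred k)) n → D * + n ≡ a + + suc (ℕ.pred k) * (b + + suc (ℕ.pred k) * c)
      at k p = trans (poly _ _ (ℕ.s≤s ℕ.z≤n) p) (eq _ (0<1+ (ℕ.pred k)))
      distribute : ∀ D n₁ n₂ n₃ n₄ n₅ → D * (+ 9 * n₂ + + 3 * n₅ - (+ 4 * n₁ + + 3 * n₃ + + 5 * n₄)) ≡
        + 9 * (D * n₂) + + 3 * (D * n₅) - (+ 4 * (D * n₁) + + 3 * (D * n₃) + + 5 * (D * n₄))
      distribute = solve-∀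
      substitute : ∀ {m₁ m₂ m₃ m₄ m₅} → m₁ ≡ a + + 1 * (b + + 1 * c) → m₂ ≡ a + + 2 * (b + + 2 * c) →
        m₃ ≡ a + + 3 * (b + + 3 * c) → m₄ ≡ a + + 4 * (b + + 4 * c) → m₅ ≡ a + + 5 * (b + + 5 * c) →
        + 9 * m₂ + + 3 * m₅ - (+ 4 * m₁ + + 3 * m₃ + + 5 * m₄) ≡ 0ℤ
      substitute refl refl refl refl refl = annihilated a b c
        where
        annihilated : ∀ a b c → + 9 * (a + + 2 * (b + + 2 * c)) + + 3 * (a + + 5 * (b + + 5 * c)) -
          (+ 4 * (a + + 1 * (b + + 1 * c)) + + 3 * (a + + 3 * (b + + 3 * c)) + + 5 * (a + + 4 * (b + + 4 * c))) ≡ 0ℤ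
        annihilated = solve-∀

-- From rational polygons to cones

ℚ-ring : AlmostCommutativeRing 0ℓ 0ℓ
ℚ-ring = fromCommutativeRing ℚ.+-*-commutativeRing (λ _ → nothing)

record Rep (q : ℚ) (z : ℤ) : Set where
  constructor represents
  field unrep : q ≡ z / 1
open Rep

/1-rep : ∀ z → Rep (z / 1) z
/1-rep z = represents refl

private
  toℚᵘ-/1 : ∀ z → ℚ.toℚᵘ (z / 1) ℚᵘ.≃ mkℚᵘ z 0
  toℚᵘ-/1 z = ℚ.toℚᵘ-fromℚᵘ (mkℚᵘ z 0)

infixl 6 _+ᴿ_ _-ᴿ_
infixl 7 _*ᴿ_

_+ᴿ_ : ∀ {p q x y} → Rep p x → Rep q y → Rep (p ℚ.+ q) (x + y)
_+ᴿ_ {x = x} {y} (represents refl) (represents refl) = represents (ℚ.toℚᵘ-injective (ℚᵘ.≃-trans (ℚ.toℚᵘ-homo-+ (x / 1) (y / 1))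
  (ℚᵘ.≃-trans (ℚᵘ.+-cong (toℚᵘ-/1 x) (toℚᵘ-/1 y)) (ℚᵘ.≃-trans (*≡* (generic x y)) (ℚᵘ.≃-sym (toℚᵘ-/1 (x + y)))))))
  where
  generic : ∀ x y → (x * + 1 + y * + 1) * + 1 ≡ (x + y) * + 1
  generic = solve-∀

_*ᴿ_ : ∀ {p q x y} → Rep p x → Rep q y → Rep (p ℚ.* q) (x * y)
_*ᴿ_ {x = x} {y} (represents refl) (represents refl) = represents (ℚ.toℚᵘ-injective (ℚᵘ.≃-trans (ℚ.toℚᵘ-homo-* (x / 1) (y / 1))
  (ℚᵘ.≃-trans (ℚᵘ.*-cong (toℚᵘ-/1 x) (toℚᵘ-/1 y)) (ℚᵘ.≃-sym (toℚᵘ-/1 (x * y))))))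

-ᴿ_ : ∀ {p x} → Rep p x → Rep (ℚ.- p) (- x)
-ᴿ_ {x = x} (represents refl) = represents (ℚ.toℚᵘ-injective (ℚᵘ.≃-trans (ℚ.toℚᵘ-homo‿- (x / 1))
  (ℚᵘ.≃-trans (ℚᵘ.-‿cong (toℚᵘ-/1 x)) (ℚᵘ.≃-sym (toℚᵘ-/1 (- x))))))

_-ᴿ_ : ∀ {p q x y} → Rep p x → Rep q y → Rep (p ℚ.- q) (x - y)
p -ᴿ q = p +ᴿ (-ᴿ q)

/1-mono-≤ : ∀ {x y} → x ≤ y → x / 1 ℚ.≤ y / 1
/1-mono-≤ {x} {y} p = ℚ.toℚᵘ-cancel-≤ (ℚᵘ.≤-respˡ-≃ (ℚᵘ.≃-sym (toℚᵘ-/1 x)) (ℚᵘ.≤-respʳ-≃ (ℚᵘ.≃-sym (toℚᵘ-/1 y))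
  (*≤* (ℤ.*-monoʳ-≤-nonNeg (+ 1) p))))

/1-mono-< : ∀ {x y} → x < y → x / 1 ℚ.< y / 1
/1-mono-< {x} {y} p = ℚ.toℚᵘ-cancel-< (ℚᵘ.<-respˡ-≃ (ℚᵘ.≃-sym (toℚᵘ-/1 x)) (ℚᵘ.<-respʳ-≃ (ℚᵘ.≃-sym (toℚᵘ-/1 y))
  (*<* (ℤ.*-monoʳ-<-pos (+ 1) p))))

/1-cancel-≤ : ∀ {x y} → x / 1 ℚ.≤ y / 1 → x ≤ y
/1-cancel-≤ {x} {y} p = ℤ.≮⇒≥ λ q → ℚ.<-irrefl refl (ℚ.<-≤-trans (/1-mono-< q) p)

/1-cancel-< : ∀ {x y} → x / 1 ℚ.< y / 1 → x < y
/1-cancel-< {x} {y} p = ℤ.≰⇒> λ q → ℚ.<-irrefl refl (ℚ.<-≤-trans p (/1-mono-≤ q))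

/1-injective : ∀ {x y} → x / 1 ≡ y / 1 → x ≡ y
/1-injective eq = ℤ.≤-antisym (/1-cancel-≤ (ℚ.≤-reflexive eq)) (/1-cancel-≤ (ℚ.≤-reflexive (sym eq)))

-- The square of 2: a cross product is bilinear, and doubling makes each of its factors integral.
four : ℚ
four = + 4 / 1

module Sign {c : ℚ} {n : ℤ} (scaled-rep : Rep (four ℚ.* c) n) where

  pos⁺ : 0ℚ ℚ.< c → 0ℤ < n
  pos⁺ p = /1-cancel-< (subst₂ ℚ._<_ (ℚ.*-zeroʳ four) (unrep scaled-rep) (ℚ.*-monoʳ-<-pos four p))

  neg⁺ : c ℚ.< 0ℚ → n < 0ℤ
  neg⁺ p = /1-cancel-< (subst₂ ℚ._<_ (unrep scaled-rep) (ℚ.*-zeroʳ four) (ℚ.*-monoʳ-<-pos four p))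

  zero⁺ : c ≡ 0ℚ → n ≡ 0ℤ
  zero⁺ refl = /1-injective (trans (sym (unrep scaled-rep)) (ℚ.*-zeroʳ four))

  nonNeg⁺ : 0ℚ ℚ.≤ c → 0ℤ ≤ n
  nonNeg⁺ p = /1-cancel-≤ (subst₂ ℚ._≤_ (ℚ.*-zeroʳ four) (unrep scaled-rep) (ℚ.*-monoˡ-≤-nonNeg four p))

  nonNeg⁻ : 0ℤ ≤ n → 0ℚ ℚ.≤ c
  nonNeg⁻ p = ℚ.≮⇒≥ λ q → ℤ.<-irrefl refl (ℤ.<-≤-trans (neg⁺ q) p)

  pos⁻ : 0ℤ < n → 0ℚ ℚ.< c
  pos⁻ p = ℚ.≰⇒> λ q → case ℚ.<-cmp c 0ℚ of λ
    { (tri< c<0 _ _) → ℤ.<-asym p (neg⁺ c<0)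
    ; (tri≈ _ c≡0 _) → ℤ.<-irrefl (sym (zero⁺ c≡0)) p
    ; (tri> _ _ c>0) → ℚ.<-irrefl refl (ℚ.<-≤-trans c>0 q) }

  zero⁻ : n ≡ 0ℤ → c ≡ 0ℚ
  zero⁻ n≡0 = case ℚ.<-cmp c 0ℚ of λ
    { (tri< c<0 _ _) → ⊥-elim (ℤ.<-irrefl n≡0 (neg⁺ c<0))
    ; (tri≈ _ c≡0 _) → c≡0
    ; (tri> _ _ c>0) → ⊥-elim (ℤ.<-irrefl (sym n≡0) (pos⁺ c>0)) }

numerator-rep : ∀ q → IsIntegral q → Rep q (ℚ.↥ q)
numerator-rep q@(ℚ.mkℚ _ zero _) refl = represents (sym (ℚ.↥p/↧p≡p q))

clear-denominator : ∀ q → Rep ((ℚ.↧ q / 1) ℚ.* q) (ℚ.↥ q)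
clear-denominator q@(ℚ.mkℚ n d _) = represents (ℚ.toℚᵘ-injective (ℚᵘ.≃-trans (ℚ.toℚᵘ-homo-* (+ suc d / 1) q)
  (ℚᵘ.≃-trans (ℚᵘ.*-cong (toℚᵘ-/1 (+ suc d)) (ℚᵘ.≃-refl {mkℚᵘ n d}))
    (ℚᵘ.≃-trans (*≡* (trans (generic (+ suc d) n) (cong (λ e → n * (+ e)) (cong suc (sym (ℕ.+-identityʳ d)))))) (ℚᵘ.≃-sym (toℚᵘ-/1 n))))))
  where
  generic : ∀ d n → d * n * + 1 ≡ n * d
  generic = solve-∀

evalℤ-scale : ∀ d cs t → evalℤ (map (d *_) cs) t ≡ d * evalℤ cs t
evalℤ-scale d [] t = sym (ℤ.*-zeroʳ d)
evalℤ-scale d (c ∷ cs) t = subst (λ e → d * c + t * e ≡ d * (c + t * evalℤ cs t)) (sym (evalℤ-scale d cs t)) (generic d c t (evalℤ cs t))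
  where
  generic : ∀ d c t e → d * c + t * (d * e) ≡ d * (c + t * e)
  generic = solve-∀

clear-denominators : ∀ cs → ∃₂ λ D cs′ → 0ℤ < D × (∀ z → Rep ((D / 1) ℚ.* evalPoly cs (z / 1)) (evalℤ cs′ z))
clear-denominators [] = 1ℤ , [] , 0<1+ 0 , λ z → represents (ℚ.*-zeroʳ (1ℤ / 1))
clear-denominators (c ∷ cs) with clear-denominators cs
... | D , cs′ , D>0 , rep = d * D , n * D ∷ map (d *_) cs′ , 0<1+ (ℚ.denominator-1 c) ⊗₊ D>0 , λ z → represents
  (trans (cong (λ e → e ℚ.* (c ℚ.+ (z / 1) ℚ.* evalPoly cs (z / 1))) (sym (unrep (/1-rep d *ᴿ /1-rep D))))
    (trans (expand (d / 1) (D / 1) c (z / 1) (evalPoly cs (z / 1)))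
      (trans (unrep (clear-denominator c *ᴿ /1-rep D +ᴿ /1-rep z *ᴿ (/1-rep d *ᴿ rep z)))
        (cong (_/ 1) (regroup z)))))
  where
  d n : ℤ
  d = ℚ.↧ c
  n = ℚ.↥ c
  regroup : ∀ z → n * D + z * (d * evalℤ cs′ z) ≡ n * D + z * evalℤ (map (d *_) cs′) z
  regroup z = subst (λ e → n * D + z * (d * evalℤ cs′ z) ≡ n * D + z * e) (sym (evalℤ-scale d cs′ z)) refl
  expand : ∀ d D c z q → d ℚ.* D ℚ.* (c ℚ.+ z ℚ.* q) ≡ d ℚ.* c ℚ.* D ℚ.+ z ℚ.* (d ℚ.* (D ℚ.* q))
  expand = RingSolver.solve-∀ ℚ-ring

-- Edges of a half-integral polygon as integer forms

two : ℚ
two = + 2 / 1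

abstract
  -- 2a for a half-integral point a; the numerators are meaningless for other points.
  W : Point → LatticePoint
  W (a₁ , a₂) = ℚ.↥ (two ℚ.* a₁) , ℚ.↥ (two ℚ.* a₂)

  W-rep : ∀ a → IsIntegral (proj₁ (scaleᵖ 2 a)) × IsIntegral (proj₂ (scaleᵖ 2 a)) →
    Rep (two ℚ.* proj₁ a) (proj₁ (W a)) × Rep (two ℚ.* proj₂ a) (proj₂ (W a))
  W-rep (a₁ , a₂) (p , q) = numerator-rep (two ℚ.* a₁) p , numerator-rep (two ℚ.* a₂) q

Half : Point → Set
Half a = Rep (two ℚ.* proj₁ a) (proj₁ (W a)) × Rep (two ℚ.* proj₂ a) (proj₂ (W a))

-- The determinant of B - A and 2(x , y) - kA, where A and B are the doubled endpoints of an edge;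
-- it is positive to the left of that edge of kP.
edgeForm : LatticePoint → LatticePoint → Form
edgeForm (A₁ , A₂) (B₁ , B₂) = - (+ 2 * (B₂ - A₂)) , + 2 * (B₁ - A₁) , (B₂ - A₂) * A₁ - (B₁ - A₁) * A₂

-- Since the edge vector is scaled by k as well, an extra factor k appears; it is cancelled in the
-- passage to the cone, where k ≥ 1.
dilate-rep : ∀ {a b} → Half a → Half b → ∀ k x y →
  Rep (four ℚ.* cross (scaleᵖ k b -ᵖ scaleᵖ k a) (ι (x , y) -ᵖ scaleᵖ k a)) (+ k * ev (edgeForm (W a) (W b)) x y (+ k))
dilate-rep {a₁ , a₂} {b₁ , b₂} (A₁ , A₂) (B₁ , B₂) k x y = represents (trans
  (identity two (+ k / 1) a₁ a₂ b₁ b₂ (x / 1) (y / 1))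
  (trans (unrep (/1-rep (+ k) *ᴿ ((B₁ -ᴿ A₁) *ᴿ (/1-rep (+ 2) *ᴿ /1-rep y -ᴿ /1-rep (+ k) *ᴿ A₂)
                                  -ᴿ (B₂ -ᴿ A₂) *ᴿ (/1-rep (+ 2) *ᴿ /1-rep x -ᴿ /1-rep (+ k) *ᴿ A₁))))
    (cong (_/ 1) (generic (+ k) x y (proj₁ (W (a₁ , a₂))) (proj₂ (W (a₁ , a₂))) (proj₁ (W (b₁ , b₂))) (proj₂ (W (b₁ , b₂)))))))
  where
  identity : ∀ t K a₁ a₂ b₁ b₂ x y →
    t ℚ.* t ℚ.* ((K ℚ.* b₁ ℚ.- K ℚ.* a₁) ℚ.* (y ℚ.- K ℚ.* a₂) ℚ.- (K ℚ.* b₂ ℚ.- K ℚ.* a₂) ℚ.* (x ℚ.- K ℚ.* a₁)) ≡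
    K ℚ.* ((t ℚ.* b₁ ℚ.- t ℚ.* a₁) ℚ.* (t ℚ.* y ℚ.- K ℚ.* (t ℚ.* a₂)) ℚ.- (t ℚ.* b₂ ℚ.- t ℚ.* a₂) ℚ.* (t ℚ.* x ℚ.- K ℚ.* (t ℚ.* a₁)))
  identity = RingSolver.solve-∀ ℚ-ring
  generic : ∀ k x y A₁ A₂ B₁ B₂ →
    k * ((B₁ - A₁) * (+ 2 * y - k * A₂) - (B₂ - A₂) * (+ 2 * x - k * A₁)) ≡
    k * (- (+ 2 * (B₂ - A₂)) * x + + 2 * (B₁ - A₁) * y + ((B₂ - A₂) * A₁ - (B₁ - A₁) * A₂) * k)
  generic = solve-∀

cross-scaled : ∀ t a₁ a₂ b₁ b₂ x y →
  t ℚ.* t ℚ.* ((b₁ ℚ.- a₁) ℚ.* (y ℚ.- a₂) ℚ.- (b₂ ℚ.- a₂) ℚ.* (x ℚ.- a₁)) ≡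
  (t ℚ.* b₁ ℚ.- t ℚ.* a₁) ℚ.* (t ℚ.* y ℚ.- t ℚ.* a₂) ℚ.- (t ℚ.* b₂ ℚ.- t ℚ.* a₂) ℚ.* (t ℚ.* x ℚ.- t ℚ.* a₁)
cross-scaled = RingSolver.solve-∀ ℚ-ring

point-rep : ∀ {a b} → Half a → Half b → ∀ x y →
  Rep (four ℚ.* cross (b -ᵖ a) (ι (x , y) -ᵖ a)) (ev (edgeForm (W a) (W b)) x y 1ℤ)
point-rep {a₁ , a₂} {b₁ , b₂} (A₁ , A₂) (B₁ , B₂) x y = represents (trans
  (cross-scaled two a₁ a₂ b₁ b₂ (x / 1) (y / 1))
  (trans (unrep ((B₁ -ᴿ A₁) *ᴿ (/1-rep (+ 2) *ᴿ /1-rep y -ᴿ A₂) -ᴿ (B₂ -ᴿ A₂) *ᴿ (/1-rep (+ 2) *ᴿ /1-rep x -ᴿ A₁)))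
    (cong (_/ 1) (generic x y (proj₁ (W (a₁ , a₂))) (proj₂ (W (a₁ , a₂))) (proj₁ (W (b₁ , b₂))) (proj₂ (W (b₁ , b₂)))))))
  where
  generic : ∀ x y A₁ A₂ B₁ B₂ →
    (B₁ - A₁) * (+ 2 * y - A₂) - (B₂ - A₂) * (+ 2 * x - A₁) ≡
    - (+ 2 * (B₂ - A₂)) * x + + 2 * (B₁ - A₁) * y + ((B₂ - A₂) * A₁ - (B₁ - A₁) * A₂) * + 1
  generic = solve-∀

det : LatticePoint → LatticePoint → LatticePoint → ℤ
det (A₁ , A₂) (B₁ , B₂) (C₁ , C₂) = (B₁ - A₁) * (C₂ - A₂) - (B₂ - A₂) * (C₁ - A₁)

abstract
  edgeForm-start : ∀ A B → 0ℤ ≤ ev (edgeForm A B) (proj₁ A) (proj₂ A) (+ 2)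
  edgeForm-start (A₁ , A₂) (B₁ , B₂) = 0≤+ {0} by generic A₁ A₂ B₁ B₂
    where
    generic : ∀ A₁ A₂ B₁ B₂ → + 0 ≡ - (+ 2 * (B₂ - A₂)) * A₁ + + 2 * (B₁ - A₁) * A₂ + ((B₂ - A₂) * A₁ - (B₁ - A₁) * A₂) * + 2
    generic = solve-∀

  edgeForm-end : ∀ A B → 0ℤ ≤ ev (edgeForm A B) (proj₁ B) (proj₂ B) (+ 2)
  edgeForm-end (A₁ , A₂) (B₁ , B₂) = 0≤+ {0} by generic A₁ A₂ B₁ B₂
    where
    generic : ∀ A₁ A₂ B₁ B₂ → + 0 ≡ - (+ 2 * (B₂ - A₂)) * B₁ + + 2 * (B₁ - A₁) * B₂ + ((B₂ - A₂) * A₁ - (B₁ - A₁) * A₂) * + 2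
    generic = solve-∀

  edgeForm-left : ∀ A B C → 0ℤ < det A B C → 0ℤ ≤ ev (edgeForm A B) (proj₁ C) (proj₂ C) (+ 2)
  edgeForm-left (A₁ , A₂) (B₁ , B₂) (C₁ , C₂) p = 0≤+ {2} ⊗ <⇒≤ p by generic A₁ A₂ B₁ B₂ C₁ C₂
    where
    generic : ∀ A₁ A₂ B₁ B₂ C₁ C₂ → + 2 * ((B₁ - A₁) * (C₂ - A₂) - (B₂ - A₂) * (C₁ - A₁)) ≡
      - (+ 2 * (B₂ - A₂)) * C₁ + + 2 * (B₁ - A₁) * C₂ + ((B₂ - A₂) * A₁ - (B₁ - A₁) * A₂) * + 2
    generic = solve-∀

vertex-rep : ∀ {a b c} → Half a → Half b → Half c → Rep (four ℚ.* cross (b -ᵖ a) (c -ᵖ a)) (det (W a) (W b) (W c))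
vertex-rep {a₁ , a₂} {b₁ , b₂} {c₁ , c₂} (A₁ , A₂) (B₁ , B₂) (C₁ , C₂) = represents (trans
  (cross-scaled two a₁ a₂ b₁ b₂ c₁ c₂)
  (unrep ((B₁ -ᴿ A₁) *ᴿ (C₂ -ᴿ A₂) -ᴿ (B₂ -ᴿ A₂) *ᴿ (C₁ -ᴿ A₁))))

-- Neighbouring vertices and duality

module _ {A : Set} where

  zip-∈ : ∀ {a b : A} xs ys → (a , b) ∈ zip xs ys → a ∈ xs × b ∈ ys
  zip-∈ (x ∷ xs) (y ∷ ys) (here refl) = here refl , here refl
  zip-∈ (x ∷ xs) (y ∷ ys) (there p) = let q , r = zip-∈ xs ys p in there q , there r

  consecutive : ∀ xs a b ys (c : A) → (a , b) ∈ zip (xs ++ a ∷ b ∷ ys) (drop 1 (xs ++ a ∷ b ∷ ys) ++ [ c ])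
  consecutive [] a b ys c = here refl
  consecutive (x ∷ []) a b ys c = there (here refl)
  consecutive (x ∷ y ∷ xs) a b ys c = there (consecutive (y ∷ xs) a b ys c)

  closing : ∀ xs (a c : A) → (a , c) ∈ zip (xs ++ [ a ]) (drop 1 (xs ++ [ a ]) ++ [ c ])
  closing [] a c = here refl
  closing (x ∷ []) a c = there (here refl)
  closing (x ∷ y ∷ xs) a c = there (closing (y ∷ xs) a c)

  separate : ∀ xs {a b : A} {ys} → Unique (xs ++ a ∷ ys) → b ∈ ys → a ≢ b
  separate [] (a∉ ∷ᴾ _) b∈ = All.lookup a∉ b∈
  separate (x ∷ xs) (_ ∷ᴾ u) b∈ = separate xs u b∈

edges-∈ : ∀ {a b} vs → (a , b) ∈ edges vs → a ∈ vs × b ∈ vs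
edges-∈ (v ∷ vs) p with zip-∈ (v ∷ vs) (vs ++ [ v ]) p
... | q , r with ∈-++⁻ vs r
... | inj₁ r′ = q , there r′
... | inj₂ (here refl) = q , here refl

edge-consecutive : ∀ xs a b ys → (a , b) ∈ edges (xs ++ a ∷ b ∷ ys)
edge-consecutive [] a b ys = consecutive [] a b ys a
edge-consecutive (x ∷ xs) a b ys = consecutive (x ∷ xs) a b ys x

edge-closing : ∀ x xs a → (a , x) ∈ edges (x ∷ xs ++ [ a ])
edge-closing x xs a = closing (x ∷ xs) a x

Neighbours : List Point → Point → Set
Neighbours vs v = ∃₂ λ u w → (u , v) ∈ edges vs × (v , w) ∈ edges vs × w ≢ u × w ≢ v

-- Three distinct vertices make the predecessor and the successor different. The cases are the
-- vertex in first, inner and last position of the cyclic list.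
neighbours : ∀ {vs v} → 3 ℕ.≤ length vs → Unique vs → v ∈ vs → Neighbours vs v
neighbours {vs} {v} 3≤ uniq v∈ with ∈-∃++ v∈
... | pre , post , refl = cases (initLast pre) post 3≤ uniq
  where
  cases : ∀ {pre} → InitLast pre → ∀ post → 3 ℕ.≤ length (pre ++ v ∷ post) → Unique (pre ++ v ∷ post) →
    Neighbours (pre ++ v ∷ post) v
  cases [] post 3≤ uniq = first (initLast post) 3≤ uniq
    where
    first : ∀ {post} → InitLast post → 3 ℕ.≤ length (v ∷ post) → Unique (v ∷ post) → Neighbours (v ∷ post) v
    first [] (ℕ.s≤s ()) _
    first ([] ∷ʳ′ u) (ℕ.s≤s (ℕ.s≤s ())) _
    first ((w ∷ mid) ∷ʳ′ u) _ uniq = u , w , edge-closing v (w ∷ mid) u , edge-consecutive [] v w (mid ++ [ u ]) ,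
      separate [ v ] uniq (∈-++⁺ʳ mid (here refl)) , λ eq → separate [] uniq (here refl) (sym eq)
  cases (pre ∷ʳ′ u) (w ∷ post) _ uniq = u , w ,
    subst (λ vs → (u , v) ∈ edges vs) (sym shift) (edge-consecutive pre u v (w ∷ post)) ,
    edge-consecutive (pre ++ [ u ]) v w post ,
    (λ eq → separate pre (subst Unique shift uniq) (there (here refl)) (sym eq)) ,
    (λ eq → separate (pre ++ [ u ]) uniq (here refl) (sym eq))
    where
    shift : (pre ++ [ u ]) ++ v ∷ w ∷ post ≡ pre ++ u ∷ v ∷ w ∷ post
    shift = ++-assoc pre [ u ] (v ∷ w ∷ post)
  cases ([] ∷ʳ′ u) [] (ℕ.s≤s (ℕ.s≤s ())) _
  cases ((w ∷ pre) ∷ʳ′ u) [] _ uniq = u , w ,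
    subst (λ vs → (u , v) ∈ edges vs) (sym shift) (edge-consecutive (w ∷ pre) u v []) ,
    edge-closing w (pre ++ [ u ]) v ,
    separate [] uniq (∈-++⁺ˡ (∈-++⁺ʳ pre (here refl))) ,
    separate [] uniq (∈-++⁺ʳ (pre ++ [ u ]) (here refl))
    where
    shift : (w ∷ pre ++ [ u ]) ++ [ v ] ≡ w ∷ pre ++ u ∷ v ∷ []
    shift = ++-assoc (w ∷ pre) [ u ] [ v ]

-- In the basis formed by the two edges at V, the form φ - φ(V) has non-negative coefficients on the cone of the polygon.
abstract
  cone-nonneg : ∀ φ U V W {x y k} → 0ℤ < det U V W → 0ℤ ≤ k →
    0ℤ ≤ ev (edgeForm U V) x y k → 0ℤ ≤ ev (edgeForm V W) x y k → 0ℤ ≤ ev φ (proj₁ V) (proj₂ V) (+ 2) →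
    ev φ (proj₁ V) (proj₂ V) (+ 2) ≤ ev φ (proj₁ U) (proj₂ U) (+ 2) →
    ev φ (proj₁ V) (proj₂ V) (+ 2) ≤ ev φ (proj₁ W) (proj₂ W) (+ 2) → 0ℤ ≤ ev φ x y k
  cone-nonneg (a , b , c) (U₁ , U₂) (V₁ , V₂) (W₁ , W₂) {x} {y} {k} D>0 k≥0 uv vw φV≥0 V≤U V≤W =
    cancel-≤ {+ 2 * ((V₁ - U₁) * (W₂ - U₂) - (V₂ - U₂) * (W₁ - U₁))} {a * x + b * y + c * k} (0<1+ 1 ⊗₊ D>0)
      (vw ⊗ ≤⇒0≤ V≤U ⊕ uv ⊗ ≤⇒0≤ V≤W ⊕ <⇒≤ D>0 ⊗ (k≥0 ⊗ φV≥0)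
        by generic a b c U₁ U₂ V₁ V₂ W₁ W₂ x y k)
    where
    generic : ∀ a b c U₁ U₂ V₁ V₂ W₁ W₂ x y k →
      (- (+ 2 * (W₂ - V₂)) * x + + 2 * (W₁ - V₁) * y + ((W₂ - V₂) * V₁ - (W₁ - V₁) * V₂) * k)
        * (a * U₁ + b * U₂ + c * + 2 - (a * V₁ + b * V₂ + c * + 2))
      + (- (+ 2 * (V₂ - U₂)) * x + + 2 * (V₁ - U₁) * y + ((V₂ - U₂) * U₁ - (V₁ - U₁) * U₂) * k)
        * (a * W₁ + b * W₂ + c * + 2 - (a * V₁ + b * V₂ + c * + 2))
      + ((V₁ - U₁) * (W₂ - U₂) - (V₂ - U₂) * (W₁ - U₁)) * (k * (a * V₁ + b * V₂ + c * + 2)) ≡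
      + 2 * ((V₁ - U₁) * (W₂ - U₂) - (V₂ - U₂) * (W₁ - U₁)) * (a * x + b * y + c * k)
    generic = solve-∀

module FromPolygon (P : Polygon) (halves : All Half (vertices P)) where

  vs : List Point
  vs = vertices P

  polygonGens : List LatticePoint
  polygonGens = map W vs

  edgeForms : List Form
  edgeForms = map (λ (a , b) → edgeForm (W a) (W b)) (edges vs)

  half : ∀ {v} → v ∈ vs → Half v
  half = All.lookup halves

  start-half : ∀ {a b} → (a , b) ∈ edges vs → Half a
  start-half e∈ = half (proj₁ (edges-∈ vs e∈))

  end-half : ∀ {a b} → (a , b) ∈ edges vs → Half b
  end-half e∈ = half (proj₂ (edges-∈ vs e∈))

  convex : ∀ {a b c} → (a , b) ∈ edges vs → c ∈ vs → c ≢ a → c ≢ b → 0ℤ < det (W a) (W b) (W c)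
  convex {a} {b} {c} e∈ c∈ c≢a c≢b = Sign.pos⁺ (vertex-rep {a} {b} {c} (start-half e∈) (end-half e∈) (half c∈))
    (All.lookup (All.lookup (strictlyConvex P) e∈) c∈ c≢a c≢b)

  In′ Int′ : ℤ → ℤ → ℤ → Set
  In′ x y k = All (λ g → 0ℤ ≤ ev g x y k) edgeForms
  Int′ x y k = All (λ g → 0ℤ < ev g x y k) edgeForms

  In-dilate : ∀ k {x y} → In′ x y (+ suc k) → InDilate (suc k) P (ι (x , y))
  In-dilate k {x} {y} p = All.tabulate λ {(a , b)} e∈ → Sign.nonNeg⁻ (dilate-rep {a} {b} (start-half e∈) (end-half e∈) (suc k) x y)
    (0≤+ {suc k} ⊗ All.lookup (All.map⁻ p) e∈)

  dilate-In : ∀ k {x y} → InDilate (suc k) P (ι (x , y)) → In′ x y (+ suc k)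
  dilate-In k {x} {y} p = All.map⁺ (All.tabulate λ {(a , b)} e∈ → cancel-≤ {+ suc k} {ev (edgeForm (W a) (W b)) x y (+ suc k)} (0<1+ k)
    (Sign.nonNeg⁺ (dilate-rep {a} {b} (start-half e∈) (end-half e∈) (suc k) x y) (All.lookup p e∈)))

  Int-interior : ∀ {x y} → InInterior P (ι (x , y)) → Int′ x y 1ℤ
  Int-interior {x} {y} p = All.map⁺ (All.tabulate λ {(a , b)} e∈ →
    Sign.pos⁺ (point-rep {a} {b} (start-half e∈) (end-half e∈) x y) (All.lookup p e∈))

  interior-Int : ∀ {x y} → Int′ x y 1ℤ → InInterior P (ι (x , y))
  interior-Int {x} {y} p = All.tabulate λ {(a , b)} e∈ →
    Sign.pos⁻ (point-rep {a} {b} (start-half e∈) (end-half e∈) x y) (All.lookup (All.map⁻ p) e∈)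

  OnEdge : ℤ → ℤ → Set
  OnEdge x y = Any (λ g → ev g x y 1ℤ ≡ 0ℤ) edgeForms

  boundary-In : ∀ {x y} → OnBoundary P (ι (x , y)) → In′ x y 1ℤ × OnEdge x y
  boundary-In {x} {y} (p , q) = dilate-In 0 p , Any.map⁺ (let (a , b) , e∈ , eq = find q in
    lose e∈ (Sign.zero⁺ (point-rep {a} {b} (start-half e∈) (end-half e∈) x y) eq))

  In-boundary : ∀ {x y} → In′ x y 1ℤ × OnEdge x y → OnBoundary P (ι (x , y))
  In-boundary {x} {y} (p , q) = In-dilate 0 p , (let (a , b) , e∈ , eq = find (Any.map⁻ q) in
    lose e∈ (Sign.zero⁻ (point-rep {a} {b} (start-half e∈) (end-half e∈) x y) eq))

  VertexNonNeg : Point → Point → Point → Set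
  VertexNonNeg a b c = 0ℤ ≤ ev (edgeForm (W a) (W b)) (proj₁ (W c)) (proj₂ (W c)) (+ 2)

  vertex-nonneg : ∀ {a b c} → (a , b) ∈ edges vs → c ∈ vs → Dec (c ≡ a) → Dec (c ≡ b) → VertexNonNeg a b c
  vertex-nonneg {a} {b} e∈ c∈ (yes c≡a) _ = subst (VertexNonNeg a b) (sym c≡a) (edgeForm-start (W a) (W b))
  vertex-nonneg {a} {b} e∈ c∈ (no _) (yes c≡b) = subst (VertexNonNeg a b) (sym c≡b) (edgeForm-end (W a) (W b))
  vertex-nonneg {a} {b} {c} e∈ c∈ (no c≢a) (no c≢b) = edgeForm-left (W a) (W b) (W c) (convex {a} {b} {c} e∈ c∈ c≢a c≢b)

  vertex-In : ∀ {c} → c ∈ vs → In′ (proj₁ (W c)) (proj₂ (W c)) (+ 2)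
  vertex-In {c} c∈ = All.map⁺ (All.tabulate λ {(a , b)} e∈ →
    vertex-nonneg {a} {b} {c} e∈ c∈ (≡-dec ℚ._≟_ ℚ._≟_ c a) (≡-dec ℚ._≟_ ℚ._≟_ c b))

  vertices-In : ∀ {X Y} → (X , Y) ∈ polygonGens → In′ X Y (+ 2)
  vertices-In z∈ = let c , c∈ , eq = ∈-map⁻ W z∈ in
    subst₂ (λ X Y → In′ X Y (+ 2)) (sym (,-injectiveˡ eq)) (sym (,-injectiveʳ eq)) (vertex-In c∈)

  some-vertex : ∃ λ v → v ∈ vs
  some-vertex = cases vs (atLeast3 P)
    where
    cases : ∀ (vs : List Point) → 3 ℕ.≤ length vs → ∃ λ v → v ∈ vs
    cases (v ∷ _) _ = v , here refl

  -- As in the simplex method, a vertex minimising φ suffices: φ does not decrease along its two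
  -- edges, and the polygon lies in the angle that they span.
  duality : ∀ φ → NonNegOn polygonGens φ → ∀ {x y k} → 0ℤ ≤ k → In′ x y k → 0ℤ ≤ ev φ x y k
  duality φ φ≥0 {x} {y} {k} k≥0 p with ∃-max (λ v → - ev φ (proj₁ (W v)) (proj₂ (W v)) (+ 2)) (proj₂ some-vertex)
  ... | v , v∈ , min with neighbours (atLeast3 P) (distinct P) v∈
  ... | u , w , uv∈ , vw∈ , w≢u , w≢v = cone-nonneg φ (W u) (W v) (W w) (convex {u} {v} {w} uv∈ w∈ w≢u w≢v) k≥0
    (All.lookup (All.map⁻ p) uv∈) (All.lookup (All.map⁻ p) vw∈) (φ≥0 (∈-map⁺ W v∈))
    (lowest (proj₁ (edges-∈ vs uv∈))) (lowest w∈)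
    where
    w∈ : w ∈ vs
    w∈ = proj₂ (edges-∈ vs vw∈)
    lowest : ∀ {c} → c ∈ vs → ev φ (proj₁ (W v)) (proj₂ (W v)) (+ 2) ≤ ev φ (proj₁ (W c)) (proj₂ (W c)) (+ 2)
    lowest c∈ = ℤ.neg-cancel-≤ (min c∈)

  body : ∀ {i b} → PseudoIntegral P → InteriorCount P i → BoundaryCount P b → Body i b
  body (cs , polynomial) int bdy = record
    { forms = edgeForms
    ; gens = polygonGens
    ; interior = hasCount-map id id (λ _ → refl) (λ _ → refl) Int-interior interior-Int int
    ; boundary = hasCount-map id id (λ _ → refl) (λ _ → refl) boundary-In In-boundary bdy
    ; gens-In = vertices-In
    ; dual = duality
    ; relation = polynomial-relation (proj₁ cleared) (proj₁ (proj₂ cleared)) (proj₁ (proj₂ (proj₂ cleared))) ehrhart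
    }
    where
    open Counting edgeForms polygonGens duality
    cleared : ∃₂ λ D cs′ → 0ℤ < D × (∀ z → Rep ((D / 1) ℚ.* evalPoly cs (z / 1)) (evalℤ cs′ z))
    cleared = clear-denominators cs
    ehrhart : ∀ k n → 1 ℕ.≤ k → Points k n → proj₁ cleared * + n ≡ evalℤ (proj₁ (proj₂ cleared)) (+ k)
    ehrhart (suc k) n 1≤k c = /1-injective (trans (sym (unrep (/1-rep (proj₁ cleared) *ᴿ /1-rep (+ n))))
      (trans (cong ((proj₁ cleared / 1) ℚ.*_) (polynomial (suc k) n 1≤k
               (hasCount-map id id (λ _ → refl) (λ _ → refl) (In-dilate k) (dilate-In k) c)))
        (unrep (proj₂ (proj₂ (proj₂ cleared)) (+ suc k)))))

theorem6p3 : (P : Polygon) → HalfIntegral P → PseudoIntegral P →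
    (i b : ℕ) → InteriorCount P i → BoundaryCount P b →
    0 ℕ.< i → 2 ℕ.* i ℕ.+ 7 ℕ.≤ b → b ≡ 2 ℕ.* i ℕ.+ 7
theorem6p3 P (integral , _) pseudo i b int bdy 0<i large with b ℕ.≟ 2 ℕ.* i ℕ.+ 7
... | yes eq = eq
... | no b≢ = ℕ.≤-antisym (ℤ.drop‿+≤+ (subst (+ b ≤_) cast (body-bound body′ 0<i 10≤b))) large
  where
  body′ : Body i b
  body′ = FromPolygon.body P (All.map (λ {a} → W-rep a) integral) pseudo int bdy
  cast : + 2 * + i + + 7 ≡ + (2 ℕ.* i ℕ.+ 7)
  cast = trans (cong (_+ + 7) (sym (ℤ.pos-* 2 i))) (sym (ℤ.pos-+ (2 ℕ.* i) 7))
  -- With equality excluded, b ≥ 2i + 8 ≥ 10, one more than the nine residue classes modulo 3.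
  10≤b : 10 ℕ.≤ b
  10≤b = ℕ.≤-trans (ℕ.s≤s (ℕ.+-monoˡ-≤ 7 (ℕ.*-monoʳ-≤ 2 0<i))) (ℕ.≤∧≢⇒< large (λ eq → b≢ (sym eq)))
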